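{- For every integer $r\ge 3$ and every $\varepsilon>0$ there exists a constant $c=c(r,\varepsilon)>0$ such that the following holds. If $G$ is a graph on $n$ vertices with average degree $d$ which has at most $(1-\varepsilon)\frac{n^r}{r!}(d/n)^{\binom{r}{2}}$ copies of $K_r$, then $\mathrm{sp}(G)\ge c\, d^{r-1}/n^{r-3}$.
   Context: All graphs are finite and simple; $n\ge 1$. $K_r$ is the complete graph on $r$ vertices. $\mathrm{mc}(G)$ denotes the maximum number of edges crossing a partition of $V(G)$ into two parts, and $\mathrm{sp}(G)=\mathrm{mc}(G)-e(G)/2$. -}

module Defs where

open import Data.Bool using (Bool; true; false; _∧_; _xor_; if_then_else_; T)
open import Data.Nat as ℕ using (ℕ; zero; suc; _<ᵇ_; _≡ᵇ_; _⊔_)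
open import Data.Fin using (Fin; toℕ)
open import Data.Vec using (Vec; []; _∷_; lookup; count)
open import Data.List using (List; []; _∷_; [_]; _++_; map; concatMap; filterᵇ; length; foldr)
open import Data.List using (allFin)
open import Data.Product using (_×_; _,_)
open import Data.Integer using (+_)
open import Data.Rational using (ℚ; _/_; _*_; _-_; 1ℚ)
open import Relation.Binary.PropositionalEquality using (_≡_)
open import Function using (id)

record Graph (n : ℕ) : Set where
  field
    adj    : Fin n → Fin n → Bool
    sym    : ∀ i j → adj i j ≡ adj j i
    irrefl : ∀ i → adj i i ≡ false
open Graph public

pairs : (n : ℕ) → List (Fin n × Fin n)
pairs n = filterᵇ (λ { (i , j) → toℕ i <ᵇ toℕ j })
                  (concatMap (λ i → map (λ j → (i , j)) (allFin n)) (allFin n))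

e : ∀ {n} → Graph n → ℕ
e {n} G = length (filterᵇ (λ { (i , j) → adj G i j }) (pairs n))

Subset : ℕ → Set
Subset n = Vec Bool n

allSubsets : (n : ℕ) → List (Subset n)
allSubsets zero    = [ [] ]
allSubsets (suc n) = map (true ∷_) (allSubsets n) ++ map (false ∷_) (allSubsets n)

size : ∀ {n} → Subset n → ℕ
size S = count T? S
  where
  open import Relation.Nullary.Decidable using (Dec; yes; no)
  T? : (b : Bool) → Dec (T b)
  T? = Data.Bool.T?
    where import Data.Bool

allᵇ : {A : Set} → (A → Bool) → List A → Bool
allᵇ p = foldr (λ x b → p x ∧ b) true

isClique : ∀ {n} → Graph n → Subset n → Bool
isClique {n} G S =
  allᵇ (λ { (i , j) → if lookup S i ∧ lookup S j then adj G i j else true }) (pairs n)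

copiesK : ∀ {n} → ℕ → Graph n → ℕ
copiesK {n} r G =
  length (filterᵇ (λ S → (size S ≡ᵇ r) ∧ isClique G S) (allSubsets n))

cut : ∀ {n} → Graph n → Subset n → ℕ
cut {n} G S =
  length (filterᵇ (λ { (i , j) → adj G i j ∧ (lookup S i xor lookup S j) }) (pairs n))

mc : ∀ {n} → Graph n → ℕ
mc {n} G = foldr _⊔_ 0 (map (cut G) (allSubsets n))

ℕ→ℚ : ℕ → ℚ
ℕ→ℚ k = (+ k) / 1

sp : ∀ {n} → Graph n → ℚ
sp G = ℕ→ℚ (mc G) - ((+ e G) / 2)

avgDeg : ∀ {n} .{{_ : ℕ.NonZero n}} → Graph n → ℚ
avgDeg {n} G = (+ (2 ℕ.* e G)) / n

_^ℚ_ : ℚ → ℕ → ℚ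
p ^ℚ zero  = 1ℚ
p ^ℚ suc k = p * (p ^ℚ k)

inv : (k : ℕ) → .{{_ : ℕ.NonZero k}} → ℚ
inv k = (+ 1) / k

{-# OPTIONS --safe #-}

-- For x in [-1,1]^V, rounding gives sp(G) ≥ -xᵀAx/4; the same idea rounds a whole family of vectors x_Q with
-- weights q_Q at once, provided Σ_Q q_Q |x_Q| ≤ 1 at every vertex, and yields a constant times
-- Σ_Q q_Q (-x_QᵀAx_Q - δ |x_Q|ᵀA|x_Q|).  Such families are built by induction on r.
--
-- If the vertices of degree much larger than d carry a positive proportion of the edges, either they span a
-- subgraph of larger average degree on at most half of the vertices, and one passes to it, or the cut between
-- them and the rest is large.  Otherwise delete them.  Now the degrees are O(d).  Let s_v be the sum of the
-- degrees of the neighbours of v.  If N(v) has at least (1-η) s_v²/(nd) edges (counted twice) and nearly as many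
-- K_{r-1} as a random graph of its density, for almost all v, then convexity gives more than
-- (1-ε) n^r (d/n)^C(r,2) ordered r-cliques in total, a contradiction.  At every other v there is either a
-- family on N(v) given by induction, or the vector 1_{N(v)} - (s_v/nd) 1, on which the form is negative.
-- Adding these over v with weight of order 1/d respects the budget.

module Submission where

open import Defs
open import Algebra.Bundles using (CommutativeRing)
open import Data.Bool using (Bool; true; false; _∧_; _∨_; _xor_; not; if_then_else_; T?)
open import Data.Bool.Properties using (T-≡; xor-comm)
open import Data.Fin using (Fin; zero; suc; toℕ)
import Data.Fin.Properties
open import Data.Integer as ℤ using (ℤ)
import Data.Integer.Properties as ℤₚ
open import Data.List using (List; []; _∷_; _++_; map; concatMap; filterᵇ; length; foldr; allFin; tabulate)
open import Data.List.Membership.Propositional using (_∈_; lose)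
open import Data.List.Membership.Propositional.Properties
  using (∈-++⁺ˡ; ∈-++⁺ʳ; ∈-map⁺; ∈-filter⁺; ∈-filter⁻; ∈-concatMap⁺; ∈-allFin)
open import Data.List.Relation.Unary.Any using (here; there)
open import Data.Maybe.Base using (just; nothing)
open import Data.Nat as ℕ using (ℕ; zero; suc; _≤_; _!; _∸_; NonZero)
import Data.Nat.Properties as ℕₚ
open import Data.Nat.Properties using (_!≢0; m^n≢0)
open import Data.Nat.Combinatorics using (_C_; nCk+nC[k+1]≡[n+1]C[k+1]; nC1≡n)
open import Data.Nat.Tactic.RingSolver using () renaming (solve-∀ to ℕ-solve-∀)
open import Data.Product using (Σ; Σ-syntax; _×_; _,_; proj₁; proj₂)
open import Data.Rational using (ℚ; 0ℚ; 1ℚ; ½; _/_; toℚᵘ; _<_; _+_; _*_; _-_; -_; _⊓_; 1/_; positive; nonNegative) renaming (_≤_ to _≤ℚ_)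
import Data.Rational.Properties as ℚₚ
open import Data.Rational.Properties
  using ( +-*-commutativeRing; ≤-refl; ≤-trans; ≤-reflexive; <⇒≤; ≰⇒>; <-≤-trans; ≤-<-trans; _≤?_; _≟_; ≤-total
        ; +-mono-≤; +-monoʳ-≤; +-monoˡ-≤; *-assoc; *-comm; *-identityˡ; *-identityʳ; *-zeroˡ; *-zeroʳ
        ; +-identityˡ; module ≤-Reasoning)
import Data.Rational.Unnormalised as ℚᵘ
import Data.Rational.Unnormalised.Properties as ℚᵘₚ
open ℚᵘₚ using (≃-trans; ≃-sym)
open import Data.Sum using (_⊎_; inj₁; inj₂)
open import Data.Unit.Base using (tt)
open import Data.Vec using ([]; _∷_; lookup; _[_]≔_; replicate)
open import Data.Vec.Properties using (lookup∘updateAt′)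
open import Function using (_∘_)
open import Function.Bundles using (Equivalence)
open import Level using (0ℓ)
open import Relation.Binary.Definitions using (tri<; tri≈; tri>)
open import Relation.Binary.PropositionalEquality using (_≡_; refl; trans; cong; cong₂; subst; subst₂; module ≡-Reasoning) renaming (sym to ≡-sym)
open import Relation.Nullary using (Dec; does; yes; no; ¬_; contradiction)
open import Relation.Nullary.Decidable using (dec-true; dec-false)
open import Tactic.RingSolver using (solve-∀)
import Tactic.RingSolver.Core.AlmostCommutativeRing as ACR
open import Algebra.Properties.Semiring.Sum (CommutativeRing.semiring +-*-commutativeRing)
  using (sum; sum-cong-≗; ∑-distrib-+; ∑-comm; *-distribˡ-sum; sum-replicate-zero)

-- The induction cannot run on sp itself: a good cut of N(v) says nothing about the edges that leave
-- N(v), and the neighbourhoods overlap. What does add up is a family of vectors supported in N(v),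
-- with a bound on its total mass at every vertex. Rounded one after another with random signs,
-- distinct vectors have cross terms of mean zero, and the only loss is that later vectors partly
-- erase earlier ones. If every vertex carries mass at most δ/2, that loss is at most δ |x|ᵀA|x| for
-- each x. So the penalty is carried through the whole induction. The orders of magnitude fit: with
-- p = d/n, a typical N(v) has pn vertices and density p and yields p^(k-1) (pn)², where k = r-1; n
-- of these with weight 1/(pn) give p^k n² = d^k / n^(k-2). Degrees have to be O(d) because a vertex
-- of larger degree lies in too many neighbourhoods and would exceed its budget. Every estimate is
-- polynomial, with Bernoulli's inequality in place of Jensen's, so rational numbers suffice.

ℚ-ring : ACR.AlmostCommutativeRing 0ℓ 0ℓ
ℚ-ring = ACR.fromCommutativeRing +-*-commutativeRing isZero
  where
  isZero : ∀ x → _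
  isZero x with 0ℚ ≟ x
  ... | yes p = just p
  ... | no  _ = nothing

-- Inequalities between rationals.

0≤-resp : ∀ {p q} → p ≡ q → 0ℚ ≤ℚ q → 0ℚ ≤ℚ p
0≤-resp refl h = h

≤⇒0≤ : ∀ {p q} → p ≤ℚ q → 0ℚ ≤ℚ q - p
≤⇒0≤ {p} {q} h = subst (_≤ℚ q - p) (ℚₚ.+-inverseʳ p) (+-monoˡ-≤ (- p) h)

≤-by : ∀ {p q e} → q - p ≡ e → 0ℚ ≤ℚ e → p ≤ℚ q
≤-by {p} {q} refl h = subst₂ _≤ℚ_ (+-identityˡ p) (cancel q p) (+-monoˡ-≤ p h)
  where
  cancel : ∀ q p → (q - p) + p ≡ q
  cancel = solve-∀ ℚ-ring

0≤+ : ∀ {p q} → 0ℚ ≤ℚ p → 0ℚ ≤ℚ q → 0ℚ ≤ℚ p + q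
0≤+ hp hq = +-mono-≤ hp hq

*-monoˡ : ∀ {r p q} → 0ℚ ≤ℚ r → p ≤ℚ q → r * p ≤ℚ r * q
*-monoˡ {r} hr h = ℚₚ.*-monoˡ-≤-nonNeg r {{nonNegative hr}} h

*-monoʳ : ∀ {r p q} → 0ℚ ≤ℚ r → p ≤ℚ q → p * r ≤ℚ q * r
*-monoʳ {r} hr h = ℚₚ.*-monoʳ-≤-nonNeg r {{nonNegative hr}} h

0≤* : ∀ {p q} → 0ℚ ≤ℚ p → 0ℚ ≤ℚ q → 0ℚ ≤ℚ p * q
0≤* {p} {q} hp hq = subst (_≤ℚ p * q) (*-zeroʳ p) (*-monoˡ hp hq)

*-mono : ∀ {p q r s} → 0ℚ ≤ℚ p → p ≤ℚ q → 0ℚ ≤ℚ r → r ≤ℚ s → p * r ≤ℚ q * s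
*-mono hp pq hr rs = ≤-trans (*-monoʳ hr pq) (*-monoˡ (≤-trans hp pq) rs)

0<* : ∀ {p q} → 0ℚ < p → 0ℚ < q → 0ℚ < p * q
0<* {p} {q} hp hq = subst (_< p * q) (*-zeroʳ p) (ℚₚ.*-monoʳ-<-pos p {{positive hp}} hq)

*-cancel : ∀ {r p q} → 0ℚ < r → r * p ≤ℚ r * q → p ≤ℚ q
*-cancel {r} hr h = ℚₚ.*-cancelˡ-≤-pos r {{positive hr}} h

square-nonneg : ∀ p → 0ℚ ≤ℚ p * p
square-nonneg p with ≤-total 0ℚ p
... | inj₁ h = 0≤* h h
... | inj₂ h = 0≤-resp (neg² p) (0≤* (ℚₚ.neg-antimono-≤ h) (ℚₚ.neg-antimono-≤ h))
  where
  neg² : ∀ p → p * p ≡ (- p) * (- p)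
  neg² = solve-∀ ℚ-ring

inverse : ∀ {p} → 0ℚ < p → Σ[ i ∈ ℚ ] (0ℚ < i) × (p * i ≡ 1ℚ)
inverse {p} h = (1/ p) {{nz}} , ℚₚ.positive⁻¹ _ {{ℚₚ.1/pos⇒pos p {{positive h}}}} , ℚₚ.*-inverseʳ p {{nz}}
  where
  nz = ℚₚ.pos⇒nonZero p {{positive h}}

0<⊓ : ∀ {p q} → 0ℚ < p → 0ℚ < q → 0ℚ < p ⊓ q
0<⊓ {p} {q} hp hq with ℚₚ.⊓-sel p q
... | inj₁ e = subst (0ℚ <_) (≡-sym e) hp
... | inj₂ e = subst (0ℚ <_) (≡-sym e) hq

0≤1 : 0ℚ ≤ℚ 1ℚ
0≤1 = ℚₚ.nonNegative⁻¹ 1ℚ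

0≤½ : 0ℚ ≤ℚ ½
0≤½ = ℚₚ.nonNegative⁻¹ ½

0<½ : 0ℚ < ½
0<½ = ℚₚ.positive⁻¹ ½

0<1 : 0ℚ < 1ℚ
0<1 = ℚₚ.positive⁻¹ 1ℚ

2ℚ 3ℚ 4ℚ 8ℚ : ℚ
2ℚ = ℕ→ℚ 2
3ℚ = ℕ→ℚ 3
4ℚ = ℕ→ℚ 4
8ℚ = ℕ→ℚ 8

-- Natural numbers as rationals, and powers.

ℕ→ℚ-nonneg : ∀ k → 0ℚ ≤ℚ ℕ→ℚ k
ℕ→ℚ-nonneg k = ℚₚ.nonNegative⁻¹ (ℕ→ℚ k) {{ℚₚ.normalize-nonNeg k 1}}

toℚᵘ-/ : ∀ i m → ℚᵘ._≃_ (toℚᵘ (i / suc m)) (ℚᵘ.mkℚᵘ i m)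
toℚᵘ-/ i m = ℚₚ.toℚᵘ-fromℚᵘ (ℚᵘ.mkℚᵘ i m)

ℕ→ℚ-+ : ∀ m k → ℕ→ℚ (m ℕ.+ k) ≡ ℕ→ℚ m + ℕ→ℚ k
ℕ→ℚ-+ m k = ℚₚ.toℚᵘ-injective (≃-trans (toℚᵘ-/ (ℤ.+ (m ℕ.+ k)) 0) (≃-trans (ℚᵘ.*≡* eq)
  (≃-sym (≃-trans (ℚₚ.toℚᵘ-homo-+ (ℕ→ℚ m) (ℕ→ℚ k)) (ℚᵘₚ.+-cong (toℚᵘ-/ (ℤ.+ m) 0) (toℚᵘ-/ (ℤ.+ k) 0))))))
  where
  eq : (ℤ.+ (m ℕ.+ k)) ℤ.* (ℤ.+ 1) ≡ ((ℤ.+ m) ℤ.* (ℤ.+ 1) ℤ.+ (ℤ.+ k) ℤ.* (ℤ.+ 1)) ℤ.* (ℤ.+ 1)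
  eq = cong (ℤ._* (ℤ.+ 1)) (≡-sym (cong₂ ℤ._+_ (ℤₚ.*-identityʳ (ℤ.+ m)) (ℤₚ.*-identityʳ (ℤ.+ k))))

ℕ→ℚ-suc : ∀ k → ℕ→ℚ (suc k) ≡ 1ℚ + ℕ→ℚ k
ℕ→ℚ-suc = ℕ→ℚ-+ 1

/-*-cancel : ∀ i k .{{_ : NonZero k}} → (i / k) * ℕ→ℚ k ≡ i / 1
/-*-cancel i k@(suc m) = ℚₚ.toℚᵘ-injective (≃-trans (ℚₚ.toℚᵘ-homo-* (i / k) (ℕ→ℚ k))
  (≃-trans (ℚᵘₚ.*-cong (toℚᵘ-/ i m) (toℚᵘ-/ (ℤ.+ k) 0))
  (≃-trans (ℚᵘ.*≡* eq) (≃-sym (toℚᵘ-/ i 0)))))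
  where
  eq : (i ℤ.* (ℤ.+ k)) ℤ.* (ℤ.+ 1) ≡ i ℤ.* (ℤ.+ (k ℕ.* 1))
  eq = trans (ℤₚ.*-identityʳ _) (cong (λ z → i ℤ.* (ℤ.+ z)) (≡-sym (ℕₚ.*-identityʳ k)))

ℕ→ℚ-* : ∀ m k → ℕ→ℚ (m ℕ.* k) ≡ ℕ→ℚ m * ℕ→ℚ k
ℕ→ℚ-* zero    k = ≡-sym (*-zeroˡ (ℕ→ℚ k))
ℕ→ℚ-* (suc m) k = begin
  ℕ→ℚ (k ℕ.+ m ℕ.* k)       ≡⟨ ℕ→ℚ-+ k (m ℕ.* k) ⟩
  ℕ→ℚ k + ℕ→ℚ (m ℕ.* k)     ≡⟨ cong (ℕ→ℚ k +_) (ℕ→ℚ-* m k) ⟩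
  ℕ→ℚ k + ℕ→ℚ m * ℕ→ℚ k     ≡⟨ shift (ℕ→ℚ k) (ℕ→ℚ m) ⟩
  (1ℚ + ℕ→ℚ m) * ℕ→ℚ k      ≡⟨ cong (_* ℕ→ℚ k) (ℕ→ℚ-suc m) ⟨
  ℕ→ℚ (suc m) * ℕ→ℚ k       ∎
  where
  open ≡-Reasoning
  shift : ∀ x y → x + y * x ≡ (1ℚ + y) * x
  shift = solve-∀ ℚ-ring

ℕ→ℚ-^ : ∀ m k → ℕ→ℚ (m ℕ.^ k) ≡ ℕ→ℚ m ^ℚ k
ℕ→ℚ-^ m zero    = refl
ℕ→ℚ-^ m (suc k) = trans (ℕ→ℚ-* m (m ℕ.^ k)) (cong (ℕ→ℚ m *_) (ℕ→ℚ-^ m k))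

1≤ℕ→ℚ-suc : ∀ k → 1ℚ ≤ℚ ℕ→ℚ (suc k)
1≤ℕ→ℚ-suc k = ≤-by (trans (cong (_- 1ℚ) (ℕ→ℚ-suc k)) (shift (ℕ→ℚ k))) (ℕ→ℚ-nonneg k)
  where
  shift : ∀ x → 1ℚ + x - 1ℚ ≡ x
  shift = solve-∀ ℚ-ring

^-nonneg : ∀ {p} k → 0ℚ ≤ℚ p → 0ℚ ≤ℚ p ^ℚ k
^-nonneg zero    h = 0≤1
^-nonneg (suc k) h = 0≤* h (^-nonneg k h)

^-pos : ∀ {p} k → 0ℚ < p → 0ℚ < p ^ℚ k
^-pos zero    h = 0<1
^-pos (suc k) h = 0<* h (^-pos k h)

^-mono : ∀ {p q} k → 0ℚ ≤ℚ p → p ≤ℚ q → p ^ℚ k ≤ℚ q ^ℚ k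
^-mono zero    hp h = ≤-refl
^-mono (suc k) hp h = *-mono hp h (^-nonneg k hp) (^-mono k hp h)

^-≤1 : ∀ {p} k → 0ℚ ≤ℚ p → p ≤ℚ 1ℚ → p ^ℚ k ≤ℚ 1ℚ
^-≤1 zero    hp h = ≤-refl
^-≤1 (suc k) hp h = *-mono hp h (^-nonneg k hp) (^-≤1 k hp h)

^-+ : ∀ p m k → p ^ℚ (m ℕ.+ k) ≡ p ^ℚ m * p ^ℚ k
^-+ p zero    k = ≡-sym (*-identityˡ (p ^ℚ k))
^-+ p (suc m) k = trans (cong (p *_) (^-+ p m k)) (≡-sym (*-assoc p (p ^ℚ m) (p ^ℚ k)))

^-* : ∀ p q k → (p * q) ^ℚ k ≡ p ^ℚ k * q ^ℚ k
^-* p q zero    = refl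
^-* p q (suc k) = trans (cong (p * q *_) (^-* p q k)) (swap p q (p ^ℚ k) (q ^ℚ k))
  where
  swap : ∀ a b c d → a * b * (c * d) ≡ a * c * (b * d)
  swap = solve-∀ ℚ-ring

1^ : ∀ k → 1ℚ ^ℚ k ≡ 1ℚ
1^ zero    = refl
1^ (suc k) = trans (*-identityˡ (1ℚ ^ℚ k)) (1^ k)

^-^ : ∀ p m k → (p ^ℚ m) ^ℚ k ≡ p ^ℚ (m ℕ.* k)
^-^ p zero    k = 1^ k
^-^ p (suc m) k = begin
  (p * p ^ℚ m) ^ℚ k          ≡⟨ ^-* p (p ^ℚ m) k ⟩
  p ^ℚ k * (p ^ℚ m) ^ℚ k     ≡⟨ cong (p ^ℚ k *_) (^-^ p m k) ⟩
  p ^ℚ k * p ^ℚ (m ℕ.* k)    ≡⟨ ^-+ p k (m ℕ.* k) ⟨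
  p ^ℚ (k ℕ.+ m ℕ.* k)       ∎
  where open ≡-Reasoning

-- Multiplying the bound for `k` by `x` exceeds the bound for `suc k` by `k` times the square of
-- `x - 1`. This replaces convexity throughout.
bernoulli : ∀ {x} k → 0ℚ ≤ℚ x → 1ℚ + ℕ→ℚ k * (x - 1ℚ) ≤ℚ x ^ℚ k
bernoulli {x} zero    h = ≤-reflexive (base x)
  where
  base : ∀ x → 1ℚ + 0ℚ * (x - 1ℚ) ≡ 1ℚ
  base = solve-∀ ℚ-ring
bernoulli {x} (suc k) h = ≤-trans
  (≤-by (trans (cong (λ z → x * (1ℚ + ℕ→ℚ k * (x - 1ℚ)) - (1ℚ + z * (x - 1ℚ))) (ℕ→ℚ-suc k)) (gap x (ℕ→ℚ k)))
        (0≤* (ℕ→ℚ-nonneg k) (square-nonneg (x - 1ℚ))))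
  (*-monoˡ h (bernoulli k h))
  where
  gap : ∀ x y → x * (1ℚ + y * (x - 1ℚ)) - (1ℚ + (1ℚ + y) * (x - 1ℚ)) ≡ y * ((x - 1ℚ) * (x - 1ℚ))
  gap = solve-∀ ℚ-ring

-- Finite sums and indicators.

sum-mono : ∀ {n} {f g : Fin n → ℚ} → (∀ i → f i ≤ℚ g i) → sum f ≤ℚ sum g
sum-mono {zero}  h = ≤-refl
sum-mono {suc n} h = +-mono-≤ (h zero) (sum-mono (h ∘ suc))

sum-nonneg : ∀ {n} {f : Fin n → ℚ} → (∀ i → 0ℚ ≤ℚ f i) → 0ℚ ≤ℚ sum f
sum-nonneg {zero}  h = ≤-refl
sum-nonneg {suc n} h = 0≤+ (h zero) (sum-nonneg (h ∘ suc))

sum-+ : ∀ {n} (f g : Fin n → ℚ) → sum (λ i → f i + g i) ≡ sum f + sum g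
sum-+ = ∑-distrib-+

sum-*ˡ : ∀ {n} c (f : Fin n → ℚ) → sum (λ i → c * f i) ≡ c * sum f
sum-*ˡ c f = ≡-sym (*-distribˡ-sum c f)

sum-linear : ∀ {n} c d (f g : Fin n → ℚ) → sum (λ i → c * f i + d * g i) ≡ c * sum f + d * sum g
sum-linear c d f g = trans (sum-+ (λ i → c * f i) (λ i → d * g i)) (cong₂ _+_ (sum-*ˡ c f) (sum-*ˡ d g))

sum-swap : ∀ {m n} (f : Fin m → Fin n → ℚ) → sum (λ i → sum (λ j → f i j)) ≡ sum (λ j → sum (λ i → f i j))
sum-swap = ∑-comm

ℕ→ℚ-mono : ∀ {m k} → m ≤ k → ℕ→ℚ m ≤ℚ ℕ→ℚ k
ℕ→ℚ-mono {m} {k} h = subst (λ z → ℕ→ℚ m ≤ℚ ℕ→ℚ z) (ℕₚ.m+[n∸m]≡n h)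
  (≤-by (trans (cong (_- ℕ→ℚ m) (ℕ→ℚ-+ m (k ∸ m))) (cancel (ℕ→ℚ m) (ℕ→ℚ (k ∸ m)))) (ℕ→ℚ-nonneg (k ∸ m)))
  where
  cancel : ∀ x y → x + y - x ≡ y
  cancel = solve-∀ ℚ-ring

ind : Bool → ℚ
ind b = if b then 1ℚ else 0ℚ

ind-nonneg : ∀ b → 0ℚ ≤ℚ ind b
ind-nonneg false = ≤-refl
ind-nonneg true  = 0≤1

ind-≤1 : ∀ b → ind b ≤ℚ 1ℚ
ind-≤1 false = 0≤1
ind-≤1 true  = ≤-refl

ind-∧ : ∀ b c → ind (b ∧ c) ≡ ind b * ind c
ind-∧ true  c = ≡-sym (*-identityˡ (ind c))
ind-∧ false c = ≡-sym (*-zeroˡ (ind c))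

sum₂ : ∀ {m n} → (Fin m → Fin n → ℚ) → ℚ
sum₂ f = sum (λ u → sum (λ w → f u w))

sum₂-cong : ∀ {m n} {f g : Fin m → Fin n → ℚ} → (∀ u w → f u w ≡ g u w) → sum₂ f ≡ sum₂ g
sum₂-cong h = sum-cong-≗ (λ u → sum-cong-≗ (h u))

sum₂-mono : ∀ {m n} {f g : Fin m → Fin n → ℚ} → (∀ u w → f u w ≤ℚ g u w) → sum₂ f ≤ℚ sum₂ g
sum₂-mono h = sum-mono (λ u → sum-mono (h u))

sum₂-linear : ∀ {m n} c d (f g : Fin m → Fin n → ℚ) →
  sum₂ (λ u w → c * f u w + d * g u w) ≡ c * sum₂ f + d * sum₂ g
sum₂-linear c d f g = trans (sum-cong-≗ (λ u → sum-linear c d (f u) (g u)))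
                            (sum-linear c d (λ u → sum (f u)) (λ u → sum (g u)))

-- The bilinear form of the adjacency matrix.

module Form {n} (G : Graph n) where

  a : Fin n → Fin n → ℚ
  a u w = ind (adj G u w)

  a-nonneg : ∀ u w → 0ℚ ≤ℚ a u w
  a-nonneg u w = ind-nonneg (adj G u w)

  B : (Fin n → ℚ) → (Fin n → ℚ) → ℚ
  B f g = sum₂ (λ u w → a u w * (f u * g w))

  B-sym : ∀ f g → B f g ≡ B g f
  B-sym f g = trans (sum-swap (λ u w → a u w * (f u * g w)))
    (sum₂-cong (λ w u → cong₂ _*_ (cong ind (Graph.sym G u w)) (*-comm (f u) (g w))))

  B-linearˡ : ∀ c d f g h → B (λ u → c * f u + d * g u) h ≡ c * B f h + d * B g h
  B-linearˡ c d f g h = trans (sum₂-cong (λ u w → expand c d (a u w) (f u) (g u) (h w)))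
    (sum₂-linear c d (λ u w → a u w * (f u * h w)) (λ u w → a u w * (g u * h w)))
    where
    expand : ∀ c d a f g h → a * ((c * f + d * g) * h) ≡ c * (a * (f * h)) + d * (a * (g * h))
    expand = solve-∀ ℚ-ring

  B-linearʳ : ∀ c d f g h → B h (λ u → c * f u + d * g u) ≡ c * B h f + d * B h g
  B-linearʳ c d f g h = trans (B-sym h (λ u → c * f u + d * g u))
    (trans (B-linearˡ c d f g h) (cong₂ (λ x y → c * x + d * y) (B-sym f h) (B-sym g h)))

  B-quadratic : ∀ c d f g → B (λ u → c * f u + d * g u) (λ u → c * f u + d * g u)
              ≡ c * c * B f f + 2ℚ * (c * d) * B f g + d * d * B g g
  B-quadratic c d f g = begin
    B x x                                                         ≡⟨ B-linearˡ c d f g x ⟩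
    c * B f x + d * B g x                                         ≡⟨ cong₂ (λ y z → c * y + d * z) (B-linearʳ c d f g f) (B-linearʳ c d f g g) ⟩
    c * (c * B f f + d * B f g) + d * (c * B g f + d * B g g)     ≡⟨ cong (λ y → c * (c * B f f + d * B f g) + d * (c * y + d * B g g)) (B-sym g f) ⟩
    c * (c * B f f + d * B f g) + d * (c * B f g + d * B g g)     ≡⟨ collect c d (B f f) (B f g) (B g g) ⟩
    c * c * B f f + 2ℚ * (c * d) * B f g + d * d * B g g          ∎
    where
    open ≡-Reasoning
    x = λ u → c * f u + d * g u
    collect : ∀ c d p q r → c * (c * p + d * q) + d * (c * q + d * r) ≡ c * c * p + 2ℚ * (c * d) * q + d * d * r
    collect = solve-∀ ℚ-ring

  B-mono : ∀ {f f′ g g′} → (∀ u → 0ℚ ≤ℚ f u) → (∀ u → f u ≤ℚ f′ u) → (∀ u → 0ℚ ≤ℚ g u) → (∀ u → g u ≤ℚ g′ u) →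
           B f g ≤ℚ B f′ g′
  B-mono hf ff hg gg = sum₂-mono (λ u w → *-monoˡ (a-nonneg u w) (*-mono (hf u) (ff u) (hg w) (gg w)))

  B-nonneg : ∀ {f g} → (∀ u → 0ℚ ≤ℚ f u) → (∀ u → 0ℚ ≤ℚ g u) → 0ℚ ≤ℚ B f g
  B-nonneg hf hg = sum-nonneg (λ u → sum-nonneg (λ w → 0≤* (a-nonneg u w) (0≤* (hf u) (hg w))))

-- Rounding a family of vectors.

Cube : ∀ {n} → (Fin n → ℚ) → Set
Cube y = ∀ u → (- 1ℚ ≤ℚ y u) × (y u ≤ℚ 1ℚ)

-- A random vector that equals x and -x with probability q/2 each and 0 otherwise; mass dominates |x|.
record Entry (n : ℕ) : Set where
  field
    q        : ℚ
    x mass   : Fin n → ℚ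
    0≤q      : 0ℚ ≤ℚ q
    q≤1      : q ≤ℚ 1ℚ
    -mass≤x  : ∀ u → - mass u ≤ℚ x u
    x≤mass   : ∀ u → x u ≤ℚ mass u
    mass≤1   : ∀ u → mass u ≤ℚ 1ℚ

  0≤mass : ∀ u → 0ℚ ≤ℚ mass u
  0≤mass u = *-cancel (ℚₚ.positive⁻¹ 2ℚ) (≤-by (double (mass u) (x u)) (0≤+ (≤⇒0≤ (-mass≤x u)) (≤⇒0≤ (x≤mass u))))
    where
    double : ∀ m x → 2ℚ * m - 2ℚ * 0ℚ ≡ (x - (- m)) + (m - x)
    double = solve-∀ ℚ-ring

open Entry

budget : ∀ {n} → List (Entry n) → Fin n → ℚ
budget []      u = 0ℚ
budget (E ∷ L) u = q E * mass E u + budget L u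

budget-nonneg : ∀ {n} (L : List (Entry n)) u → 0ℚ ≤ℚ budget L u
budget-nonneg []      u = ≤-refl
budget-nonneg (E ∷ L) u = 0≤+ (0≤* (0≤q E) (0≤mass E u)) (budget-nonneg L u)

-- Rounding a list of entries: starting from a vector y, each entry in turn overwrites y with probability q by
-- (1 - mass) y ± x, which stays in the cube.  The second moments of the result are retain * (y u * y w) + moment.
retain : ∀ {n} → List (Entry n) → Fin n → Fin n → ℚ
retain []      u w = 1ℚ
retain (E ∷ L) u w = retain L u w * (1ℚ - q E + q E * ((1ℚ - mass E u) * (1ℚ - mass E w)))

moment : ∀ {n} → List (Entry n) → Fin n → Fin n → ℚ
moment []      u w = 0ℚ
moment (E ∷ L) u w = moment L u w + retain L u w * q E * (x E u * x E w)

retain-nonneg : ∀ {n} (L : List (Entry n)) u w → 0ℚ ≤ℚ retain L u w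
retain-nonneg []      u w = 0≤1
retain-nonneg (E ∷ L) u w = 0≤* (retain-nonneg L u w)
  (0≤+ (≤⇒0≤ (q≤1 E)) (0≤* (0≤q E) (0≤* (≤⇒0≤ (mass≤1 E u)) (≤⇒0≤ (mass≤1 E w)))))

loss-nonneg : ∀ {n} (E : Entry n) u w → 0ℚ ≤ℚ q E * (mass E u * (1ℚ - mass E w) + mass E w)
loss-nonneg E u w = 0≤* (0≤q E) (0≤+ (0≤* (0≤mass E u) (≤⇒0≤ (mass≤1 E w))) (0≤mass E w))

retain≤1 : ∀ {n} (L : List (Entry n)) u w → retain L u w ≤ℚ 1ℚ
retain≤1 []      u w = ≤-refl
retain≤1 (E ∷ L) u w = ≤-trans
  (≤-by (gap (retain L u w) (q E) (mass E u) (mass E w)) (0≤* (retain-nonneg L u w) (loss-nonneg E u w)))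
  (retain≤1 L u w)
  where
  gap : ∀ r q m k → r - r * (1ℚ - q + q * ((1ℚ - m) * (1ℚ - k))) ≡ r * (q * (m * (1ℚ - k) + k))
  gap = solve-∀ ℚ-ring

-- A union bound: for factors in [0,1] the deficits from 1 add up at most, and the factor of `E` has
-- deficit at most `q E * (mass E u + mass E w)`.
1-retain≤budget : ∀ {n} (L : List (Entry n)) u w → 1ℚ - retain L u w ≤ℚ budget L u + budget L w
1-retain≤budget []      u w = ≤-refl
1-retain≤budget (E ∷ L) u w = ≤-by
  (gap (retain L u w) (q E) (mass E u) (mass E w) (budget L u) (budget L w))
  (0≤+ (0≤+ (≤⇒0≤ (1-retain≤budget L u w)) (0≤* (≤⇒0≤ (retain≤1 L u w)) (loss-nonneg E u w)))
       (0≤* (0≤q E) (0≤* (0≤mass E u) (0≤mass E w))))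
  where
  gap : ∀ r q m k b c → (q * m + b + (q * k + c)) - (1ℚ - r * (1ℚ - q + q * ((1ℚ - m) * (1ℚ - k))))
      ≡ ((b + c) - (1ℚ - r)) + (1ℚ - r) * (q * (m * (1ℚ - k) + k)) + q * (m * k)
  gap = solve-∀ ℚ-ring

-mass*mass≤x*x : ∀ {n} (E : Entry n) u w → 0ℚ ≤ℚ x E u * x E w + mass E u * mass E w
-mass*mass≤x*x E u w = 0≤-resp (polarise (x E u) (x E w) (mass E u) (mass E w))
  (0≤* 0≤½ (0≤+ (0≤* (≤⇒0≤ (-mass≤x E u)) (≤⇒0≤ (-mass≤x E w))) (0≤* (≤⇒0≤ (x≤mass E u)) (≤⇒0≤ (x≤mass E w)))))
  where
  polarise : ∀ x y m k → x * y + m * k ≡ ½ * ((x - (- m)) * (y - (- k)) + (m - x) * (k - y))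
  polarise = solve-∀ ℚ-ring

module Rounding {n} (G : Graph n) where

  open Form G

  -- An upper bound for the expected form that, unlike `form`, is additive over the list, so that
  -- families can be concatenated and scaled.
  cost : ℚ → List (Entry n) → ℚ
  cost δ []      = 0ℚ
  cost δ (E ∷ L) = q E * (B (x E) (x E) + δ * B (mass E) (mass E)) + cost δ L

  -- The expectation of `B` at the vector obtained by rounding `L` from `y`.
  form : List (Entry n) → (Fin n → ℚ) → ℚ
  form L y = sum₂ (λ u w → a u w * (retain L u w * (y u * y w) + moment L u w))

  overwrite⁺ overwrite⁻ : Entry n → (Fin n → ℚ) → Fin n → ℚ
  overwrite⁺ E y u = (1ℚ - mass E u) * y u + x E u
  overwrite⁻ E y u = (1ℚ - mass E u) * y u - x E u

  -- Conditioning on the head of the list, which acts first: `y` survives with probability `1 - q E`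
  -- and otherwise becomes either overwrite with equal probability. The mixed terms in `y` and `x E`
  -- cancel between the two signs.
  form-∷ : ∀ E L y → form (E ∷ L) y
         ≡ (1ℚ - q E) * form L y + q E * ½ * (1ℚ * form L (overwrite⁺ E y) + 1ℚ * form L (overwrite⁻ E y))
  form-∷ E L y = begin
    form (E ∷ L) y
      ≡⟨ sum₂-cong (λ u w → average (a u w) (retain L u w) (moment L u w) (q E) (mass E u) (mass E w) (x E u) (x E w) (y u) (y w)) ⟩
    sum₂ (λ u w → (1ℚ - q E) * F y u w + q E * ½ * (1ℚ * F y⁺ u w + 1ℚ * F y⁻ u w))
      ≡⟨ sum₂-linear (1ℚ - q E) (q E * ½) (F y) (λ u w → 1ℚ * F y⁺ u w + 1ℚ * F y⁻ u w) ⟩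
    (1ℚ - q E) * form L y + q E * ½ * sum₂ (λ u w → 1ℚ * F y⁺ u w + 1ℚ * F y⁻ u w)
      ≡⟨ cong (λ z → (1ℚ - q E) * form L y + q E * ½ * z) (sum₂-linear 1ℚ 1ℚ (F y⁺) (F y⁻)) ⟩
    (1ℚ - q E) * form L y + q E * ½ * (1ℚ * form L y⁺ + 1ℚ * form L y⁻) ∎
    where
    open ≡-Reasoning
    y⁺ = overwrite⁺ E y
    y⁻ = overwrite⁻ E y
    F : (Fin n → ℚ) → Fin n → Fin n → ℚ
    F z u w = a u w * (retain L u w * (z u * z w) + moment L u w)
    average : ∀ a r c q m k X Y y z →
      a * (r * (1ℚ - q + q * ((1ℚ - m) * (1ℚ - k))) * (y * z) + (c + r * q * (X * Y)))
      ≡ (1ℚ - q) * (a * (r * (y * z) + c))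
        + q * ½ * (1ℚ * (a * (r * (((1ℚ - m) * y + X) * ((1ℚ - k) * z + Y)) + c))
                 + 1ℚ * (a * (r * (((1ℚ - m) * y - X) * ((1ℚ - k) * z - Y)) + c)))
    average = solve-∀ ℚ-ring

  overwrite⁺-cube : ∀ E {y} → Cube y → Cube (overwrite⁺ E y)
  overwrite⁺-cube E {y} h u =
      ≤-by (lower (mass E u) (y u) (x E u)) (0≤+ (0≤* 0≤1-m (≤⇒0≤ (proj₁ (h u)))) (≤⇒0≤ (-mass≤x E u)))
    , ≤-by (upper (mass E u) (y u) (x E u)) (0≤+ (0≤* 0≤1-m (≤⇒0≤ (proj₂ (h u)))) (≤⇒0≤ (x≤mass E u)))
    where
    0≤1-m = ≤⇒0≤ (mass≤1 E u)
    lower : ∀ m y x → (1ℚ - m) * y + x - (- 1ℚ) ≡ (1ℚ - m) * (y - (- 1ℚ)) + (x - (- m))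
    lower = solve-∀ ℚ-ring
    upper : ∀ m y x → 1ℚ - ((1ℚ - m) * y + x) ≡ (1ℚ - m) * (1ℚ - y) + (m - x)
    upper = solve-∀ ℚ-ring

  overwrite⁻-cube : ∀ E {y} → Cube y → Cube (overwrite⁻ E y)
  overwrite⁻-cube E {y} h u =
      ≤-by (lower (mass E u) (y u) (x E u)) (0≤+ (0≤* 0≤1-m (≤⇒0≤ (proj₁ (h u)))) (≤⇒0≤ (x≤mass E u)))
    , ≤-by (upper (mass E u) (y u) (x E u)) (0≤+ (0≤* 0≤1-m (≤⇒0≤ (proj₂ (h u)))) (≤⇒0≤ (-mass≤x E u)))
    where
    0≤1-m = ≤⇒0≤ (mass≤1 E u)
    lower : ∀ m y x → (1ℚ - m) * y - x - (- 1ℚ) ≡ (1ℚ - m) * (y - (- 1ℚ)) + (m - x)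
    lower = solve-∀ ℚ-ring
    upper : ∀ m y x → 1ℚ - ((1ℚ - m) * y - x) ≡ (1ℚ - m) * (1ℚ - y) + (x - (- m))
    upper = solve-∀ ℚ-ring

  module _ {S} (bound : ∀ y → Cube y → 0ℚ ≤ℚ S + B y y) where

    -- By `form-∷` the expected form is an average of values of `B` at points of the cube, to each
    -- of which `bound` applies.
    form-bound : ∀ L y → Cube y → 0ℚ ≤ℚ S + form L y
    form-bound []      y h = 0≤-resp (cong (S +_) (sum₂-cong (λ u w → drop (a u w) (y u * y w)))) (bound y h)
      where
      drop : ∀ a z → a * (1ℚ * z + 0ℚ) ≡ a * z
      drop = solve-∀ ℚ-ring
    form-bound (E ∷ L) y h = 0≤-resp
      (trans (cong (S +_) (form-∷ E L y)) (split S (q E) (form L y) (form L (overwrite⁺ E y)) (form L (overwrite⁻ E y))))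
      (0≤+ (0≤* (≤⇒0≤ (q≤1 E)) (form-bound L y h))
           (0≤* (0≤* (0≤q E) 0≤½) (0≤+ (form-bound L (overwrite⁺ E y) (overwrite⁺-cube E h))
                                       (form-bound L (overwrite⁻ E y) (overwrite⁻-cube E h)))))
      where
      split : ∀ S q f g h → S + ((1ℚ - q) * f + q * ½ * (1ℚ * g + 1ℚ * h)) ≡ (1ℚ - q) * (S + f) + q * ½ * ((S + g) + (S + h))
      split = solve-∀ ℚ-ring

  dominating : ℚ → List (Entry n) → Fin n → Fin n → ℚ
  dominating δ []      u w = 0ℚ
  dominating δ (E ∷ L) u w = dominating δ L u w + q E * (x E u * x E w + δ * (mass E u * mass E w))

  -- The factor `retain L u w` has to be replaced by 1, although the product `x E u * x E w` may
  -- have either sign. The change is at most `1 - retain L u w` times the product of the masses, and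
  -- `1-retain≤budget` bounds that deficit by `δ`.
  moment≤dominating : ∀ {δ} L → (∀ u w → budget L u + budget L w ≤ℚ δ) → ∀ u w → moment L u w ≤ℚ dominating δ L u w
  moment≤dominating []      h u w = ≤-refl
  moment≤dominating {δ} (E ∷ L) h u w = +-mono-≤ (moment≤dominating L h′ u w)
    (≤-by (gap (retain L u w) (q E) (x E u * x E w) (mass E u * mass E w) δ)
          (0≤* (0≤q E) (0≤+ (0≤* (≤⇒0≤ (retain≤1 L u w)) (-mass*mass≤x*x E u w))
                            (0≤* (0≤* (0≤mass E u) (0≤mass E w)) (≤⇒0≤ (≤-trans (1-retain≤budget L u w) (h′ u w)))))))
    where
    skip : ∀ v → budget L v ≤ℚ budget (E ∷ L) v
    skip v = ≤-by (cancel (q E * mass E v) (budget L v)) (0≤* (0≤q E) (0≤mass E v))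
      where
      cancel : ∀ p b → p + b - b ≡ p
      cancel = solve-∀ ℚ-ring
    h′ : ∀ u w → budget L u + budget L w ≤ℚ δ
    h′ u w = ≤-trans (+-mono-≤ (skip u) (skip w)) (h u w)
    gap : ∀ r q X M δ → q * (X + δ * M) - r * q * X ≡ q * ((1ℚ - r) * (X + M) + M * (δ - (1ℚ - r)))
    gap = solve-∀ ℚ-ring

  sum₂-dominating : ∀ δ L → sum₂ (λ u w → a u w * dominating δ L u w) ≡ cost δ L
  sum₂-dominating δ [] = trans (sum₂-cong (λ u w → collapse (a u w)))
    (trans (sum₂-linear {n} {n} 0ℚ 0ℚ (λ _ _ → 0ℚ) (λ _ _ → 0ℚ)) (vanish (sum₂ {n} {n} (λ _ _ → 0ℚ))))
    where
    collapse : ∀ a → a * 0ℚ ≡ 0ℚ * 0ℚ + 0ℚ * 0ℚ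
    collapse = solve-∀ ℚ-ring
    vanish : ∀ z → 0ℚ * z + 0ℚ * z ≡ 0ℚ
    vanish = solve-∀ ℚ-ring
  sum₂-dominating δ (E ∷ L) = begin
    sum₂ (λ u w → a u w * (dominating δ L u w + q E * (x E u * x E w + δ * (mass E u * mass E w))))
      ≡⟨ sum₂-cong (λ u w → distribute (a u w) (dominating δ L u w) (q E) (x E u * x E w) δ (mass E u * mass E w)) ⟩
    sum₂ (λ u w → q E * (1ℚ * X u w + δ * M u w) + 1ℚ * (a u w * dominating δ L u w))
      ≡⟨ sum₂-linear (q E) 1ℚ (λ u w → 1ℚ * X u w + δ * M u w) (λ u w → a u w * dominating δ L u w) ⟩
    q E * sum₂ (λ u w → 1ℚ * X u w + δ * M u w) + 1ℚ * sum₂ (λ u w → a u w * dominating δ L u w)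
      ≡⟨ cong₂ (λ y z → q E * y + 1ℚ * z) (sum₂-linear 1ℚ δ X M) (sum₂-dominating δ L) ⟩
    q E * (1ℚ * B (x E) (x E) + δ * B (mass E) (mass E)) + 1ℚ * cost δ L
      ≡⟨ cong₂ (λ y z → q E * (y + δ * B (mass E) (mass E)) + z) (*-identityˡ (B (x E) (x E))) (*-identityˡ (cost δ L)) ⟩
    cost δ (E ∷ L) ∎
    where
    open ≡-Reasoning
    X M : Fin n → Fin n → ℚ
    X u w = a u w * (x E u * x E w)
    M u w = a u w * (mass E u * mass E w)
    distribute : ∀ a d q X δ M → a * (d + q * (X + δ * M)) ≡ q * (1ℚ * (a * X) + δ * (a * M)) + 1ℚ * (a * d)
    distribute = solve-∀ ℚ-ring

  -- Rounding starts from the zero vector, which leaves only the moments.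
  rounding : ∀ {S δ} L → (∀ y → Cube y → 0ℚ ≤ℚ S + B y y) →
             (∀ u w → budget L u + budget L w ≤ℚ δ) → 0ℚ ≤ℚ S + cost δ L
  rounding {S} {δ} L bound h = ≤-trans (form-bound {S} bound L (λ _ → 0ℚ) (λ _ → ℚₚ.nonPositive⁻¹ (- 1ℚ) , 0≤1))
    (+-monoʳ-≤ S (≤-trans
      (sum₂-mono (λ u w → *-monoˡ (a-nonneg u w) (≤-trans (≤-reflexive (drop (retain L u w) (moment L u w))) (moment≤dominating L h u w))))
      (≤-reflexive (sum₂-dominating δ L))))
    where
    drop : ∀ r c → r * (0ℚ * 0ℚ) + c ≡ c
    drop = solve-∀ ℚ-ring

scale : ∀ {n} c → 0ℚ ≤ℚ c → c ≤ℚ 1ℚ → Entry n → Entry n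
scale c hc c≤1 E = record E { q = c * q E ; 0≤q = 0≤* hc (0≤q E) ; q≤1 = *-mono hc c≤1 (0≤q E) (q≤1 E) }

budget-scale : ∀ {n} c hc c≤1 (L : List (Entry n)) u → budget (map (scale c hc c≤1) L) u ≡ c * budget L u
budget-scale c hc c≤1 []      u = ≡-sym (*-zeroʳ c)
budget-scale c hc c≤1 (E ∷ L) u = trans (cong (c * q E * mass E u +_) (budget-scale c hc c≤1 L u))
  (factor c (q E) (mass E u) (budget L u))
  where
  factor : ∀ c q m b → c * q * m + c * b ≡ c * (q * m + b)
  factor = solve-∀ ℚ-ring

budget-++ : ∀ {n} (L M : List (Entry n)) u → budget (L ++ M) u ≡ budget L u + budget M u
budget-++ []      M u = ≡-sym (+-identityˡ (budget M u))
budget-++ (E ∷ L) M u = trans (cong (q E * mass E u +_) (budget-++ L M u)) (≡-sym (ℚₚ.+-assoc (q E * mass E u) (budget L u) (budget M u)))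

-- Certificates: families with a budget and a value.

module Certificate {n} (G : Graph n) where

  open Form G
  open Rounding G

  cost-scale : ∀ δ c hc c≤1 L → cost δ (map (scale c hc c≤1) L) ≡ c * cost δ L
  cost-scale δ c hc c≤1 []      = ≡-sym (*-zeroʳ c)
  cost-scale δ c hc c≤1 (E ∷ L) = trans (cong (c * q E * (B (x E) (x E) + δ * B (mass E) (mass E)) +_) (cost-scale δ c hc c≤1 L))
    (factor c (q E) (B (x E) (x E) + δ * B (mass E) (mass E)) (cost δ L))
    where
    factor : ∀ c q m b → c * q * m + c * b ≡ c * (q * m + b)
    factor = solve-∀ ℚ-ring

  cost-++ : ∀ δ L M → cost δ (L ++ M) ≡ cost δ L + cost δ M
  cost-++ δ []      M = ≡-sym (+-identityˡ (cost δ M))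
  cost-++ δ (E ∷ L) M = trans (cong (q E * (B (x E) (x E) + δ * B (mass E) (mass E)) +_) (cost-++ δ L M))
    (≡-sym (ℚₚ.+-assoc (q E * (B (x E) (x E) + δ * B (mass E) (mass E))) (cost δ L) (cost δ M)))

  cost-mono : ∀ {δ δ′} → δ ≤ℚ δ′ → ∀ L → cost δ L ≤ℚ cost δ′ L
  cost-mono h []      = ≤-refl
  cost-mono h (E ∷ L) = +-mono-≤
    (*-monoˡ (0≤q E) (+-monoʳ-≤ (B (x E) (x E)) (*-monoʳ (B-nonneg (0≤mass E) (0≤mass E)) h))) (cost-mono h L)

  -- The penalty term of weight δ pays for the correlations lost when the entries are rounded jointly.
  Achieves : ℚ → (Fin n → ℚ) → ℚ → Set
  Achieves δ b v = Σ[ L ∈ List (Entry n) ] (∀ u → budget L u ≤ℚ b u) × (cost δ L ≤ℚ - v)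

  achieves-weaken : ∀ {δ δ′ b b′ v v′} → δ′ ≤ℚ δ → (∀ u → b u ≤ℚ b′ u) → v′ ≤ℚ v → Achieves δ b v → Achieves δ′ b′ v′
  achieves-weaken hδ hb hv (L , hL , hc) =
    L , (λ u → ≤-trans (hL u) (hb u)) , ≤-trans (cost-mono hδ L) (≤-trans hc (ℚₚ.neg-antimono-≤ hv))

  achieves-0 : ∀ {δ b} → (∀ u → 0ℚ ≤ℚ b u) → Achieves δ b 0ℚ
  achieves-0 h = [] , h , ≤-refl

  achieves-+ : ∀ {δ b b′ v v′} → Achieves δ b v → Achieves δ b′ v′ → Achieves δ (λ u → b u + b′ u) (v + v′)
  achieves-+ {δ} {v = v} {v′} (L , hL , cL) (M , hM , cM) = L ++ M
    , (λ u → ≤-trans (≤-reflexive (budget-++ L M u)) (+-mono-≤ (hL u) (hM u)))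
    , ≤-trans (≤-reflexive (cost-++ δ L M)) (≤-trans (+-mono-≤ cL cM) (≤-reflexive (≡-sym (ℚₚ.neg-distrib-+ v v′))))

  achieves-sum : ∀ {δ m} (b : Fin m → Fin n → ℚ) (v : Fin m → ℚ) → (∀ i → Achieves δ (b i) (v i)) →
                 Achieves δ (λ u → sum (λ i → b i u)) (sum v)
  achieves-sum {m = zero}  b v h = achieves-0 (λ _ → ≤-refl)
  achieves-sum {m = suc m} b v h = achieves-+ (h zero) (achieves-sum (b ∘ suc) (v ∘ suc) (h ∘ suc))

  achieves-scale : ∀ {δ b v} c → 0ℚ ≤ℚ c → c ≤ℚ 1ℚ → Achieves δ b v → Achieves δ (λ u → c * b u) (c * v)
  achieves-scale {δ} {v = v} c hc c≤1 (L , hL , cL) = map (scale c hc c≤1) L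
    , (λ u → ≤-trans (≤-reflexive (budget-scale c hc c≤1 L u)) (*-monoˡ hc (hL u)))
    , ≤-trans (≤-reflexive (cost-scale δ c hc c≤1 L)) (≤-trans (*-monoˡ hc cL) (≤-reflexive (≡-sym (ℚₚ.neg-distribʳ-* c v))))

  achieves-single : ∀ {δ} x m → (∀ u → - m u ≤ℚ x u) → (∀ u → x u ≤ℚ m u) → (∀ u → m u ≤ℚ 1ℚ) →
                    Achieves δ m (- (B x x + δ * B m m))
  achieves-single {δ} x m -m≤x x≤m m≤1 = (E ∷ [])
    , (λ u → ≤-reflexive (one (m u)))
    , ≤-reflexive (two (B x x + δ * B m m))
    where
    E : Entry n
    E = record { q = 1ℚ ; x = x ; mass = m ; 0≤q = 0≤1 ; q≤1 = ≤-refl ; -mass≤x = -m≤x ; x≤mass = x≤m ; mass≤1 = m≤1 }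
    one : ∀ z → 1ℚ * z + 0ℚ ≡ z
    one = solve-∀ ℚ-ring
    two : ∀ z → 1ℚ * z + 0ℚ ≡ - (- z)
    two = solve-∀ ℚ-ring

  -- Scaling the family by `δ * ½` brings the budgets of any two vertices to a sum of at most `δ`,
  -- as `rounding` requires; this is the factor lost in the conclusion.
  achieves-bound : ∀ {S δ b v} → 0ℚ ≤ℚ δ → δ ≤ℚ 1ℚ → (∀ u → b u ≤ℚ 1ℚ) → (∀ y → Cube y → 0ℚ ≤ℚ S + B y y) →
                   Achieves δ b v → δ * ½ * v ≤ℚ S
  achieves-bound {S} {δ} {b} {v} hδ δ≤1 hb bound A with achieves-scale (δ * ½) (0≤* hδ 0≤½) (*-mono hδ δ≤1 0≤½ (ℚₚ.≤ᵇ⇒≤ {½} {1ℚ} tt)) A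
  ... | L , hL , cL = ≤-by (flip S (δ * ½ * v)) (≤-trans (rounding {S} {δ} L bound total) (+-monoʳ-≤ S cL))
    where
    flip : ∀ S z → S - z ≡ S + - z
    flip = solve-∀ ℚ-ring
    halves : ∀ δ → δ * ½ * 1ℚ + δ * ½ * 1ℚ ≡ δ
    halves = solve-∀ ℚ-ring
    part : ∀ u → budget L u ≤ℚ δ * ½ * 1ℚ
    part u = ≤-trans (hL u) (*-monoˡ (0≤* hδ 0≤½) (hb u))
    total : ∀ u w → budget L u + budget L w ≤ℚ δ
    total u w = ≤-trans (+-mono-≤ (part u) (part w)) (≤-reflexive (halves δ))

-- From points of the cube to cuts.

sign : Bool → ℚ
sign true  = 1ℚ
sign false = - 1ℚ

-- The expectation of F over random subsets that contain u independently with probability (1 + y u) / 2.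
expect : ∀ {n} → (Fin n → ℚ) → (Subset n → ℚ) → ℚ
expect {zero}  y F = F []
expect {suc n} y F = ½ * (1ℚ + y zero) * expect (y ∘ suc) (λ S → F (true ∷ S)) + ½ * (1ℚ - y zero) * expect (y ∘ suc) (λ S → F (false ∷ S))

expect-cong : ∀ {n} (y : Fin n → ℚ) {F F′ : Subset n → ℚ} → (∀ S → F S ≡ F′ S) → expect y F ≡ expect y F′
expect-cong {zero}  y h = h []
expect-cong {suc n} y h = cong₂ (λ p r → ½ * (1ℚ + y zero) * p + ½ * (1ℚ - y zero) * r)
  (expect-cong (y ∘ suc) (λ S → h (true ∷ S))) (expect-cong (y ∘ suc) (λ S → h (false ∷ S)))

expect-nonneg : ∀ {n} (y : Fin n → ℚ) {F : Subset n → ℚ} → Cube y → (∀ S → 0ℚ ≤ℚ F S) → 0ℚ ≤ℚ expect y F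
expect-nonneg {zero}  y hy h = h []
expect-nonneg {suc n} y hy h = 0≤+
  (0≤* (0≤* 0≤½ (0≤-resp (shift (y zero)) (≤⇒0≤ (proj₁ (hy zero))))) (expect-nonneg (y ∘ suc) (hy ∘ suc) (λ S → h (true ∷ S))))
  (0≤* (0≤* 0≤½ (≤⇒0≤ (proj₂ (hy zero)))) (expect-nonneg (y ∘ suc) (hy ∘ suc) (λ S → h (false ∷ S))))
  where
  shift : ∀ z → 1ℚ + z ≡ z - (- 1ℚ)
  shift = solve-∀ ℚ-ring

expect-const : ∀ {n} (y : Fin n → ℚ) c → expect y (λ _ → c) ≡ c
expect-const {zero}  y c = refl
expect-const {suc n} y c = trans (cong (λ z → ½ * (1ℚ + y zero) * z + ½ * (1ℚ - y zero) * z) (expect-const (y ∘ suc) c)) (total (y zero) c)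
  where
  total : ∀ z c → ½ * (1ℚ + z) * c + ½ * (1ℚ - z) * c ≡ c
  total = solve-∀ ℚ-ring

expect-+ : ∀ {n} (y : Fin n → ℚ) (F F′ : Subset n → ℚ) → expect y (λ S → F S + F′ S) ≡ expect y F + expect y F′
expect-+ {zero}  y F F′ = refl
expect-+ {suc n} y F F′ = trans
  (cong₂ (λ p r → ½ * (1ℚ + y zero) * p + ½ * (1ℚ - y zero) * r) (expect-+ (y ∘ suc) _ _) (expect-+ (y ∘ suc) _ _))
  (regroup (½ * (1ℚ + y zero)) (½ * (1ℚ - y zero)) (expect (y ∘ suc) (λ S → F (true ∷ S))) (expect (y ∘ suc) (λ S → F′ (true ∷ S)))
     (expect (y ∘ suc) (λ S → F (false ∷ S))) (expect (y ∘ suc) (λ S → F′ (false ∷ S))))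
  where
  regroup : ∀ a b p p′ r r′ → a * (p + p′) + b * (r + r′) ≡ (a * p + b * r) + (a * p′ + b * r′)
  regroup = solve-∀ ℚ-ring

expect-* : ∀ {n} (y : Fin n → ℚ) c (F : Subset n → ℚ) → expect y (λ S → c * F S) ≡ c * expect y F
expect-* {zero}  y c F = refl
expect-* {suc n} y c F = trans
  (cong₂ (λ p r → ½ * (1ℚ + y zero) * p + ½ * (1ℚ - y zero) * r) (expect-* (y ∘ suc) c _) (expect-* (y ∘ suc) c _))
  (regroup (½ * (1ℚ + y zero)) (½ * (1ℚ - y zero)) c (expect (y ∘ suc) (λ S → F (true ∷ S))) (expect (y ∘ suc) (λ S → F (false ∷ S))))
  where
  regroup : ∀ a b c p r → a * (c * p) + b * (c * r) ≡ c * (a * p + b * r)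
  regroup = solve-∀ ℚ-ring

expect-sum : ∀ {n m} (y : Fin n → ℚ) (F : Fin m → Subset n → ℚ) → expect y (λ S → sum (λ i → F i S)) ≡ sum (λ i → expect y (F i))
expect-sum {m = zero}  y F = expect-const y 0ℚ
expect-sum {m = suc m} y F = trans (expect-+ y (F zero) (λ S → sum (λ i → F (suc i) S)))
  (cong (expect y (F zero) +_) (expect-sum y (F ∘ suc)))

expect-sign : ∀ {n} (y : Fin n → ℚ) u → expect y (λ S → sign (lookup S u)) ≡ y u
expect-sign y zero = trans
  (cong₂ (λ p r → ½ * (1ℚ + y zero) * p + ½ * (1ℚ - y zero) * r) (expect-const (y ∘ suc) 1ℚ) (expect-const (y ∘ suc) (- 1ℚ)))
  (mean (y zero))
  where
  mean : ∀ z → ½ * (1ℚ + z) * 1ℚ + ½ * (1ℚ - z) * (- 1ℚ) ≡ z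
  mean = solve-∀ ℚ-ring
expect-sign y (suc u) = trans
  (cong₂ (λ p r → ½ * (1ℚ + y zero) * p + ½ * (1ℚ - y zero) * r) (expect-sign (y ∘ suc) u) (expect-sign (y ∘ suc) u))
  (total (y zero) (y (suc u)))
  where
  total : ∀ z c → ½ * (1ℚ + z) * c + ½ * (1ℚ - z) * c ≡ c
  total = solve-∀ ℚ-ring

-- Independence of distinct coordinates; for equal ones the left side would be 1.
expect-sign-sign : ∀ {n} (y : Fin n → ℚ) {u w} → ¬ u ≡ w → expect y (λ S → sign (lookup S u) * sign (lookup S w)) ≡ y u * y w
expect-sign-sign y {zero} {zero} u≢w = contradiction refl u≢w
expect-sign-sign y {zero} {suc w} u≢w = trans
  (cong₂ (λ p r → ½ * (1ℚ + y zero) * p + ½ * (1ℚ - y zero) * r)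
    (trans (expect-* (y ∘ suc) 1ℚ _) (cong (1ℚ *_) (expect-sign (y ∘ suc) w)))
    (trans (expect-* (y ∘ suc) (- 1ℚ) _) (cong (- 1ℚ *_) (expect-sign (y ∘ suc) w))))
  (mean (y zero) (y (suc w)))
  where
  mean : ∀ z c → ½ * (1ℚ + z) * (1ℚ * c) + ½ * (1ℚ - z) * (- 1ℚ * c) ≡ z * c
  mean = solve-∀ ℚ-ring
expect-sign-sign y {suc u} {zero} u≢w = trans
  (expect-cong y (λ S → *-comm (sign (lookup S (suc u))) (sign (lookup S zero))))
  (trans (expect-sign-sign y {zero} {suc u} (λ ())) (*-comm (y zero) (y (suc u))))
expect-sign-sign y {suc u} {suc w} u≢w = trans
  (cong₂ (λ p r → ½ * (1ℚ + y zero) * p + ½ * (1ℚ - y zero) * r)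
    (expect-sign-sign (y ∘ suc) (u≢w ∘ cong suc)) (expect-sign-sign (y ∘ suc) (u≢w ∘ cong suc)))
  (total (y zero) (y (suc u) * y (suc w)))
  where
  total : ∀ z c → ½ * (1ℚ + z) * c + ½ * (1ℚ - z) * c ≡ c
  total = solve-∀ ℚ-ring

module CubeBound {n} (G : Graph n) where

  open Form G

  signs : Subset n → Fin n → ℚ
  signs S u = sign (lookup S u)

  expect-B : ∀ y → expect y (λ S → B (signs S) (signs S)) ≡ B y y
  expect-B y = trans (expect-sum y (λ u S → sum (λ w → a u w * (signs S u * signs S w))))
    (sum-cong-≗ (λ u → trans (expect-sum y (λ w S → a u w * (signs S u * signs S w))) (sum-cong-≗ (term u))))
    where
    term : ∀ u w → expect y (λ S → a u w * (signs S u * signs S w)) ≡ a u w * (y u * y w)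
    term u w with u Data.Fin.≟ w
    ... | no u≢w = trans (expect-* y (a u w) _) (cong (a u w *_) (expect-sign-sign y u≢w))
    ... | yes refl = trans (expect-* y (a u u) _) (trans (cong (_* expect y (λ S → signs S u * signs S u)) a≡0)
                       (trans (*-zeroˡ (expect y (λ S → signs S u * signs S u))) (≡-sym (trans (cong (_* (y u * y u)) a≡0) (*-zeroˡ (y u * y u))))))
      where
      a≡0 : a u u ≡ 0ℚ
      a≡0 = cong ind (irrefl G u)

  -- Since there are no loops, `B` is affine in each coordinate, so its value at `y` is its mean
  -- over random sign vectors with mean `y`.
  cube-bound : ∀ {S₀} → (∀ S → 0ℚ ≤ℚ S₀ + B (signs S) (signs S)) → ∀ y → Cube y → 0ℚ ≤ℚ S₀ + B y y
  cube-bound {S₀} h y hy = 0≤-resp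
    (≡-sym (trans (expect-+ y (λ _ → S₀) (λ S → B (signs S) (signs S))) (cong₂ _+_ (expect-const y S₀) (expect-B y))))
    (expect-nonneg y hy h)

-- Sums over lists and over pairs of vertices.

listSum : {A : Set} → (A → ℚ) → List A → ℚ
listSum f = foldr (λ x acc → f x + acc) 0ℚ

listSum-++ : {A : Set} (f : A → ℚ) (xs ys : List A) → listSum f (xs ++ ys) ≡ listSum f xs + listSum f ys
listSum-++ f []       ys = ≡-sym (+-identityˡ (listSum f ys))
listSum-++ f (x ∷ xs) ys = trans (cong (f x +_) (listSum-++ f xs ys)) (≡-sym (ℚₚ.+-assoc (f x) (listSum f xs) (listSum f ys)))

listSum-map : {A B : Set} (f : B → ℚ) (g : A → B) (xs : List A) → listSum f (map g xs) ≡ listSum (f ∘ g) xs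
listSum-map f g []       = refl
listSum-map f g (x ∷ xs) = cong (f (g x) +_) (listSum-map f g xs)

listSum-concatMap : {A B : Set} (f : B → ℚ) (g : A → List B) (xs : List A) →
                    listSum f (concatMap g xs) ≡ listSum (λ x → listSum f (g x)) xs
listSum-concatMap f g []       = refl
listSum-concatMap f g (x ∷ xs) = trans (listSum-++ f (g x) (concatMap g xs)) (cong (listSum f (g x) +_) (listSum-concatMap f g xs))

listSum-filter : {A : Set} (f : A → ℚ) (p : A → Bool) (xs : List A) → listSum f (filterᵇ p xs) ≡ listSum (λ x → ind (p x) * f x) xs
listSum-filter f p []       = refl
listSum-filter f p (x ∷ xs) with p x
... | true  = cong₂ _+_ (≡-sym (*-identityˡ (f x))) (listSum-filter f p xs)
... | false = trans (listSum-filter f p xs) (≡-sym (trans (cong (_+ _) (*-zeroˡ (f x))) (+-identityˡ _)))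

length-filter : {A : Set} (p : A → Bool) (xs : List A) → ℕ→ℚ (length (filterᵇ p xs)) ≡ listSum (λ x → ind (p x)) xs
length-filter p []       = refl
length-filter p (x ∷ xs) with p x
... | true  = trans (ℕ→ℚ-suc (length (filterᵇ p xs))) (cong (1ℚ +_) (length-filter p xs))
... | false = trans (length-filter p xs) (≡-sym (+-identityˡ _))

listSum-tabulate : ∀ {m} {A : Set} (f : A → ℚ) (g : Fin m → A) → listSum f (tabulate g) ≡ sum (f ∘ g)
listSum-tabulate {zero}  f g = refl
listSum-tabulate {suc m} f g = cong (f (g zero) +_) (listSum-tabulate f (g ∘ suc))

listSum-cong : {A : Set} {f g : A → ℚ} → (∀ x → f x ≡ g x) → ∀ xs → listSum f xs ≡ listSum g xs
listSum-cong h []       = refl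
listSum-cong h (x ∷ xs) = cong₂ _+_ (h x) (listSum-cong h xs)

listSum-pairs : ∀ {n} (f : Fin n × Fin n → ℚ) → listSum f (pairs n) ≡ sum₂ (λ i j → ind (toℕ i ℕ.<ᵇ toℕ j) * f (i , j))
listSum-pairs {n} f = begin
  listSum f (pairs n)
    ≡⟨ listSum-filter f (λ { (i , j) → toℕ i ℕ.<ᵇ toℕ j }) (concatMap (λ i → map (i ,_) (allFin n)) (allFin n)) ⟩
  listSum g (concatMap (λ i → map (i ,_) (allFin n)) (allFin n))
    ≡⟨ listSum-concatMap g (λ i → map (i ,_) (allFin n)) (allFin n) ⟩
  listSum (λ i → listSum g (map (i ,_) (allFin n))) (allFin n)
    ≡⟨ listSum-tabulate {n} (λ i → listSum g (map (i ,_) (allFin n))) (λ i → i) ⟩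
  sum (λ i → listSum g (map (i ,_) (allFin n)))
    ≡⟨ sum-cong-≗ (λ i → trans (listSum-map g (i ,_) (allFin n)) (listSum-tabulate {n} (λ j → g (i , j)) (λ j → j))) ⟩
  sum₂ (λ i j → g (i , j)) ∎
  where
  open ≡-Reasoning
  g : Fin n × Fin n → ℚ
  g (i , j) = ind (toℕ i ℕ.<ᵇ toℕ j) * f (i , j)

sum₂-symmetric : ∀ {n} (f : Fin n × Fin n → ℚ) → (∀ i j → f (i , j) ≡ f (j , i)) → (∀ i → f (i , i) ≡ 0ℚ) →
                 sum₂ (λ i j → f (i , j)) ≡ 2ℚ * listSum f (pairs n)
sum₂-symmetric {n} f f-sym f-diag = begin
  sum₂ (λ i j → f (i , j))
    ≡⟨ sum₂-cong split ⟩
  sum₂ (λ i j → 1ℚ * below i j + 1ℚ * below j i)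
    ≡⟨ sum₂-linear 1ℚ 1ℚ below (λ i j → below j i) ⟩
  1ℚ * sum₂ below + 1ℚ * sum₂ (λ i j → below j i)
    ≡⟨ cong (λ z → 1ℚ * sum₂ below + 1ℚ * z) (sum-swap (λ i j → below j i)) ⟩
  1ℚ * sum₂ below + 1ℚ * sum₂ below
    ≡⟨ double (sum₂ below) ⟩
  2ℚ * sum₂ below
    ≡⟨ cong (2ℚ *_) (listSum-pairs f) ⟨
  2ℚ * listSum f (pairs n) ∎
  where
  open ≡-Reasoning
  below : Fin n → Fin n → ℚ
  below i j = ind (toℕ i ℕ.<ᵇ toℕ j) * f (i , j)
  double : ∀ z → 1ℚ * z + 1ℚ * z ≡ 2ℚ * z
  double = solve-∀ ℚ-ring
  left : ∀ x → x ≡ 1ℚ * (1ℚ * x) + 1ℚ * (0ℚ * x)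
  left = solve-∀ ℚ-ring
  right : ∀ x → x ≡ 1ℚ * (0ℚ * x) + 1ℚ * (1ℚ * x)
  right = solve-∀ ℚ-ring
  both : 0ℚ ≡ 1ℚ * (0ℚ * 0ℚ) + 1ℚ * (0ℚ * 0ℚ)
  both = refl
  <ᵇ-true : ∀ {m k} → m ℕ.< k → (m ℕ.<ᵇ k) ≡ true
  <ᵇ-true h = dec-true (_ ℕ.<? _) h
  <ᵇ-false : ∀ {m k} → ¬ m ℕ.< k → (m ℕ.<ᵇ k) ≡ false
  <ᵇ-false h = dec-false (_ ℕ.<? _) h
  split : ∀ i j → f (i , j) ≡ 1ℚ * below i j + 1ℚ * below j i
  split i j with ℕₚ.<-cmp (toℕ i) (toℕ j)
  ... | tri< lt _ gt rewrite <ᵇ-true lt | <ᵇ-false gt | f-sym j i = left (f (i , j))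
  ... | tri> lt _ gt rewrite <ᵇ-false lt | <ᵇ-true gt | f-sym j i = right (f (i , j))
  ... | tri≈ lt eq gt with Data.Fin.Properties.toℕ-injective eq
  ...   | refl rewrite <ᵇ-false lt | f-diag i = both

-- The surplus as a bound for the form on the cube.

module Surplus {n} (G : Graph n) where

  open Form G
  open CubeBound G

  edges-B : B (λ _ → 1ℚ) (λ _ → 1ℚ) ≡ ℕ→ℚ (2 ℕ.* e G)
  edges-B = trans (sum₂-cong (λ u w → *-identityʳ (a u w)))
    (trans (sum₂-symmetric (λ ij → a (proj₁ ij) (proj₂ ij)) (λ i j → cong ind (Graph.sym G i j)) (λ i → cong ind (irrefl G i)))
    (trans (cong (2ℚ *_) (≡-sym (length-filter (λ { (i , j) → adj G i j }) (pairs n)))) (≡-sym (ℕ→ℚ-* 2 (e G)))))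

  -- A product of two signs is 1, minus 2 if the signs differ; each crossing edge is met in both
  -- orders, hence the 4.
  cut-B : ∀ S → B (signs S) (signs S) ≡ ℕ→ℚ (2 ℕ.* e G) - 4ℚ * ℕ→ℚ (cut G S)
  cut-B S = begin
    B (signs S) (signs S)
      ≡⟨ sum₂-cong (λ u w → term (adj G u w) (lookup S u) (lookup S w)) ⟩
    sum₂ (λ u w → 1ℚ * (a u w * (1ℚ * 1ℚ)) + (- 2ℚ) * c u w)
      ≡⟨ sum₂-linear 1ℚ (- 2ℚ) (λ u w → a u w * (1ℚ * 1ℚ)) c ⟩
    1ℚ * B (λ _ → 1ℚ) (λ _ → 1ℚ) + (- 2ℚ) * sum₂ c
      ≡⟨ cong₂ (λ y z → 1ℚ * y + (- 2ℚ) * z) edges-B cut-sum ⟩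
    1ℚ * ℕ→ℚ (2 ℕ.* e G) + (- 2ℚ) * (2ℚ * ℕ→ℚ (cut G S))
      ≡⟨ collect (ℕ→ℚ (2 ℕ.* e G)) (ℕ→ℚ (cut G S)) ⟩
    ℕ→ℚ (2 ℕ.* e G) - 4ℚ * ℕ→ℚ (cut G S) ∎
    where
    open ≡-Reasoning
    c : Fin n → Fin n → ℚ
    c u w = ind (adj G u w ∧ (lookup S u xor lookup S w))
    collect : ∀ y z → 1ℚ * y + (- 2ℚ) * (2ℚ * z) ≡ y - 4ℚ * z
    collect = solve-∀ ℚ-ring
    term : ∀ b s t → ind b * (sign s * sign t) ≡ 1ℚ * (ind b * (1ℚ * 1ℚ)) + (- 2ℚ) * ind (b ∧ (s xor t))
    term true  true  true  = refl
    term true  true  false = refl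
    term true  false true  = refl
    term true  false false = refl
    term false true  true  = refl
    term false true  false = refl
    term false false true  = refl
    term false false false = refl
    cut-sum : sum₂ c ≡ 2ℚ * ℕ→ℚ (cut G S)
    cut-sum = trans (sum₂-symmetric (λ ij → c (proj₁ ij) (proj₂ ij))
        (λ i j → cong ind (cong₂ _∧_ (Graph.sym G i j) (xor-comm (lookup S i) (lookup S j))))
        (λ i → cong (λ b → ind (b ∧ (lookup S i xor lookup S i))) (irrefl G i)))
      (cong (2ℚ *_) (≡-sym (length-filter (λ { (i , j) → adj G i j ∧ (lookup S i xor lookup S j) }) (pairs n))))

  ∈-allSubsets : ∀ {n} (S : Subset n) → S ∈ allSubsets n
  ∈-allSubsets []          = here refl
  ∈-allSubsets (true ∷ S)  = ∈-++⁺ˡ (∈-map⁺ (true ∷_) (∈-allSubsets S))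
  ∈-allSubsets {suc n} (false ∷ S) = ∈-++⁺ʳ (map (true ∷_) (allSubsets n)) (∈-map⁺ (false ∷_) (∈-allSubsets S))

  cut≤max : ∀ {S} xs → S ∈ xs → cut G S ≤ foldr ℕ._⊔_ 0 (map (cut G) xs)
  cut≤max (x ∷ xs) (here refl) = ℕₚ.m≤m⊔n (cut G x) _
  cut≤max (x ∷ xs) (there h)   = ℕₚ.≤-trans (cut≤max xs h) (ℕₚ.m≤n⊔m (cut G x) _)

  4sp : 4ℚ * sp G ≡ 4ℚ * ℕ→ℚ (mc G) - ℕ→ℚ (2 ℕ.* e G)
  4sp = trans (expand (ℕ→ℚ (mc G)) ((ℤ.+ e G) / 2))
    (cong (λ z → 4ℚ * ℕ→ℚ (mc G) - z) (trans (cong (2ℚ *_) (/-*-cancel (ℤ.+ e G) 2)) (≡-sym (ℕ→ℚ-* 2 (e G)))))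
    where
    expand : ∀ m z → 4ℚ * (m - z) ≡ 4ℚ * m - 2ℚ * (z * 2ℚ)
    expand = solve-∀ ℚ-ring

  sp-bound : ∀ y → Cube y → 0ℚ ≤ℚ 4ℚ * sp G + B y y
  sp-bound = cube-bound {4ℚ * sp G} (λ S → 0≤-resp
    (trans (cong₂ _+_ 4sp (cut-B S)) (cancel (ℕ→ℚ (mc G)) (ℕ→ℚ (2 ℕ.* e G)) (ℕ→ℚ (cut G S))))
    (0≤* (ℚₚ.nonNegative⁻¹ 4ℚ) (≤⇒0≤ (ℕ→ℚ-mono (cut≤max (allSubsets n) (∈-allSubsets S))))))
    where
    cancel : ∀ m e c → 4ℚ * m - e + (e - 4ℚ * c) ≡ 4ℚ * (m - c)
    cancel = solve-∀ ℚ-ring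

-- The binomial coefficient `k C 2`, by the recursion that the edge count of a clique follows when
-- one vertex is split off.
tri : ℕ → ℕ
tri zero    = 0
tri (suc k) = k ℕ.+ tri k

tri-double : ∀ k → tri (suc k) ℕ.+ tri (suc k) ≡ k ℕ.* suc k
tri-double zero    = refl
tri-double (suc k) = begin
  suc k ℕ.+ tri (suc k) ℕ.+ (suc k ℕ.+ tri (suc k))   ≡⟨ regroup (suc k) (tri (suc k)) ⟩
  suc k ℕ.+ suc k ℕ.+ (tri (suc k) ℕ.+ tri (suc k))   ≡⟨ cong (suc k ℕ.+ suc k ℕ.+_) (tri-double k) ⟩
  suc k ℕ.+ suc k ℕ.+ k ℕ.* suc k                     ≡⟨ finish k ⟩
  suc k ℕ.* suc (suc k)                               ∎
  where
  open ≡-Reasoning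
  regroup : ∀ x y → x ℕ.+ y ℕ.+ (x ℕ.+ y) ≡ x ℕ.+ x ℕ.+ (y ℕ.+ y)
  regroup = ℕ-solve-∀
  finish : ∀ k → suc k ℕ.+ suc k ℕ.+ k ℕ.* suc k ≡ suc k ℕ.* suc (suc k)
  finish = ℕ-solve-∀

-- Cardinalities and degrees are rationals in this development; this recovers their integrality.
sum-ind-discrete : ∀ {n} (f : Fin n → Bool) → sum (ind ∘ f) ≡ 0ℚ ⊎ 1ℚ ≤ℚ sum (ind ∘ f)
sum-ind-discrete {zero}  f = inj₁ refl
sum-ind-discrete {suc n} f with f zero | sum-ind-discrete (f ∘ suc)
... | true  | _      = inj₂ (+-monoʳ-≤ 1ℚ (sum-nonneg (λ i → ind-nonneg (f (suc i)))))
... | false | inj₁ h = inj₁ (trans (+-identityˡ _) h)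
... | false | inj₂ h = inj₂ (≤-trans h (≤-reflexive (≡-sym (+-identityˡ _))))

-- Ordered cliques inside a vertex set.

module Cliques {n} (G : Graph n) where

  open Form G

  VertexSet : Set
  VertexSet = Fin n → Bool

  ι : VertexSet → Fin n → ℚ
  ι U u = ind (U u)

  ι-nonneg : ∀ U u → 0ℚ ≤ℚ ι U u
  ι-nonneg U u = ind-nonneg (U u)

  card : VertexSet → ℚ
  card U = sum (ι U)

  card-nonneg : ∀ U → 0ℚ ≤ℚ card U
  card-nonneg U = sum-nonneg (ι-nonneg U)

  infixl 7 _∩N_
  _∩N_ : VertexSet → Fin n → VertexSet
  (U ∩N v) u = U u ∧ adj G v u

  ι-∩N : ∀ U v u → ι (U ∩N v) u ≡ ι U u * a v u
  ι-∩N U v u = ind-∧ (U u) (adj G v u)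

  -- Ordered r-cliques in U, that is r! times the number of r-element cliques.
  cliques : ℕ → VertexSet → ℚ
  cliques zero    U = 1ℚ
  cliques (suc r) U = sum (λ v → ι U v * cliques r (U ∩N v))

  cliques-nonneg : ∀ r U → 0ℚ ≤ℚ cliques r U
  cliques-nonneg zero    U = 0≤1
  cliques-nonneg (suc r) U = sum-nonneg (λ v → 0≤* (ι-nonneg U v) (cliques-nonneg r (U ∩N v)))

  cliques-mono : ∀ r {U W} → (∀ u → ι U u ≤ℚ ι W u) → cliques r U ≤ℚ cliques r W
  cliques-mono zero    h = ≤-refl
  cliques-mono (suc r) {U} {W} h = sum-mono (λ v → *-mono (ι-nonneg U v) (h v) (cliques-nonneg r (U ∩N v))
    (cliques-mono r (λ u → ≤-trans (≤-reflexive (ι-∩N U v u))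
      (≤-trans (*-monoʳ (a-nonneg v u) (h u)) (≤-reflexive (≡-sym (ι-∩N W v u)))))))

  deg : VertexSet → Fin n → ℚ
  deg U u = sum (λ w → a u w * ι U w)

  card-∩N : ∀ U v → card (U ∩N v) ≡ deg U v
  card-∩N U v = sum-cong-≗ (λ u → trans (ι-∩N U v u) (*-comm (ι U u) (a v u)))

  deg-mono : ∀ {U W} → (∀ u → ι U u ≤ℚ ι W u) → ∀ v → deg U v ≤ℚ deg W v
  deg-mono h v = sum-mono (λ w → *-monoˡ (a-nonneg v w) (h w))

  B-deg : ∀ f U → B f (ι U) ≡ sum (λ u → f u * deg U u)
  B-deg f U = sum-cong-≗ (λ u → trans (sum-cong-≗ (λ w → swap (a u w) (f u) (ι U w))) (sum-*ˡ (f u) (λ w → a u w * ι U w)))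
    where
    swap : ∀ a f i → a * (f * i) ≡ f * (a * i)
    swap = solve-∀ ℚ-ring

  cliques-2 : ∀ U → cliques 2 U ≡ B (ι U) (ι U)
  cliques-2 U = trans (sum-cong-≗ (λ v → cong (ι U v *_) (trans (sum-cong-≗ (λ u → *-identityʳ (ι (U ∩N v) u))) (card-∩N U v))))
    (≡-sym (B-deg (ι U) U))

  B-ι-nonneg : ∀ U W → 0ℚ ≤ℚ B (ι U) (ι W)
  B-ι-nonneg U W = B-nonneg (ι-nonneg U) (ι-nonneg W)

  deg≤card : ∀ U v → deg U v ≤ℚ card U
  deg≤card U v = sum-mono (λ w → ≤-trans (*-monoʳ (ι-nonneg U w) (ind-≤1 (adj G v w))) (≤-reflexive (*-identityˡ (ι U w))))

  B≤card² : ∀ U → B (ι U) (ι U) ≤ℚ card U * card U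
  B≤card² U = ≤-trans (≤-reflexive (B-deg (ι U) U)) (≤-trans (sum-mono (λ u → *-monoˡ (ι-nonneg U u) (deg≤card U u)))
    (≤-reflexive (trans (sum-cong-≗ (λ u → *-comm (ι U u) (card U))) (sum-*ˡ (card U) (ι U)))))

-- In units of d = pN, α is the degree of v and β the average degree of its neighbours.
module VertexArithmetic {N p K α β : ℚ} (0≤N : 0ℚ ≤ℚ N) (0≤p : 0ℚ ≤ℚ p) (p≤1 : p ≤ℚ 1ℚ)
  (0≤α : 0ℚ ≤ℚ α) (α≤K : α ≤ℚ K) (0≤β : 0ℚ ≤ℚ β) (β≤K : β ≤ℚ K) (i : ℕ) where

  private
    j k : ℕ
    j = suc i
    k = suc j

  -- By `weight≡`, `expected * ω ^ℚ k` is the count of ordered `k`-cliques to be expected among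
  -- `p * N * α` vertices at density `p * (β * β)`. The factor `scaleN` is `expected` divided by
  -- `p ^ℚ suc k * (N * N)`, the order of a certificate on one neighbourhood; it converts
  -- certificate values into numbers of cliques.
  ω scaleN expected : ℚ
  ω = α * β ^ℚ j
  scaleN = N ^ℚ i * p ^ℚ (i ℕ.+ tri j)
  expected = N ^ℚ k * p ^ℚ (k ℕ.+ tri k)

  κ : ℚ
  κ = (K * K ^ℚ j) ^ℚ i

  0≤ω : 0ℚ ≤ℚ ω
  0≤ω = 0≤* 0≤α (^-nonneg j 0≤β)

  0≤scaleN : 0ℚ ≤ℚ scaleN
  0≤scaleN = 0≤* (^-nonneg i 0≤N) (^-nonneg (i ℕ.+ tri j) 0≤p)

  ω^i≤κ : ω ^ℚ i ≤ℚ κ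
  ω^i≤κ = ^-mono i 0≤ω (*-mono 0≤α α≤K (^-nonneg j 0≤β) (^-mono j 0≤β β≤K))

  -- Certificates on a neighbourhood are only quadratic in `ω`; the remaining `i` factors are
  -- bounded because `α` and `β` are at most `K`.
  weight≤ω² : expected * ω ^ℚ k ≤ℚ κ * (scaleN * (p ^ℚ j * (p * p) * (N * N) * (ω * ω)))
  weight≤ω² = ≤-trans (≤-reflexive (trans (cong (λ z → N ^ℚ k * z * ω ^ℚ k) (^-+ p k (tri k)))
      (regroup N (N ^ℚ i) p (p ^ℚ i) (p ^ℚ (i ℕ.+ tri j)) ω (ω ^ℚ i))))
    (*-monoʳ (0≤* 0≤scaleN (0≤* (0≤* (0≤* (^-nonneg j 0≤p) (0≤* 0≤p 0≤p)) (0≤* 0≤N 0≤N)) (0≤* 0≤ω 0≤ω))) ω^i≤κ)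
    where
    regroup : ∀ N Ni p pi pt w wi → N * (N * Ni) * (p * (p * pi) * (p * pt)) * (w * (w * wi))
            ≡ wi * ((Ni * pt) * (p * pi * (p * p) * (N * N) * (w * w)))
    regroup = solve-∀ ℚ-ring

  -- The version for neighbourhoods with few edges, whose certificate has order
  -- `p * (p * p) * (N * N)` times the square of `α * β`: the surplus powers of `p` are at most 1,
  -- those of `β` at most powers of `K`.
  weight≤αβ² : expected * ω ^ℚ k ≤ℚ κ * (K ^ℚ i * K ^ℚ i) * (scaleN * (p * (p * p) * (N * N) * (α * β * (α * β))))
  weight≤αβ² = ≤-trans weight≤ω² (≤-trans
    (*-monoˡ (^-nonneg i (0≤* 0≤K (^-nonneg j 0≤K))) (*-monoˡ 0≤scaleN
      (≤-trans (≤-reflexive (regroup p (p ^ℚ i) N α β (β ^ℚ i)))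
        (*-mono (0≤* (^-nonneg i 0≤p) (0≤* (^-nonneg i 0≤β) (^-nonneg i 0≤β)))
                (*-mono (^-nonneg i 0≤p) (^-≤1 i 0≤p p≤1) (0≤* (^-nonneg i 0≤β) (^-nonneg i 0≤β))
                   (*-mono (^-nonneg i 0≤β) (^-mono i 0≤β β≤K) (^-nonneg i 0≤β) (^-mono i 0≤β β≤K)))
                (0≤* (0≤* (0≤* 0≤p (0≤* 0≤p 0≤p)) (0≤* 0≤N 0≤N)) (0≤* (0≤* 0≤α 0≤β) (0≤* 0≤α 0≤β)))
                ≤-refl))))
    (≤-reflexive (finish κ scaleN (K ^ℚ i * K ^ℚ i) (p * (p * p) * (N * N) * (α * β * (α * β))))))
    where
    0≤K : 0ℚ ≤ℚ K
    0≤K = ≤-trans 0≤α α≤K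
    regroup : ∀ p pi N α β βi → p * pi * (p * p) * (N * N) * (α * (β * βi) * (α * (β * βi)))
            ≡ pi * (βi * βi) * (p * (p * p) * (N * N) * (α * β * (α * β)))
    regroup = solve-∀ ℚ-ring
    finish : ∀ κ s m z → κ * (s * (1ℚ * m * z)) ≡ κ * m * (s * z)
    finish = solve-∀ ℚ-ring

  ω²≡ : p ^ℚ j * (p * p) * (N * N) * (ω * ω) ≡ (p * (β * β)) ^ℚ j * (p * N * α * (p * N * α))
  ω²≡ = trans (regroup (p ^ℚ j) p N α (β ^ℚ j))
    (cong (_* (p * N * α * (p * N * α))) (≡-sym (trans (^-* p (β * β) j) (cong (p ^ℚ j *_) (^-* β β j)))))
    where
    regroup : ∀ pj p N α βj → pj * (p * p) * (N * N) * (α * βj * (α * βj)) ≡ pj * (βj * βj) * (p * N * α * (p * N * α))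
    regroup = solve-∀ ℚ-ring

  -- The exponents agree because `j * k` is twice `tri k`.
  weight≡ : expected * ω ^ℚ k ≡ (p * N * α) ^ℚ k * (p * (β * β)) ^ℚ tri k
  weight≡ = begin
    N ^ℚ k * p ^ℚ (k ℕ.+ tri k) * ω ^ℚ k
      ≡⟨ cong₂ (λ y z → N ^ℚ k * y * z) (^-+ p k (tri k)) ω^k ⟩
    N ^ℚ k * (p ^ℚ k * p ^ℚ tri k) * (α ^ℚ k * (β ^ℚ tri k * β ^ℚ tri k))
      ≡⟨ regroup (N ^ℚ k) (p ^ℚ k) (p ^ℚ tri k) (α ^ℚ k) (β ^ℚ tri k) ⟩
    p ^ℚ k * N ^ℚ k * α ^ℚ k * (p ^ℚ tri k * (β ^ℚ tri k * β ^ℚ tri k))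
      ≡⟨ cong₂ _*_ (trans (^-* (p * N) α k) (cong (_* α ^ℚ k) (^-* p N k)))
                   (trans (^-* p (β * β) (tri k)) (cong (p ^ℚ tri k *_) (^-* β β (tri k)))) ⟨
    (p * N * α) ^ℚ k * (p * (β * β)) ^ℚ tri k ∎
    where
    open ≡-Reasoning
    ω^k : ω ^ℚ k ≡ α ^ℚ k * (β ^ℚ tri k * β ^ℚ tri k)
    ω^k = trans (^-* α (β ^ℚ j) k) (cong (α ^ℚ k *_) (trans (^-^ β j k)
      (trans (cong (β ^ℚ_) (≡-sym (tri-double j))) (^-+ β (tri k) (tri k)))))
    regroup : ∀ a b c d x → a * (b * c) * (d * (x * x)) ≡ b * a * d * (c * (x * x))
    regroup = solve-∀ ℚ-ring

  -- Bernoulli twice; the lower bound is linear in 1, α and αβ, whose sums over v are computable.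
  ω^k≥linear : (1ℚ - ℕ→ℚ k) + ℕ→ℚ k * (2ℚ - ℕ→ℚ k) * α + ℕ→ℚ k * (ℕ→ℚ k - 1ℚ) * (α * β) ≤ℚ ω ^ℚ k
  ω^k≥linear = ≤-trans (≤-by (trans (cong (λ z → 1ℚ + z * (ω - 1ℚ) - ((1ℚ - z) + z * (2ℚ - z) * α + z * (z - 1ℚ) * (α * β))) (ℕ→ℚ-suc j))
                                  (gap (ℕ→ℚ j) α β (β ^ℚ j)))
                             (0≤* (0≤* (0≤+ 0≤1 (ℕ→ℚ-nonneg j)) 0≤α) (≤⇒0≤ (bernoulli j 0≤β))))
                       (bernoulli k 0≤ω)
    where
    gap : ∀ j α β βj → 1ℚ + (1ℚ + j) * (α * βj - 1ℚ) - ((1ℚ - (1ℚ + j)) + (1ℚ + j) * (2ℚ - (1ℚ + j)) * α + (1ℚ + j) * ((1ℚ + j) - 1ℚ) * (α * β))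
        ≡ (1ℚ + j) * α * (βj - (1ℚ + j * (β - 1ℚ)))
    gap = solve-∀ ℚ-ring

⅛ : ℚ
⅛ = ½ * ½ * ½

-- The statement proved by induction.

module CliqueTarget {n} (G : Graph n) where

  open Form G
  open Cliques G
  open Certificate G

  -- The theorem for `suc k`-cliques inside `U`, with a family supported on `U` in place of a cut.
  -- In terms of the average degree d and the size N of `U`, the value `p ^ℚ k * (card U * card U)`
  -- is d^k / N^(k-2). Stating it for all `U` lets it be applied to neighbourhoods.
  Bound : ℕ → ℚ → ℚ → ℚ → Set
  Bound k ε c δ = ∀ U p → 0ℚ < card U → p * (card U * card U) ≡ B (ι U) (ι U) →
    cliques (suc k) U ≤ℚ (1ℚ - ε) * (card U ^ℚ suc k * p ^ℚ tri (suc k)) →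
    Achieves δ (ι U) (c * (p ^ℚ k * (card U * card U)))

Target : ℕ → ℚ → ℚ → ℚ → Set
Target k ε c δ = ∀ {n} (G : Graph n) → CliqueTarget.Bound G k ε c δ

-- Bounded degrees: adding up the neighbourhoods.

module Core {n} (G : Graph n) where

  open Form G
  open Cliques G
  open Certificate G

  -- Here `L` is what remains after the heavy vertices are deleted, while `N` is the size of the set
  -- before the deletion. Keeping `N`, and measuring the density `p` against it, leaves the power of
  -- `N` in the clique hypothesis unchanged.
  module _ (L : VertexSet) {N p K : ℚ} (i : ℕ)
    (0<N : 0ℚ < N) (0<p : 0ℚ < p) (0≤K : 0ℚ ≤ℚ K)
    (card≤N : card L ≤ℚ N) (edges : p * (N * N) ≡ B (ι L) (ι L))
    (deg≤ : ∀ u → ι L u * deg L u ≤ℚ ι L u * (K * (p * N)))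
    {η δ c₀ : ℚ} (0<η : 0ℚ < η) (η≤1 : η ≤ℚ 1ℚ) (0≤δ : 0ℚ ≤ℚ δ) (δ≤ : 8ℚ * δ ≤ℚ η) (0<c₀ : 0ℚ < c₀)
    (induction : Target (suc i) η c₀ δ)
    {Γ : ℚ} (0≤Γ : 0ℚ ≤ℚ Γ)
    (Γ-sparse : (K * K ^ℚ suc i) ^ℚ i * (K ^ℚ i * K ^ℚ i) ≤ℚ Γ * (η * ⅛))
    (Γ-cliques : (K * K ^ℚ suc i) ^ℚ i ≤ℚ Γ * (c₀ * (1ℚ - η) ^ℚ suc i))
    where

    j k : ℕ
    j = suc i
    k = suc j

    D : ℚ
    D = p * N

    0<D : 0ℚ < D
    0<D = 0<* 0<p 0<N

    0≤N : 0ℚ ≤ℚ N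
    0≤N = <⇒≤ 0<N

    0≤p : 0ℚ ≤ℚ p
    0≤p = <⇒≤ 0<p

    0≤1-η : 0ℚ ≤ℚ 1ℚ - η
    0≤1-η = ≤⇒0≤ η≤1

    1-η≤1 : 1ℚ - η ≤ℚ 1ℚ
    1-η≤1 = ≤-by (cancel η) (<⇒≤ 0<η)
      where
      cancel : ∀ η → 1ℚ - (1ℚ - η) ≡ η
      cancel = solve-∀ ℚ-ring

    p≤1 : p ≤ℚ 1ℚ
    p≤1 = *-cancel (0<* 0<N 0<N) (subst₂ _≤ℚ_ (trans (≡-sym edges) (*-comm p (N * N))) (≡-sym (*-identityʳ (N * N)))
      (≤-trans (B≤card² L) (*-mono (card-nonneg L) card≤N (card-nonneg L) card≤N)))

    S : Fin n → ℚ
    S v = B (ι (L ∩N v)) (ι L)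

    ι-∩N≤ : ∀ v u → ι (L ∩N v) u ≤ℚ ι L u
    ι-∩N≤ v u = ≤-trans (≤-reflexive (ι-∩N L v u))
      (≤-trans (*-monoˡ (ι-nonneg L u) (ind-≤1 (adj G v u))) (≤-reflexive (*-identityʳ (ι L u))))

    S≤ : ∀ v → S v ≤ℚ K * D * deg L v
    S≤ v = ≤-trans (≤-reflexive (B-deg (ι (L ∩N v)) L))
      (≤-trans (sum-mono step) (≤-reflexive (sum-*ˡ (K * D) (λ u → a v u * ι L u))))
      where
      front : ∀ i a d → i * a * d ≡ a * (i * d)
      front = solve-∀ ℚ-ring
      back : ∀ i a d → a * (i * d) ≡ d * (a * i)
      back = solve-∀ ℚ-ring
      step : ∀ u → ι (L ∩N v) u * deg L u ≤ℚ K * D * (a v u * ι L u)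
      step u = subst₂ _≤ℚ_
        (≡-sym (trans (cong (_* deg L u) (ι-∩N L v u)) (front (ι L u) (a v u) (deg L u)))) (back (ι L u) (a v u) (K * D))
        (*-monoˡ (a-nonneg v u) (deg≤ u))

    scaleN expected : ℚ
    scaleN = N ^ℚ i * p ^ℚ (i ℕ.+ tri j)
    expected = N ^ℚ k * p ^ℚ (k ℕ.+ tri k)

    0≤scaleN : 0ℚ ≤ℚ scaleN
    0≤scaleN = 0≤* (^-nonneg i 0≤N) (^-nonneg (i ℕ.+ tri j) 0≤p)

    0≤expected : 0ℚ ≤ℚ expected
    0≤expected = 0≤* (^-nonneg k 0≤N) (^-nonneg (k ℕ.+ tri k) 0≤p)

    -- One factor for the clique threshold in `many`, and `tri k` factors for the density of the
    -- neighbourhood, which may fall short by `1 - η`.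
    ρ : ℚ
    ρ = (1ℚ - η) ^ℚ suc (tri k)

    0≤ρ : 0ℚ ≤ℚ ρ
    0≤ρ = ^-nonneg (suc (tri k)) 0≤1-η

    ρ≤1 : ρ ≤ℚ 1ℚ
    ρ≤1 = ^-≤1 (suc (tri k)) 0≤1-η 1-η≤1

    -- The common outcome of all cases at a vertex: in `gain`, either its cliques or its certificate
    -- pays for the expected count. The equations carry the factor `z`, the indicator of `v` in `L`,
    -- so that they are empty outside `L`; `α` and `β` are fields because a vertex without
    -- neighbours has no average neighbour degree and uses 0.
    record Contribution (z : ℚ) (v : Fin n) : Set where
      field
        val α β  : ℚ
        0≤α      : 0ℚ ≤ℚ α
        α≤K      : α ≤ℚ K
        0≤β      : 0ℚ ≤ℚ β
        β≤K      : β ≤ℚ K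
        α-deg    : z * (D * α) ≡ z * deg L v
        αβ-deg   : z * (D * D * (α * β)) ≡ z * S v
        achieves : Achieves δ (λ u → z * (ι (L ∩N v) u + p * (α * β) * ι L u)) val
        gain     : ρ * (expected * (z * (α * β ^ℚ j) ^ℚ k)) ≤ℚ z * cliques k (L ∩N v) + Γ * scaleN * val

    empty-contribution : ∀ z v → 0ℚ ≤ℚ z → z * deg L v ≡ 0ℚ → z * S v ≡ 0ℚ → Contribution z v
    empty-contribution z v 0≤z d≡0 s≡0 = record
      { val = 0ℚ ; α = 0ℚ ; β = 0ℚ ; 0≤α = ≤-refl ; α≤K = 0≤K ; 0≤β = ≤-refl ; β≤K = 0≤K
      ; α-deg = trans (zero₁ z D) (≡-sym d≡0)
      ; αβ-deg = trans (zero₂ z D) (≡-sym s≡0)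
      ; achieves = achieves-0 (λ u → 0≤* 0≤z (0≤+ (ι-nonneg (L ∩N v) u) (≤-reflexive (≡-sym (zero₃ p (ι L u))))))
      ; gain = ≤-trans (≤-reflexive (zero₄ ρ expected z (0ℚ ^ℚ j) ((0ℚ * 0ℚ ^ℚ j) ^ℚ j)))
          (0≤+ (0≤* 0≤z (cliques-nonneg k (L ∩N v))) (≤-reflexive (≡-sym (*-zeroʳ (Γ * scaleN)))))
      }
      where
      zero₁ : ∀ z D → z * (D * 0ℚ) ≡ 0ℚ
      zero₁ = solve-∀ ℚ-ring
      zero₂ : ∀ z D → z * (D * D * (0ℚ * 0ℚ)) ≡ 0ℚ
      zero₂ = solve-∀ ℚ-ring
      zero₃ : ∀ p i → p * (0ℚ * 0ℚ) * i ≡ 0ℚ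
      zero₃ = solve-∀ ℚ-ring
      zero₄ : ∀ r x z b w → r * (x * (z * (0ℚ * b * w))) ≡ 0ℚ
      zero₄ = solve-∀ ℚ-ring

    module NonIsolated (v : Fin n) (1≤d : 1ℚ ≤ℚ deg L v) (d≤ : deg L v ≤ℚ K * D) where

      Nv : VertexSet
      Nv = L ∩N v

      d e₂ : ℚ
      d = deg L v
      e₂ = B (ι Nv) (ι Nv)

      0<d : 0ℚ < d
      0<d = <-≤-trans 0<1 1≤d

      -- `θ` is `S v` divided by `B (ι L) (ι L)`, the coefficient of `ι L` in the projection of
      -- `ι Nv` with respect to `B`; `π` is the edge density of the neighbourhood.
      d⁻¹ D⁻¹ α β θ π : ℚ
      d⁻¹ = proj₁ (inverse 0<d)
      D⁻¹ = proj₁ (inverse 0<D)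
      α = d * D⁻¹
      β = S v * d⁻¹ * D⁻¹
      θ = p * (α * β)
      π = e₂ * (d⁻¹ * d⁻¹)

      dd⁻¹ : d * d⁻¹ ≡ 1ℚ
      dd⁻¹ = proj₂ (proj₂ (inverse 0<d))

      DD⁻¹ : D * D⁻¹ ≡ 1ℚ
      DD⁻¹ = proj₂ (proj₂ (inverse 0<D))

      0≤d⁻¹ : 0ℚ ≤ℚ d⁻¹
      0≤d⁻¹ = <⇒≤ (proj₁ (proj₂ (inverse 0<d)))

      0≤D⁻¹ : 0ℚ ≤ℚ D⁻¹
      0≤D⁻¹ = <⇒≤ (proj₁ (proj₂ (inverse 0<D)))

      0≤α : 0ℚ ≤ℚ α
      0≤α = 0≤* (<⇒≤ 0<d) 0≤D⁻¹

      0≤β : 0ℚ ≤ℚ β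
      0≤β = 0≤* (0≤* (B-ι-nonneg Nv L) 0≤d⁻¹) 0≤D⁻¹

      Dα≡d : D * α ≡ d
      Dα≡d = trans (regroup D d D⁻¹) (trans (cong (d *_) DD⁻¹) (*-identityʳ d))
        where
        regroup : ∀ D d i → D * (d * i) ≡ d * (D * i)
        regroup = solve-∀ ℚ-ring

      Ddβ≡S : D * d * β ≡ S v
      Ddβ≡S = trans (regroup D d (S v) d⁻¹ D⁻¹) (trans (cong₂ (λ x y → S v * x * y) dd⁻¹ DD⁻¹) (one (S v)))
        where
        regroup : ∀ D d s x y → D * d * (s * x * y) ≡ s * (d * x) * (D * y)
        regroup = solve-∀ ℚ-ring
        one : ∀ s → s * 1ℚ * 1ℚ ≡ s
        one = solve-∀ ℚ-ring

      DDαβ≡S : D * D * (α * β) ≡ S v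
      DDαβ≡S = trans (regroup D α β) (trans (cong (λ x → D * x * β) Dα≡d) Ddβ≡S)
        where
        regroup : ∀ D α β → D * D * (α * β) ≡ D * (D * α) * β
        regroup = solve-∀ ℚ-ring

      α≤K : α ≤ℚ K
      α≤K = *-cancel 0<D (subst₂ _≤ℚ_ (≡-sym Dα≡d) (*-comm K D) d≤)

      β≤K : β ≤ℚ K
      β≤K = *-cancel (0<* 0<D 0<d) (subst₂ _≤ℚ_ (≡-sym Ddβ≡S) (regroup K D d) (S≤ v))
        where
        regroup : ∀ K D d → K * D * d ≡ D * d * K
        regroup = solve-∀ ℚ-ring

      0≤θ : 0ℚ ≤ℚ θ
      0≤θ = 0≤* 0≤p (0≤* 0≤α 0≤β)

      πdd≡e₂ : π * (d * d) ≡ e₂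
      πdd≡e₂ = trans (regroup e₂ d⁻¹ d) (trans (cong (λ x → e₂ * (x * x)) dd⁻¹) (*-identityʳ e₂))
        where
        regroup : ∀ e x d → e * (x * x) * (d * d) ≡ e * ((d * x) * (d * x))
        regroup = solve-∀ ℚ-ring

      open VertexArithmetic {N} {p} {K} {α} {β} 0≤N 0≤p p≤1 0≤α α≤K 0≤β β≤K i using (ω; 0≤ω; κ; weight≤ω²; weight≤αβ²; ω²≡; weight≡)

      θB≡S : θ * B (ι L) (ι L) ≡ S v
      θB≡S = trans (cong (θ *_) (≡-sym edges)) (trans (regroup p α β N) DDαβ≡S)
        where
        regroup : ∀ p α β N → p * (α * β) * (p * (N * N)) ≡ p * N * (p * N) * (α * β)
        regroup = solve-∀ ℚ-ring

      θ≤1 : θ ≤ℚ 1ℚ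
      θ≤1 = *-cancel 0<B (subst₂ _≤ℚ_ (trans (≡-sym θB≡S) (*-comm θ (B (ι L) (ι L)))) (≡-sym (*-identityʳ (B (ι L) (ι L))))
        (B-mono (ι-nonneg Nv) (ι-∩N≤ v) (ι-nonneg L) (λ _ → ≤-refl)))
        where
        0<B : 0ℚ < B (ι L) (ι L)
        0<B = subst (0ℚ <_) edges (0<* 0<p (0<* 0<N 0<N))

      θS≡ : θ * S v ≡ p * (p * p) * (N * N) * (α * β * (α * β))
      θS≡ = trans (cong (θ *_) (≡-sym DDαβ≡S)) (regroup p N (α * β))
        where
        regroup : ∀ p N z → p * z * (p * N * (p * N) * z) ≡ p * (p * p) * (N * N) * (z * z)
        regroup = solve-∀ ℚ-ring

      gain-le : ∀ {val} → expected * ω ^ℚ k ≤ℚ Γ * scaleN * val →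
                ρ * (expected * (1ℚ * ω ^ℚ k)) ≤ℚ 1ℚ * cliques k Nv + Γ * scaleN * val
      gain-le {val} h = ≤-trans
        (≤-trans (*-monoʳ (0≤* 0≤expected (0≤* 0≤1 (^-nonneg k 0≤ω))) ρ≤1) (≤-reflexive (one expected (ω ^ℚ k))))
        (≤-trans h (≤-by (cancel (cliques k Nv) (Γ * scaleN * val)) (cliques-nonneg k Nv)))
        where
        one : ∀ x w → 1ℚ * (x * (1ℚ * w)) ≡ x * w
        one = solve-∀ ℚ-ring
        cancel : ∀ c z → 1ℚ * c + z - z ≡ c
        cancel = solve-∀ ℚ-ring

      contribution : ∀ val → Achieves δ (λ u → ι Nv u + θ * ι L u) val →
                     ρ * (expected * (1ℚ * ω ^ℚ k)) ≤ℚ 1ℚ * cliques k Nv + Γ * scaleN * val → Contribution 1ℚ v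
      contribution val h g = record
        { val = val ; α = α ; β = β ; 0≤α = 0≤α ; α≤K = α≤K ; 0≤β = 0≤β ; β≤K = β≤K
        ; α-deg = cong (1ℚ *_) Dα≡d
        ; αβ-deg = cong (1ℚ *_) DDαβ≡S
        ; achieves = achieves-weaken ≤-refl (λ u → ≤-reflexive (≡-sym (*-identityˡ (ι Nv u + θ * ι L u)))) ≤-refl h
        ; gain = g
        }

      -- Few edges inside the neighbourhood: the projection of its indicator orthogonal (for B) to that of L is negative.
      sparse : e₂ ≤ℚ (1ℚ - η) * (θ * S v) → Contribution 1ℚ v
      sparse h = contribution (η * ⅛ * (θ * S v))
        (achieves-weaken ≤-refl m≤ value≤ (achieves-single f g -m≤x x≤m m≤1))
        (gain-le (≤-trans weight≤αβ² (≤-trans (*-monoʳ (0≤* 0≤scaleN (0≤-resp (≡-sym θS≡) 0≤θS)) Γ-sparse)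
          (≤-reflexive (trans (cong (λ z → Γ * (η * ⅛) * (scaleN * z)) (≡-sym θS≡)) (regroup Γ (η * ⅛) scaleN (θ * S v)))))))
        where
        0≤θS : 0ℚ ≤ℚ θ * S v
        0≤θS = 0≤* 0≤θ (B-ι-nonneg Nv L)
        regroup : ∀ Γ h s z → Γ * h * (s * z) ≡ Γ * s * (h * z)
        regroup = solve-∀ ℚ-ring
        f g : Fin n → ℚ
        -- The halves keep the mass at most 1, since `θ` is at most 1.
        f u = ½ * ι Nv u + (- (½ * θ)) * ι L u
        g u = ½ * ι Nv u + ½ * θ * ι L u
        0≤θι : ∀ u → 0ℚ ≤ℚ θ * ι L u
        0≤θι u = 0≤* 0≤θ (ι-nonneg L u)
        -m≤x : ∀ u → - g u ≤ℚ f u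
        -m≤x u = ≤-by (gap θ (ι Nv u) (ι L u)) (ι-nonneg Nv u)
          where
          gap : ∀ θ y z → ½ * y + (- (½ * θ)) * z - (- (½ * y + ½ * θ * z)) ≡ y
          gap = solve-∀ ℚ-ring
        x≤m : ∀ u → f u ≤ℚ g u
        x≤m u = ≤-by (gap θ (ι Nv u) (ι L u)) (0≤θι u)
          where
          gap : ∀ θ y z → ½ * y + ½ * θ * z - (½ * y + (- (½ * θ)) * z) ≡ θ * z
          gap = solve-∀ ℚ-ring
        m≤1 : ∀ u → g u ≤ℚ 1ℚ
        m≤1 u = +-mono-≤ {½ * ι Nv u} {½} {½ * θ * ι L u} {½} (*-monoˡ 0≤½ (ind-≤1 (Nv u)))
          (≤-trans (*-mono (0≤* 0≤½ 0≤θ) (*-monoˡ 0≤½ θ≤1) (ι-nonneg L u) (ind-≤1 (L u))) ≤-refl)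
        m≤ : ∀ u → g u ≤ℚ ι Nv u + θ * ι L u
        m≤ u = ≤-by (gap θ (ι Nv u) (ι L u)) (0≤* 0≤½ (0≤+ (ι-nonneg Nv u) (0≤θι u)))
          where
          gap : ∀ θ y z → y + θ * z - (½ * y + ½ * θ * z) ≡ ½ * (y + θ * z)
          gap = solve-∀ ℚ-ring
        Bxx : B f f ≡ ½ * ½ * (e₂ - θ * S v)
        Bxx = trans (B-quadratic ½ (- (½ * θ)) (ι Nv) (ι L)) (trans (expand θ e₂ (S v) (B (ι L) (ι L)))
          (trans (cong (λ z → ½ * ½ * (e₂ - 2ℚ * (θ * S v) + θ * z)) θB≡S) (collect e₂ (θ * S v))))
          where
          expand : ∀ θ e s T → ½ * ½ * e + 2ℚ * (½ * (- (½ * θ))) * s + (- (½ * θ)) * (- (½ * θ)) * T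
                 ≡ ½ * ½ * (e - 2ℚ * (θ * s) + θ * (θ * T))
          expand = solve-∀ ℚ-ring
          collect : ∀ e z → ½ * ½ * (e - 2ℚ * z + z) ≡ ½ * ½ * (e - z)
          collect = solve-∀ ℚ-ring
        Bmm : B g g ≡ ½ * ½ * (e₂ + 3ℚ * (θ * S v))
        Bmm = trans (B-quadratic ½ (½ * θ) (ι Nv) (ι L)) (trans (expand θ e₂ (S v) (B (ι L) (ι L)))
          (trans (cong (λ z → ½ * ½ * (e₂ + 2ℚ * (θ * S v) + θ * z)) θB≡S) (collect e₂ (θ * S v))))
          where
          expand : ∀ θ e s T → ½ * ½ * e + 2ℚ * (½ * (½ * θ)) * s + (½ * θ) * (½ * θ) * T
                 ≡ ½ * ½ * (e + 2ℚ * (θ * s) + θ * (θ * T))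
          expand = solve-∀ ℚ-ring
          collect : ∀ e z → ½ * ½ * (e + 2ℚ * z + z) ≡ ½ * ½ * (e + 3ℚ * z)
          collect = solve-∀ ℚ-ring
        e₂≤θS : 0ℚ ≤ℚ θ * S v - e₂
        e₂≤θS = ≤⇒0≤ (≤-trans h (≤-trans (*-monoʳ 0≤θS 1-η≤1) (≤-reflexive (*-identityˡ (θ * S v)))))
        -- The form gains at least `η` and the penalty costs at most `4 * δ`, both in units of a
        -- quarter of `θ * S v`. As `8 * δ` is at most `η`, half of the gain survives, hence the
        -- eighth.
        value≤ : η * ⅛ * (θ * S v) ≤ℚ - (B f f + δ * B g g)
        value≤ = ≤-by (trans (cong₂ (λ y z → - (y + δ * z) - η * ⅛ * (θ * S v)) Bxx Bmm) (gap η δ e₂ (θ * S v)))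
          (0≤* (ℚₚ.nonNegative⁻¹ (½ * ½)) (0≤+ (0≤+ (≤⇒0≤ h) (0≤* 0≤δ e₂≤θS)) (0≤* (0≤* 0≤½ (≤⇒0≤ δ≤)) 0≤θS)))
          where
          gap : ∀ η δ e z → - (½ * ½ * (e - z) + δ * (½ * ½ * (e + 3ℚ * z))) - η * ⅛ * z
              ≡ ½ * ½ * (((1ℚ - η) * z - e) + δ * (z - e) + ½ * (η - 8ℚ * δ) * z)
          gap = solve-∀ ℚ-ring

      module _ (dense : (1ℚ - η) * (θ * S v) ≤ℚ e₂) where

        π≥ : (1ℚ - η) * (p * (β * β)) ≤ℚ π
        π≥ = *-cancel (0<* 0<d 0<d) (subst₂ _≤ℚ_
          (trans (cong ((1ℚ - η) *_) (trans θS≡ (regroup p N α β))) (trans (cong (λ z → (1ℚ - η) * (p * (β * β) * (z * z))) Dα≡d) (swap (1ℚ - η) (p * (β * β)) (d * d))))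
          (trans (≡-sym πdd≡e₂) (*-comm π (d * d))) dense)
          where
          regroup : ∀ p N α β → p * (p * p) * (N * N) * (α * β * (α * β)) ≡ p * (β * β) * (p * N * α * (p * N * α))
          regroup = solve-∀ ℚ-ring
          swap : ∀ h x y → h * (x * y) ≡ y * (h * x)
          swap = solve-∀ ℚ-ring

        0≤pββ : 0ℚ ≤ℚ p * (β * β)
        0≤pββ = 0≤* 0≤p (0≤* 0≤β 0≤β)

        π^≥ : ∀ m → (1ℚ - η) ^ℚ m * (p * (β * β)) ^ℚ m ≤ℚ π ^ℚ m
        π^≥ m = ≤-trans (≤-reflexive (≡-sym (^-* (1ℚ - η) (p * (β * β)) m))) (^-mono m (0≤* 0≤1-η 0≤pββ) π≥)

        -- The induction hypothesis on the neighbourhood. Its value has order `π ^ℚ j * (d * d)`,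
        -- which by `π^≥` and `ω²≡` is at least `(1 - η) ^ℚ j` times the quantity in `weight≤ω²`.
        few : cliques k Nv ≤ℚ (1ℚ - η) * (d ^ℚ k * π ^ℚ tri k) → Contribution 1ℚ v
        few h = contribution (c₀ * (π ^ℚ j * (d * d)))
          (achieves-weaken ≤-refl (λ u → ≤-by (cancel (ι Nv u) (θ * ι L u)) (0≤* 0≤θ (ι-nonneg L u))) ≤-refl
            (subst (λ z → Achieves δ (ι Nv) (c₀ * (π ^ℚ j * (z * z)))) (card-∩N L v)
              (induction G Nv π (subst (0ℚ <_) (≡-sym (card-∩N L v)) 0<d)
                (trans (cong (λ z → π * (z * z)) (card-∩N L v)) πdd≡e₂)
                (subst (λ z → cliques k Nv ≤ℚ (1ℚ - η) * (z ^ℚ k * π ^ℚ tri k)) (≡-sym (card-∩N L v)) h))))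
          (gain-le (≤-trans weight≤ω² (≤-trans (≤-reflexive (cong (λ z → κ * (scaleN * z)) (trans ω²≡ (cong (λ z → (p * (β * β)) ^ℚ j * (z * z)) Dα≡d))))
            (≤-trans (*-monoʳ (0≤* 0≤scaleN (0≤* (^-nonneg j 0≤pββ) 0≤dd)) Γ-cliques)
            (≤-trans (≤-reflexive (regroup Γ c₀ ((1ℚ - η) ^ℚ j) scaleN ((p * (β * β)) ^ℚ j) (d * d)))
              (*-monoˡ (0≤* 0≤Γ 0≤scaleN) (*-monoˡ (<⇒≤ 0<c₀) (*-monoʳ 0≤dd (π^≥ j)))))))))
          where
          0≤dd : 0ℚ ≤ℚ d * d
          0≤dd = 0≤* (<⇒≤ 0<d) (<⇒≤ 0<d)
          cancel : ∀ y z → y + z - y ≡ z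
          cancel = solve-∀ ℚ-ring
          regroup : ∀ Γ c h s x y → Γ * (c * h) * (s * (x * y)) ≡ Γ * s * (c * (h * x * y))
          regroup = solve-∀ ℚ-ring

        -- The cliques pay alone, with the empty family; the lower bound for `π` to the power
        -- `tri k` completes the factor `ρ`.
        many : (1ℚ - η) * (d ^ℚ k * π ^ℚ tri k) ≤ℚ cliques k Nv → Contribution 1ℚ v
        many h = contribution 0ℚ (achieves-0 (λ u → 0≤+ (ι-nonneg Nv u) (0≤* 0≤θ (ι-nonneg L u))))
          (≤-trans (≤-reflexive (trans (cong (λ z → ρ * z) (trans (cong (expected *_) (*-identityˡ (ω ^ℚ k))) (trans weight≡ (cong (λ z → z ^ℚ k * (p * (β * β)) ^ℚ tri k) Dα≡d))))
              (regroup (1ℚ - η) ((1ℚ - η) ^ℚ tri k) (d ^ℚ k) ((p * (β * β)) ^ℚ tri k))))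
            (≤-trans (*-monoˡ 0≤1-η (*-monoˡ (^-nonneg k (<⇒≤ 0<d)) (π^≥ (tri k))))
            (≤-trans h (≤-reflexive (finish (cliques k Nv) (Γ * scaleN))))))
          where
          regroup : ∀ h hb x y → h * hb * (x * y) ≡ h * (x * (hb * y))
          regroup = solve-∀ ℚ-ring
          finish : ∀ c z → c ≡ 1ℚ * c + z * 0ℚ
          finish = solve-∀ ℚ-ring

      by-cliques : (1ℚ - η) * (θ * S v) ≤ℚ e₂ →
        (cliques k Nv ≤ℚ (1ℚ - η) * (d ^ℚ k * π ^ℚ tri k)) ⊎ ((1ℚ - η) * (d ^ℚ k * π ^ℚ tri k) ≤ℚ cliques k Nv) → Contribution 1ℚ v
      by-cliques dense (inj₁ h) = few dense h
      by-cliques dense (inj₂ h) = many dense h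

      by-edges : (e₂ ≤ℚ (1ℚ - η) * (θ * S v)) ⊎ ((1ℚ - η) * (θ * S v) ≤ℚ e₂) → Contribution 1ℚ v
      by-edges (inj₁ h) = sparse h
      by-edges (inj₂ h) = by-cliques h (≤-total (cliques k Nv) ((1ℚ - η) * (d ^ℚ k * π ^ℚ tri k)))

      nonIsolated : Contribution 1ℚ v
      nonIsolated = by-edges (≤-total e₂ ((1ℚ - η) * (θ * S v)))

    vertex : ∀ v → Contribution (ι L v) v
    vertex v with L v | deg≤ v
    ... | false | _ = empty-contribution 0ℚ v ≤-refl (*-zeroˡ (deg L v)) (*-zeroˡ (S v))
    ... | true  | d≤ with sum-ind-discrete (L ∩N v)
    ...   | inj₂ 1≤card = NonIsolated.nonIsolated v (subst (1ℚ ≤ℚ_) (card-∩N L v) 1≤card)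
              (subst₂ _≤ℚ_ (*-identityˡ (deg L v)) (*-identityˡ (K * D)) d≤)
    ...   | inj₁ card≡0 = empty-contribution 1ℚ v 0≤1 (trans (*-identityˡ (deg L v)) d≡0)
              (trans (*-identityˡ (S v)) (ℚₚ.≤-antisym (≤-trans (S≤ v) (≤-reflexive (trans (cong (K * D *_) d≡0) (*-zeroʳ (K * D)))))
                (B-ι-nonneg (L ∩N v) L)))
      where
      d≡0 : deg L v ≡ 0ℚ
      d≡0 = trans (≡-sym (card-∩N L v)) card≡0

    open Contribution

    z : Fin n → ℚ
    z = ι L

    total-deg : sum (λ v → z v * deg L v) ≡ D * N
    total-deg = trans (≡-sym (B-deg z L)) (trans (≡-sym edges) (assoc p N))
      where
      assoc : ∀ p N → p * (N * N) ≡ p * N * N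
      assoc = solve-∀ ℚ-ring

    sum-α : sum (λ v → z v * α (vertex v)) ≡ N
    sum-α = ℚₚ.≤-antisym (*-cancel 0<D (≤-reflexive eq)) (*-cancel 0<D (≤-reflexive (≡-sym eq)))
      where
      swap : ∀ D z α → D * (z * α) ≡ z * (D * α)
      swap = solve-∀ ℚ-ring
      eq : D * sum (λ v → z v * α (vertex v)) ≡ D * N
      eq = trans (≡-sym (sum-*ˡ D (λ v → z v * α (vertex v))))
        (trans (sum-cong-≗ (λ v → trans (swap D (z v) (α (vertex v))) (α-deg (vertex v)))) total-deg)

    X : ℚ
    X = sum (λ v → z v * (α (vertex v) * β (vertex v)))

    -- Double counting of walks of length two: summed over `v`, the degree of `u` is counted once
    -- for every neighbour of `u`.
    DDX : D * D * X ≡ sum (λ u → z u * (deg L u * deg L u))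
    DDX = begin
      D * D * X                                                    ≡⟨ sum-*ˡ (D * D) (λ v → z v * (α (vertex v) * β (vertex v))) ⟨
      sum (λ v → D * D * (z v * (α (vertex v) * β (vertex v))))    ≡⟨ sum-cong-≗ (λ v → trans (swap (D * D) (z v) (α (vertex v) * β (vertex v))) (αβ-deg (vertex v))) ⟩
      sum (λ v → z v * S v)                                        ≡⟨ sum-cong-≗ (λ v → trans (cong (z v *_) (B-deg (ι (L ∩N v)) L)) (≡-sym (sum-*ˡ (z v) (λ u → ι (L ∩N v) u * deg L u)))) ⟩
      sum₂ (λ v u → z v * (ι (L ∩N v) u * deg L u))                ≡⟨ sum-swap (λ v u → z v * (ι (L ∩N v) u * deg L u)) ⟩
      sum₂ (λ u v → z v * (ι (L ∩N v) u * deg L u))                ≡⟨ sum₂-cong (λ u v → trans (cong (λ y → z v * (y * deg L u)) (trans (ι-∩N L v u) (cong (λ y → z u * ind y) (Graph.sym G v u)))) (regroup (z v) (z u) (a u v) (deg L u))) ⟩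
      sum₂ (λ u v → z u * deg L u * (a u v * z v))                 ≡⟨ sum-cong-≗ (λ u → trans (sum-*ˡ (z u * deg L u) (λ v → a u v * z v)) (*-assoc (z u) (deg L u) (deg L u))) ⟩
      sum (λ u → z u * (deg L u * deg L u))                        ∎
      where
      open ≡-Reasoning
      swap : ∀ D z y → D * (z * y) ≡ z * (D * y)
      swap = solve-∀ ℚ-ring
      regroup : ∀ x y a d → x * (y * a * d) ≡ y * d * (a * x)
      regroup = solve-∀ ℚ-ring

    -- Cauchy-Schwarz in linear form: expand the nonnegative sum of the squares of `deg L u - D`.
    X-lower : 2ℚ * N - card L ≤ℚ X
    X-lower = *-cancel (0<* 0<D 0<D) (≤-by eq (sum-nonneg (λ u → 0≤* (ι-nonneg L u) (square-nonneg (deg L u - D)))))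
      where
      expand : ∀ z d D → z * ((d - D) * (d - D)) ≡ 1ℚ * (z * (d * d)) + D * ((- 2ℚ) * (z * d) + D * z)
      expand = solve-∀ ℚ-ring
      finish : ∀ Y D N c → Y - D * D * (2ℚ * N - c) ≡ 1ℚ * Y + D * ((- 2ℚ) * (D * N) + D * c)
      finish = solve-∀ ℚ-ring
      eq : D * D * X - D * D * (2ℚ * N - card L) ≡ sum (λ u → z u * ((deg L u - D) * (deg L u - D)))
      eq = trans (cong (λ y → y - D * D * (2ℚ * N - card L)) DDX)
        (trans (finish (sum (λ u → z u * (deg L u * deg L u))) D N (card L))
        (≡-sym (trans (sum-cong-≗ (λ u → expand (z u) (deg L u) D))
          (trans (sum-linear 1ℚ D (λ u → z u * (deg L u * deg L u)) (λ u → (- 2ℚ) * (z u * deg L u) + D * z u))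
          (cong (λ y → 1ℚ * sum (λ u → z u * (deg L u * deg L u)) + D * y)
            (trans (sum-linear (- 2ℚ) D (λ u → z u * deg L u) z) (cong (λ y → (- 2ℚ) * y + D * card L) total-deg)))))))

    X-upper : X ≤ℚ K * N
    X-upper = ≤-trans (sum-mono step) (≤-reflexive (trans (sum-*ˡ K (λ v → z v * α (vertex v))) (cong (K *_) sum-α)))
      where
      regroup : ∀ z α K → z * (α * K) ≡ K * (z * α)
      regroup = solve-∀ ℚ-ring
      step : ∀ v → z v * (α (vertex v) * β (vertex v)) ≤ℚ K * (z v * α (vertex v))
      step v = ≤-trans (*-monoˡ (ι-nonneg L v) (*-monoˡ (0≤α (vertex v)) (β≤K (vertex v)))) (≤-reflexive (regroup (z v) (α (vertex v)) K))

    weight : Fin n → ℚ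
    weight v = z v * (α (vertex v) * β (vertex v) ^ℚ j) ^ℚ k

    -- The convexity step. The bound `ω^k≥linear` is tangent at `α` = `β` = 1, so summing it needs
    -- only `sum-α` and `X-lower`. The coefficient of `card L` in the resulting bound is negative,
    -- which is why `card≤N` goes the right way.
    sum-weight : N ≤ℚ sum weight
    sum-weight = ≤-trans combine (≤-trans (≤-reflexive (≡-sym linear)) (sum-mono (λ v → *-monoˡ (ι-nonneg L v) (ω^k≥ v))))
      where
      κ : ℚ
      κ = ℕ→ℚ k
      lower : Fin n → ℚ
      lower v = (1ℚ - κ) + κ * (2ℚ - κ) * α (vertex v) + κ * (κ - 1ℚ) * (α (vertex v) * β (vertex v))
      ω^k≥ : ∀ v → lower v ≤ℚ (α (vertex v) * β (vertex v) ^ℚ j) ^ℚ k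
      ω^k≥ v = VertexArithmetic.ω^k≥linear {N} {p} {K} 0≤N 0≤p p≤1 (0≤α (vertex v)) (α≤K (vertex v)) (0≤β (vertex v)) (β≤K (vertex v)) i
      expand : ∀ z κ α y → z * ((1ℚ - κ) + κ * (2ℚ - κ) * α + κ * (κ - 1ℚ) * y) ≡ (1ℚ - κ) * z + κ * ((2ℚ - κ) * (z * α) + (κ - 1ℚ) * (z * y))
      expand = solve-∀ ℚ-ring
      linear : sum (λ v → z v * lower v) ≡ (1ℚ - κ) * card L + κ * ((2ℚ - κ) * N + (κ - 1ℚ) * X)
      linear = trans (sum-cong-≗ (λ v → expand (z v) κ (α (vertex v)) (α (vertex v) * β (vertex v))))
        (trans (sum-linear (1ℚ - κ) κ z (λ v → (2ℚ - κ) * (z v * α (vertex v)) + (κ - 1ℚ) * (z v * (α (vertex v) * β (vertex v)))))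
        (cong (λ y → (1ℚ - κ) * card L + κ * y) (trans (sum-linear (2ℚ - κ) (κ - 1ℚ) (λ v → z v * α (vertex v)) (λ v → z v * (α (vertex v) * β (vertex v))))
          (cong (λ y → (2ℚ - κ) * y + (κ - 1ℚ) * X) sum-α))))
      gap : ∀ κ N c X → (1ℚ - κ) * c + κ * ((2ℚ - κ) * N + (κ - 1ℚ) * X) - N
          ≡ κ * (κ - 1ℚ) * (X - (2ℚ * N - c)) + (κ - 1ℚ) * (κ + 1ℚ) * (N - c)
      gap = solve-∀ ℚ-ring
      0≤κ-1 : 0ℚ ≤ℚ κ - 1ℚ
      0≤κ-1 = ≤⇒0≤ (1≤ℕ→ℚ-suc j)
      combine : N ≤ℚ (1ℚ - κ) * card L + κ * ((2ℚ - κ) * N + (κ - 1ℚ) * X)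
      combine = ≤-by (gap κ N (card L) X) (0≤+ (0≤* (0≤* (ℕ→ℚ-nonneg k) 0≤κ-1) (≤⇒0≤ X-lower))
        (0≤* (0≤* 0≤κ-1 (0≤+ (ℕ→ℚ-nonneg k) 0≤1)) (≤⇒0≤ card≤N)))

    V : ℚ
    V = sum (λ v → val (vertex v))

    sum-gain : ρ * (expected * N) ≤ℚ cliques (suc k) L + Γ * scaleN * V
    sum-gain = ≤-trans (*-monoˡ 0≤ρ (*-monoˡ 0≤expected sum-weight))
      (≤-trans (≤-reflexive (≡-sym left)) (≤-trans (sum-mono (λ v → gain (vertex v))) (≤-reflexive right)))
      where
      left : sum (λ v → ρ * (expected * weight v)) ≡ ρ * (expected * sum weight)
      left = trans (sum-*ˡ ρ (λ v → expected * weight v)) (cong (ρ *_) (sum-*ˡ expected weight))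
      right : sum (λ v → z v * cliques k (L ∩N v) + Γ * scaleN * val (vertex v)) ≡ cliques (suc k) L + Γ * scaleN * V
      right = trans (sum-+ (λ v → z v * cliques k (L ∩N v)) (λ v → Γ * scaleN * val (vertex v)))
        (cong (cliques (suc k) L +_) (sum-*ˡ (Γ * scaleN) (λ v → val (vertex v))))

    -- Otherwise every degree in `L` is below 1, hence zero, although `L` spans edges. It makes the
    -- weight of the families in `core` a legitimate probability.
    1≤KD : 1ℚ ≤ℚ K * D
    1≤KD with 1ℚ ≤? K * D
    ... | yes h = h
    ... | no ¬h = contradiction (trans (≡-sym total-deg) (trans (sum-cong-≗ isolated) (trans (sum-*ˡ 0ℚ z) (*-zeroˡ (card L)))))
                    (λ e → ℚₚ.<⇒≢ (0<* 0<D 0<N) (≡-sym e))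
      where
      isolated : ∀ u → z u * deg L u ≡ 0ℚ * z u
      isolated u with L u | deg≤ u
      ... | false | _ = trans (*-zeroˡ (deg L u)) (≡-sym (*-zeroˡ 0ℚ))
      ... | true  | d≤ with sum-ind-discrete (L ∩N u)
      ...   | inj₁ card≡0 = trans (cong (1ℚ *_) (trans (≡-sym (card-∩N L u)) card≡0)) (*-zeroʳ 1ℚ)
      ...   | inj₂ 1≤card = contradiction (≤-trans (subst (1ℚ ≤ℚ_) (trans (card-∩N L u) (≡-sym (*-identityˡ (deg L u)))) 1≤card)
                              (≤-trans d≤ (≤-reflexive (*-identityˡ (K * D))))) ¬h

    -- A vertex lies in at most `K * D` neighbourhoods, and the multiples of `ι L` add `p * X`,
    -- which `X-upper` bounds by `K * D` as well.
    total-budget : ∀ u → sum (λ v → z v * (ι (L ∩N v) u + p * (α (vertex v) * β (vertex v)) * z u)) ≤ℚ 2ℚ * K * D * z u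
    total-budget u = ≤-trans (≤-reflexive eq) (≤-trans
      (+-mono-≤ (≤-trans (≤-reflexive (*-identityˡ (z u * deg L u))) (deg≤ u)) (*-monoˡ (0≤* 0≤p (ι-nonneg L u)) X-upper))
      (≤-reflexive (finish (z u) K p N)))
      where
      expand : ∀ x y a w p → x * (y * a + p * w * y) ≡ 1ℚ * (y * (a * x)) + p * y * (x * w)
      expand = solve-∀ ℚ-ring
      finish : ∀ y K p N → y * (K * (p * N)) + p * y * (K * N) ≡ 2ℚ * K * (p * N) * y
      finish = solve-∀ ℚ-ring
      eq : sum (λ v → z v * (ι (L ∩N v) u + p * (α (vertex v) * β (vertex v)) * z u)) ≡ 1ℚ * (z u * deg L u) + p * z u * X
      eq = trans (sum-cong-≗ (λ v → trans (cong (λ y → z v * (y + p * (α (vertex v) * β (vertex v)) * z u))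
                   (trans (ι-∩N L v u) (cong (λ y → z u * ind y) (Graph.sym G v u))))
                 (expand (z v) (z u) (a u v) (α (vertex v) * β (vertex v)) p)))
           (trans (sum-linear 1ℚ (p * z u) (λ v → z u * (a u v * z v)) (λ v → z v * (α (vertex v) * β (vertex v))))
           (cong (λ y → 1ℚ * y + p * z u * X) (sum-*ˡ (z u) (λ v → a u v * z v))))

    -- The cliques number at most `1 - ε` times the expected count, whereas `sum-gain` asks for `ρ`,
    -- at least `1 - ½ * ε`, of it. The certificates must supply the difference, and weighting them
    -- by the inverse of `2 * K * D` brings their joint budget down to `ι L`.
    core : ∀ {ε c} → 0ℚ < K → 0ℚ < Γ → 1ℚ - ½ * ε ≤ℚ ρ → c * (2ℚ * K * Γ) ≤ℚ ½ * ε →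
           cliques (suc k) L ≤ℚ (1ℚ - ε) * (N ^ℚ suc k * p ^ℚ tri (suc k)) →
           Achieves δ (ι L) (c * (p ^ℚ k * (N * N)))
    core {ε} {c} 0<K 0<Γ ρ≥ c≤ few = achieves-weaken ≤-refl budget≤ value≤
      (achieves-scale λ₀ 0≤λ λ≤1 (achieves-sum _ (λ v → val (vertex v)) (λ v → achieves (vertex v))))
      where
      0<2KD : 0ℚ < 2ℚ * K * D
      0<2KD = 0<* (0<* (ℚₚ.positive⁻¹ 2ℚ) 0<K) 0<D
      λ₀ : ℚ
      λ₀ = proj₁ (inverse 0<2KD)
      0≤λ : 0ℚ ≤ℚ λ₀
      0≤λ = <⇒≤ (proj₁ (proj₂ (inverse 0<2KD)))
      λ-inverse : 2ℚ * K * D * λ₀ ≡ 1ℚ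
      λ-inverse = proj₂ (proj₂ (inverse 0<2KD))
      λ≤1 : λ₀ ≤ℚ 1ℚ
      λ≤1 = ≤-by (trans (cong (_- λ₀) (≡-sym λ-inverse)) (gap K D λ₀)) (0≤* 0≤λ (0≤+ (≤⇒0≤ 1≤KD) (0≤* 0≤K (<⇒≤ 0<D))))
        where
        gap : ∀ K D l → 2ℚ * K * D * l - l ≡ l * ((K * D - 1ℚ) + K * D)
        gap = solve-∀ ℚ-ring
      budget≤ : ∀ u → λ₀ * sum (λ v → z v * (ι (L ∩N v) u + p * (α (vertex v) * β (vertex v)) * z u)) ≤ℚ z u
      budget≤ u = ≤-trans (*-monoˡ 0≤λ (total-budget u))
        (≤-reflexive (trans (regroup λ₀ (2ℚ * K * D) (z u)) (trans (cong (_* z u) λ-inverse) (*-identityˡ (z u)))))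
        where
        regroup : ∀ l y z → l * (y * z) ≡ y * l * z
        regroup = solve-∀ ℚ-ring
      expectedN : expected * N ≡ scaleN * (p * p ^ℚ k * (N * (N * N)))
      expectedN = trans (cong (λ y → N ^ℚ k * y * N) (^-+ p k (tri k))) (regroup N (N ^ℚ i) (p ^ℚ k) p (p ^ℚ (i ℕ.+ tri j)))
        where
        regroup : ∀ N Ni pk p pt → N * (N * Ni) * (pk * (p * pt)) * N ≡ Ni * pt * (p * pk * (N * (N * N)))
        regroup = solve-∀ ℚ-ring
      0≤expectedN : 0ℚ ≤ℚ expected * N
      0≤expectedN = 0≤* 0≤expected 0≤N
      ΓV≥ : ½ * ε * (p * p ^ℚ k * (N * (N * N))) ≤ℚ Γ * V
      ΓV≥ = *-cancel (0<* (^-pos i 0<N) (^-pos (i ℕ.+ tri j) 0<p)) (subst₂ _≤ℚ_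
          (trans (cong (½ * ε *_) expectedN) (swap (½ * ε) scaleN (p * p ^ℚ k * (N * (N * N)))))
          (assoc Γ scaleN V)
          (≤-by (gap ε ρ (expected * N) (cliques (suc k) L) (Γ * scaleN * V))
            (0≤+ (0≤+ (≤⇒0≤ few′) (≤⇒0≤ sum-gain)) (0≤* (≤⇒0≤ ρ≥) 0≤expectedN))))
        where
        swap : ∀ h s y → h * (s * y) ≡ s * (h * y)
        swap = solve-∀ ℚ-ring
        assoc : ∀ C s V → C * s * V ≡ s * (C * V)
        assoc = solve-∀ ℚ-ring
        regroup : ∀ N x y → N * x * y ≡ x * y * N
        regroup = solve-∀ ℚ-ring
        few′ : cliques (suc k) L ≤ℚ (1ℚ - ε) * (expected * N)
        few′ = ≤-trans few (≤-reflexive (cong ((1ℚ - ε) *_) (regroup N (N ^ℚ k) (p ^ℚ tri (suc k)))))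
        gap : ∀ ε ρ E t V → V - ½ * ε * E ≡ (((1ℚ - ε) * E - t) + (t + V - ρ * E)) + (ρ - (1ℚ - ½ * ε)) * E
        gap = solve-∀ ℚ-ring
      value≤ : c * (p ^ℚ k * (N * N)) ≤ℚ λ₀ * V
      value≤ = *-cancel (0<* 0<Γ 0<2KD) (subst₂ _≤ℚ_ (left c K Γ p (p ^ℚ k) N)
          (≡-sym (trans (regroup Γ (2ℚ * K * D) λ₀ V) (trans (cong (_* (Γ * V)) λ-inverse) (*-identityˡ (Γ * V)))))
          (≤-trans (*-monoʳ (0≤* (0≤* 0≤p (^-nonneg k 0≤p)) (0≤* 0≤N (0≤* 0≤N 0≤N))) c≤) ΓV≥))
        where
        left : ∀ c K Γ p pk N → c * (2ℚ * K * Γ) * (p * pk * (N * (N * N))) ≡ Γ * (2ℚ * K * (p * N)) * (c * (pk * (N * N)))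
        left = solve-∀ ℚ-ring
        regroup : ∀ Γ y l V → Γ * y * (l * V) ≡ y * l * (Γ * V)
        regroup = solve-∀ ℚ-ring

-- Heavy vertices: reduction to bounded degrees.

SurplusFor : ℕ → Set
SurplusFor k = ∀ ε → 0ℚ < ε → ε ≤ℚ 1ℚ → Σ[ c ∈ ℚ ] Σ[ δ ∈ ℚ ] (0ℚ < c) × (0ℚ < δ) × Target k ε c δ

does-true : {P : Set} (P? : Dec P) → does P? ≡ true → P
does-true (yes h) _ = h

does-false : {P : Set} (P? : Dec P) → does P? ≡ false → ¬ P
does-false (no h) _ = h

sum-ind-positive : ∀ {n} (f : Fin n → Bool) → 0ℚ < sum (ind ∘ f) → 1ℚ ≤ℚ sum (ind ∘ f)
sum-ind-positive f h with sum-ind-discrete f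
... | inj₁ sum≡0 = contradiction (subst (0ℚ <_) sum≡0 h) (ℚₚ.<-irrefl refl)
... | inj₂ 1≤sum = 1≤sum

square-positive : ∀ {x} → 0ℚ ≤ℚ x → 0ℚ < x * x → 0ℚ < x
square-positive {x} 0≤x h with x ≤? 0ℚ
... | no x≰0  = ≰⇒> x≰0
... | yes x≤0 = contradiction (<-≤-trans h (≤-trans (*-monoˡ 0≤x x≤0) (≤-reflexive (*-zeroʳ x)))) (ℚₚ.<-irrefl refl)

0≤⇒≡0 : ∀ {x} → 0ℚ ≤ℚ x → ¬ 0ℚ < x → x ≡ 0ℚ
0≤⇒≡0 0≤x x≯0 = ℚₚ.≤-antisym (ℚₚ.≮⇒≥ x≯0) 0≤x

-- A vertex is heavy if its degree exceeds `K₀` times the average, and `σ` is the share of the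
-- degree sum from which the heavy vertices matter. `K` is twice `K₀` because deleting heavy
-- vertices below that share may halve the density.
module Reduction (i : ℕ)
  {ε σ K₀ η δ c₀ Γ c₁ c : ℚ} (0<ε : 0ℚ < ε) (ε≤1 : ε ≤ℚ 1ℚ)
  (0<σ : 0ℚ < σ) (σ≤1 : 4ℚ * σ ≤ℚ 1ℚ) (σ-small : 1ℚ - ½ * ε ≤ℚ (1ℚ - 2ℚ * σ) ^ℚ tri (suc (suc (suc i))))
  (σK₀ : σ * K₀ ≡ ℕ→ℚ 6) (2≤K₀ : 2ℚ ≤ℚ K₀)
  (0<η : 0ℚ < η) (η≤1 : η ≤ℚ 1ℚ) (η-small : 1ℚ - ½ * (½ * ε) ≤ℚ (1ℚ - η) ^ℚ suc (tri (suc (suc i))))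
  (0<δ : 0ℚ < δ) (δ≤η : 8ℚ * δ ≤ℚ η) (δ≤σ : 4ℚ * δ ≤ℚ σ * σ)
  (0<c₀ : 0ℚ < c₀) (induction : Target (suc i) η c₀ δ)
  (0<Γ : 0ℚ < Γ)
  (Γ-sparse : (2ℚ * K₀ * (2ℚ * K₀) ^ℚ suc i) ^ℚ i * ((2ℚ * K₀) ^ℚ i * (2ℚ * K₀) ^ℚ i) ≤ℚ Γ * (η * ⅛))
  (Γ-cliques : (2ℚ * K₀ * (2ℚ * K₀) ^ℚ suc i) ^ℚ i ≤ℚ Γ * (c₀ * (1ℚ - η) ^ℚ suc i))
  (0<c₁ : 0ℚ < c₁) (c₁≤ : c₁ * (2ℚ * (2ℚ * K₀) * Γ) ≤ℚ ½ * (½ * ε))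
  (0<c : 0ℚ < c) (c≤c₁ : c ≤ℚ c₁ * ½ ^ℚ suc (suc i)) (c≤σ : 4ℚ * c ≤ℚ σ * σ)
  where

  j k : ℕ
  j = suc i
  k = suc j

  K : ℚ
  K = 2ℚ * K₀

  0≤σ : 0ℚ ≤ℚ σ
  0≤σ = <⇒≤ 0<σ

  0<K₀ : 0ℚ < K₀
  0<K₀ = <-≤-trans (ℚₚ.positive⁻¹ 2ℚ) 2≤K₀

  -- Written in the average degree `p * N` and the density `p`, the count has no other dependence on
  -- `N`. It therefore grows on passing to a smaller set in which both have grown; `surplus-size`
  -- does the same for the value.
  random-count : ∀ N p → N ^ℚ suc k * p ^ℚ tri (suc k) ≡ (p * N) ^ℚ suc k * p ^ℚ (i ℕ.+ tri j)
  random-count N p = trans (cong (N ^ℚ suc k *_) (trans (^-+ p k (tri k)) (swap (p ^ℚ k) p (p ^ℚ (i ℕ.+ tri j)))))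
    (trans (≡-sym (*-assoc (N ^ℚ suc k) (p ^ℚ suc k) (p ^ℚ (i ℕ.+ tri j))))
      (cong (_* p ^ℚ (i ℕ.+ tri j)) (trans (*-comm (N ^ℚ suc k) (p ^ℚ suc k)) (≡-sym (^-* p N (suc k))))))
    where
    swap : ∀ x p y → x * (p * y) ≡ p * x * y
    swap = solve-∀ ℚ-ring

  surplus-size : ∀ N p → p ^ℚ k * (N * N) ≡ (p * N) * (p * N) * p ^ℚ i
  surplus-size N p = regroup N p (p ^ℚ i)
    where
    regroup : ∀ N p x → p * (p * x) * (N * N) ≡ p * N * (p * N) * x
    regroup = solve-∀ ℚ-ring

  module Split {n} (G : Graph n) where

    open Form G
    open Cliques G
    open Certificate G

    module At (U : VertexSet) (p : ℚ) (0<N : 0ℚ < card U) (0<p : 0ℚ < p) (edges : p * (card U * card U) ≡ B (ι U) (ι U))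
      (heavy : Fin n → Bool) (heavy-true : ∀ u → heavy u ≡ true → K₀ * (p * card U) ≤ℚ deg U u)
      (heavy-false : ∀ u → heavy u ≡ false → deg U u ≤ℚ K₀ * (p * card U)) where

      N D T : ℚ
      N = card U
      D = p * N
      T = B (ι U) (ι U)

      0<D : 0ℚ < D
      0<D = 0<* 0<p 0<N

      0≤p : 0ℚ ≤ℚ p
      0≤p = <⇒≤ 0<p

      0≤NN : 0ℚ ≤ℚ N * N
      0≤NN = <⇒≤ (0<* 0<N 0<N)

      T≡DN : T ≡ D * N
      T≡DN = trans (≡-sym edges) (assoc p N)
        where
        assoc : ∀ p N → p * (N * N) ≡ p * N * N
        assoc = solve-∀ ℚ-ring

      p≤1 : p ≤ℚ 1ℚ
      p≤1 = *-cancel (0<* 0<N 0<N) (subst₂ _≤ℚ_ (trans (≡-sym edges) (*-comm p (N * N))) (≡-sym (*-identityʳ (N * N))) (B≤card² U))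

      H L : VertexSet
      H u = U u ∧ heavy u
      L u = U u ∧ not (heavy u)

      H+L : ∀ u → ι U u ≡ 1ℚ * ι H u + 1ℚ * ι L u
      H+L u with U u | heavy u
      ... | false | _     = refl
      ... | true  | true  = refl
      ... | true  | false = refl

      H≤U : ∀ u → ι H u ≤ℚ ι U u
      H≤U u = ≤-by (trans (cong (_- ι H u) (H+L u)) (cancel (ι H u) (ι L u))) (ι-nonneg L u)
        where
        cancel : ∀ h l → 1ℚ * h + 1ℚ * l - h ≡ l
        cancel = solve-∀ ℚ-ring

      L≤U : ∀ u → ι L u ≤ℚ ι U u
      L≤U u = ≤-by (trans (cong (_- ι L u) (H+L u)) (cancel (ι H u) (ι L u))) (ι-nonneg H u)
        where
        cancel : ∀ h l → 1ℚ * h + 1ℚ * l - l ≡ h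
        cancel = solve-∀ ℚ-ring

      vol hh hl ll : ℚ
      vol = B (ι H) (ι U)
      hh = B (ι H) (ι H)
      hl = B (ι H) (ι L)
      ll = B (ι L) (ι L)

      vol≡ : vol ≡ hh + hl
      vol≡ = trans (sum₂-cong (λ u w → cong (λ y → a u w * (ι H u * y)) (H+L w)))
        (trans (B-linearʳ 1ℚ 1ℚ (ι H) (ι L) (ι H)) (cong₂ _+_ (*-identityˡ hh) (*-identityˡ hl)))

      T≡ : T ≡ hh + 2ℚ * hl + ll
      T≡ = trans (sum₂-cong (λ u w → cong₂ (λ x y → a u w * (x * y)) (H+L u) (H+L w)))
        (trans (B-quadratic 1ℚ 1ℚ (ι H) (ι L)) (collect hh hl ll))
        where
        collect : ∀ x y z → 1ℚ * 1ℚ * x + 2ℚ * (1ℚ * 1ℚ) * y + 1ℚ * 1ℚ * z ≡ x + 2ℚ * y + z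
        collect = solve-∀ ℚ-ring

      0≤hh : 0ℚ ≤ℚ hh
      0≤hh = B-ι-nonneg H H

      0≤T : 0ℚ ≤ℚ T
      0≤T = B-ι-nonneg U U

      K₀D-card-H≤vol : K₀ * D * card H ≤ℚ vol
      K₀D-card-H≤vol = ≤-trans (≤-reflexive (≡-sym (sum-*ˡ (K₀ * D) (ι H)))) (≤-trans (sum-mono step) (≤-reflexive (≡-sym (B-deg (ι H) U))))
        where
        step : ∀ u → K₀ * D * ι H u ≤ℚ ι H u * deg U u
        step u with U u | heavy u | heavy-true u
        ... | false | _     | _ = ≤-reflexive (trans (*-zeroʳ (K₀ * D)) (≡-sym (*-zeroˡ (deg U u))))
        ... | true  | false | _ = ≤-reflexive (trans (*-zeroʳ (K₀ * D)) (≡-sym (*-zeroˡ (deg U u))))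
        ... | true  | true  | h = ≤-trans (≤-reflexive (*-identityʳ (K₀ * D))) (≤-trans (h refl) (≤-reflexive (≡-sym (*-identityˡ (deg U u)))))

      deg-L : ∀ u → ι L u * deg U u ≤ℚ ι L u * (K₀ * D)
      deg-L u with U u | heavy u | heavy-false u
      ... | false | _     | _ = ≤-reflexive (trans (*-zeroˡ (deg U u)) (≡-sym (*-zeroˡ (K₀ * D))))
      ... | true  | true  | _ = ≤-reflexive (trans (*-zeroˡ (deg U u)) (≡-sym (*-zeroˡ (K₀ * D))))
      ... | true  | false | h = *-monoˡ 0≤1 (h refl)

      -- Each heavy vertex takes at least `2 * D` of the degree sum `D * N`.
      card-H≤½N : card H ≤ℚ ½ * N
      card-H≤½N = *-cancel (0<* (ℚₚ.positive⁻¹ 2ℚ) 0<D) (≤-trans (*-monoʳ (card-nonneg H) (*-monoʳ (<⇒≤ 0<D) 2≤K₀))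
        (≤-trans K₀D-card-H≤vol (≤-trans (B-mono (ι-nonneg H) H≤U (ι-nonneg U) (λ _ → ≤-refl)) (≤-reflexive (trans T≡DN (halve D N))))))
        where
        halve : ∀ D N → D * N ≡ 2ℚ * D * (½ * N)
        halve = solve-∀ ℚ-ring

      -- The vector is -1 on `H` and only `σ` on `L`: the edges inside `L` then cost at most
      -- `σ * σ * T`, while those across gain `2 * σ * hl`, and `hl` is nearly `vol` because `hh` is
      -- small.
      cut-certificate : σ * T ≤ℚ vol → hh ≤ℚ D * card H → Achieves δ (ι U) (c * (p ^ℚ k * (N * N)))
      cut-certificate large sparse = achieves-weaken ≤-refl g≤ι value≤ (achieves-single f g -g≤f f≤g (λ u → ≤-trans (g≤ι u) (ind-≤1 (U u))))
        where
        f g : Fin n → ℚ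
        f u = σ * ι L u + (- 1ℚ) * ι H u
        g u = σ * ι L u + 1ℚ * ι H u
        0≤σι : ∀ u → 0ℚ ≤ℚ σ * ι L u
        0≤σι u = 0≤* 0≤σ (ι-nonneg L u)
        -g≤f : ∀ u → - g u ≤ℚ f u
        -g≤f u = ≤-by (gap (σ * ι L u) (ι H u)) (0≤+ (0≤σι u) (0≤σι u))
          where
          gap : ∀ x h → x + (- 1ℚ) * h - (- (x + 1ℚ * h)) ≡ x + x
          gap = solve-∀ ℚ-ring
        f≤g : ∀ u → f u ≤ℚ g u
        f≤g u = ≤-by (gap (σ * ι L u) (ι H u)) (0≤+ (ι-nonneg H u) (ι-nonneg H u))
          where
          gap : ∀ x h → x + 1ℚ * h - (x + (- 1ℚ) * h) ≡ h + h
          gap = solve-∀ ℚ-ring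
        0≤1-4σ : 0ℚ ≤ℚ 1ℚ - 4ℚ * σ
        0≤1-4σ = ≤⇒0≤ σ≤1
        0≤1-σ : 0ℚ ≤ℚ 1ℚ - σ
        0≤1-σ = 0≤-resp (split σ) (0≤+ 0≤1-4σ (0≤* (ℚₚ.nonNegative⁻¹ 3ℚ) 0≤σ))
          where
          split : ∀ s → 1ℚ - s ≡ (1ℚ - 4ℚ * s) + 3ℚ * s
          split = solve-∀ ℚ-ring
        g≤ι : ∀ u → g u ≤ℚ ι U u
        g≤ι u = ≤-by (trans (cong (_- g u) (H+L u)) (gap σ (ι H u) (ι L u))) (0≤* 0≤1-σ (ι-nonneg L u))
          where
          gap : ∀ s h l → 1ℚ * h + 1ℚ * l - (s * l + 1ℚ * h) ≡ (1ℚ - s) * l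
          gap = solve-∀ ℚ-ring
        Bff : B f f ≡ σ * σ * ll + 2ℚ * (σ * (- 1ℚ)) * hl + (- 1ℚ) * (- 1ℚ) * hh
        Bff = trans (B-quadratic σ (- 1ℚ) (ι L) (ι H))
          (cong (λ y → σ * σ * ll + 2ℚ * (σ * (- 1ℚ)) * y + (- 1ℚ) * (- 1ℚ) * hh) (B-sym (ι L) (ι H)))
        Bgg≤T : B g g ≤ℚ T
        Bgg≤T = B-mono 0≤g g≤ι 0≤g g≤ι
          where
          0≤g : ∀ u → 0ℚ ≤ℚ g u
          0≤g u = 0≤+ (0≤σι u) (0≤* 0≤1 (ι-nonneg H u))
        6hh≤σvol : ℕ→ℚ 6 * hh ≤ℚ σ * vol
        6hh≤σvol = ≤-trans (*-monoˡ (ℕ→ℚ-nonneg 6) sparse)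
          (≤-trans (≤-reflexive (trans (cong (_* (D * card H)) (≡-sym σK₀)) (assoc σ K₀ D (card H)))) (*-monoˡ 0≤σ K₀D-card-H≤vol))
          where
          assoc : ∀ s K D h → s * K * (D * h) ≡ s * (K * D * h)
          assoc = solve-∀ ℚ-ring
        -- Of the gain `2 * σ * vol`, three quarters outweigh `σ * σ * ll` and leave half of
        -- `σ * σ * T`, shared between the value and the penalty. The last quarter absorbs the terms
        -- in `hh`, at most `3 * hh` in all; this is the source of the 6 in `σK₀`.
        gap : ℚ → ℚ → ℚ
        gap v t = (½ * 3ℚ) * σ * (v - σ * t) + ½ * (σ * v - ℕ→ℚ 6 * hh) + 2ℚ * hh * (1ℚ - σ) + σ * σ * (hh + 2ℚ * hl)
                + δ * (t - B g g) + ½ * ½ * (σ * σ - 4ℚ * δ) * t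
        gap-nonneg : 0ℚ ≤ℚ gap vol T
        gap-nonneg = 0≤+ (0≤+ (0≤+ (0≤+ (0≤+
          (0≤* (0≤* (ℚₚ.nonNegative⁻¹ (½ * 3ℚ)) 0≤σ) (≤⇒0≤ large))
          (0≤* 0≤½ (≤⇒0≤ 6hh≤σvol)))
          (0≤* (0≤* (ℚₚ.nonNegative⁻¹ 2ℚ) 0≤hh) 0≤1-σ))
          (0≤* (0≤* 0≤σ 0≤σ) (0≤+ 0≤hh (0≤* (ℚₚ.nonNegative⁻¹ 2ℚ) (B-ι-nonneg H L)))))
          (0≤* (<⇒≤ 0<δ) (≤⇒0≤ Bgg≤T)))
          (0≤* (0≤* (ℚₚ.nonNegative⁻¹ (½ * ½)) (≤⇒0≤ δ≤σ)) 0≤T)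
        σ²T≤value : ½ * ½ * (σ * σ) * T ≤ℚ - (B f f + δ * B g g)
        σ²T≤value = ≤-by (trans (cong₂ (λ x t → - (x + δ * B g g) - ½ * ½ * (σ * σ) * t) Bff T≡)
                    (trans (regroup σ δ hh hl ll (B g g)) (≡-sym (cong₂ gap vol≡ T≡)))) gap-nonneg
          where
          regroup : ∀ s δ hh hl ll g → - (s * s * ll + 2ℚ * (s * (- 1ℚ)) * hl + (- 1ℚ) * (- 1ℚ) * hh + δ * g) - ½ * ½ * (s * s) * (hh + 2ℚ * hl + ll)
               ≡ (½ * 3ℚ) * s * ((hh + hl) - s * (hh + 2ℚ * hl + ll)) + ½ * (s * (hh + hl) - ℕ→ℚ 6 * hh) + 2ℚ * hh * (1ℚ - s) + s * s * (hh + 2ℚ * hl)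
               + δ * ((hh + 2ℚ * hl + ll) - g) + ½ * ½ * (s * s - 4ℚ * δ) * (hh + 2ℚ * hl + ll)
          regroup = solve-∀ ℚ-ring
        value≤ : c * (p ^ℚ k * (N * N)) ≤ℚ - (B f f + δ * B g g)
        value≤ = ≤-trans (*-monoˡ (<⇒≤ 0<c) p^kNN≤T)
          (≤-trans (≤-by (quarter c (σ * σ) T) (0≤* (0≤* (ℚₚ.nonNegative⁻¹ (½ * ½)) (≤⇒0≤ c≤σ)) 0≤T)) σ²T≤value)
          where
          quarter : ∀ c s T → ½ * ½ * s * T - c * T ≡ ½ * ½ * (s - 4ℚ * c) * T
          quarter = solve-∀ ℚ-ring
          p^kNN≤T : p ^ℚ k * (N * N) ≤ℚ T
          p^kNN≤T = ≤-trans (*-monoʳ 0≤NN (≤-trans (*-monoˡ 0≤p (^-≤1 j 0≤p p≤1)) (≤-reflexive (*-identityʳ p)))) (≤-reflexive edges)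

      -- Deleting `H` removes at most a share `2 * σ` of the degree sum, so the density stays above
      -- `(1 - 2 * σ) * p` and the clique hypothesis survives with `½ * ε`.
      core-certificate : vol ≤ℚ σ * T → cliques (suc k) U ≤ℚ (1ℚ - ε) * (N ^ℚ suc k * p ^ℚ tri (suc k)) →
                         Achieves δ (ι U) (c * (p ^ℚ k * (N * N)))
      core-certificate small few = achieves-weaken ≤-refl L≤U value≤
        (Core.core G L {N} {p′} {K} i 0<N 0<p′ 0≤K card-L≤N edges-L deg-L′ 0<η η≤1 (<⇒≤ 0<δ) δ≤η 0<c₀ induction
          (<⇒≤ 0<Γ) Γ-sparse Γ-cliques {½ * ε} {c₁} 0<K 0<Γ η-small c₁≤ few′)
        where
        0<K : 0ℚ < K
        0<K = 0<* (ℚₚ.positive⁻¹ 2ℚ) 0<K₀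
        0≤K : 0ℚ ≤ℚ K
        0≤K = <⇒≤ 0<K
        0<NN : 0ℚ < N * N
        0<NN = 0<* 0<N 0<N
        p′ : ℚ
        p′ = ll * proj₁ (inverse 0<NN)
        edges-L : p′ * (N * N) ≡ ll
        edges-L = trans (regroup ll (proj₁ (inverse 0<NN)) (N * N)) (trans (cong (ll *_) (proj₂ (proj₂ (inverse 0<NN)))) (*-identityʳ ll))
          where
          regroup : ∀ l x y → l * x * y ≡ l * (y * x)
          regroup = solve-∀ ℚ-ring
        card-L≤N : card L ≤ℚ N
        card-L≤N = sum-mono L≤U
        ll≥ : (1ℚ - 2ℚ * σ) * T ≤ℚ ll
        ll≥ = ≤-by (trans (cong (_- (1ℚ - 2ℚ * σ) * T) ll≡) (gap σ vol T hh))
          (0≤+ (0≤* (ℚₚ.nonNegative⁻¹ 2ℚ) (≤⇒0≤ small)) 0≤hh)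
          where
          solve-ll : ∀ hh hl ll → ll ≡ (hh + 2ℚ * hl + ll) - 2ℚ * (hh + hl) + hh
          solve-ll = solve-∀ ℚ-ring
          ll≡ : ll ≡ T - 2ℚ * vol + hh
          ll≡ = trans (solve-ll hh hl ll) (≡-sym (cong₂ (λ t v → t - 2ℚ * v + hh) T≡ vol≡))
          gap : ∀ s v T h → T - 2ℚ * v + h - (1ℚ - 2ℚ * s) * T ≡ 2ℚ * (s * T - v) + h
          gap = solve-∀ ℚ-ring
        p′≥ : (1ℚ - 2ℚ * σ) * p ≤ℚ p′
        p′≥ = *-cancel 0<NN (subst₂ _≤ℚ_ (trans (cong ((1ℚ - 2ℚ * σ) *_) (≡-sym edges)) (regroup (1ℚ - 2ℚ * σ) p (N * N)))
                (trans (≡-sym edges-L) (*-comm p′ (N * N))) ll≥)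
          where
          regroup : ∀ h p y → h * (p * y) ≡ y * (h * p)
          regroup = solve-∀ ℚ-ring
        ½≤1-2σ : ½ ≤ℚ 1ℚ - 2ℚ * σ
        ½≤1-2σ = ≤-by (gap σ) (0≤* 0≤½ (≤⇒0≤ σ≤1))
          where
          gap : ∀ s → 1ℚ - 2ℚ * s - ½ ≡ ½ * (1ℚ - 4ℚ * s)
          gap = solve-∀ ℚ-ring
        ½p≤p′ : ½ * p ≤ℚ p′
        ½p≤p′ = ≤-trans (*-monoʳ 0≤p ½≤1-2σ) p′≥
        0<p′ : 0ℚ < p′
        0<p′ = <-≤-trans (0<* 0<½ 0<p) ½p≤p′
        deg-L′ : ∀ u → ι L u * deg L u ≤ℚ ι L u * (K * (p′ * N))
        deg-L′ u = ≤-trans (*-monoˡ (ι-nonneg L u) (deg-mono L≤U u)) (≤-trans (deg-L u) (*-monoˡ (ι-nonneg L u) (≤-trans (≤-reflexive (regroup K₀ p N))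
          (*-monoˡ 0≤K (*-monoʳ (<⇒≤ 0<N) ½p≤p′)))))
          where
          regroup : ∀ K p N → K * (p * N) ≡ 2ℚ * K * (½ * p * N)
          regroup = solve-∀ ℚ-ring
        0≤1-2σ : 0ℚ ≤ℚ 1ℚ - 2ℚ * σ
        0≤1-2σ = ≤-trans 0≤½ ½≤1-2σ
        0≤1-½ε : 0ℚ ≤ℚ 1ℚ - ½ * ε
        0≤1-½ε = 0≤-resp (split ε) (0≤+ (0≤* 0≤½ (≤⇒0≤ ε≤1)) 0≤½)
          where
          split : ∀ e → 1ℚ - ½ * e ≡ ½ * (1ℚ - e) + ½
          split = solve-∀ ℚ-ring
        -- `1 - ε` is at most the square of `1 - ½ * ε`: one factor pays for the lost density, the
        -- other remains as the new deficit.
        density : (1ℚ - ε) * p ^ℚ tri (suc k) ≤ℚ (1ℚ - ½ * ε) * p′ ^ℚ tri (suc k)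
        density = ≤-trans
          (≤-by (gap ε (p ^ℚ tri (suc k))) (0≤* (0≤* (ℚₚ.nonNegative⁻¹ (½ * ½)) (square-nonneg ε)) (^-nonneg (tri (suc k)) 0≤p)))
          (*-monoˡ 0≤1-½ε (≤-trans (*-monoʳ (^-nonneg (tri (suc k)) 0≤p) σ-small)
            (≤-trans (≤-reflexive (≡-sym (^-* (1ℚ - 2ℚ * σ) p (tri (suc k))))) (^-mono (tri (suc k)) (0≤* 0≤1-2σ 0≤p) p′≥))))
          where
          gap : ∀ e x → (1ℚ - ½ * e) * ((1ℚ - ½ * e) * x) - (1ℚ - e) * x ≡ ½ * ½ * (e * e) * x
          gap = solve-∀ ℚ-ring
        few′ : cliques (suc k) L ≤ℚ (1ℚ - ½ * ε) * (N ^ℚ suc k * p′ ^ℚ tri (suc k))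
        few′ = ≤-trans (cliques-mono (suc k) L≤U) (≤-trans few (subst₂ _≤ℚ_
          (swap (N ^ℚ suc k) (1ℚ - ε) (p ^ℚ tri (suc k))) (swap (N ^ℚ suc k) (1ℚ - ½ * ε) (p′ ^ℚ tri (suc k)))
          (*-monoˡ (^-nonneg (suc k) (<⇒≤ 0<N)) density)))
          where
          swap : ∀ x y z → x * (y * z) ≡ y * (x * z)
          swap = solve-∀ ℚ-ring
        value≤ : c * (p ^ℚ k * (N * N)) ≤ℚ c₁ * (p′ ^ℚ k * (N * N))
        value≤ = ≤-trans (*-monoʳ (0≤* (^-nonneg k 0≤p) 0≤NN) c≤c₁) (≤-trans (≤-reflexive (assoc c₁ (½ ^ℚ k) (p ^ℚ k) (N * N)))
          (*-monoˡ (<⇒≤ 0<c₁) (*-monoʳ 0≤NN (≤-trans (≤-reflexive (≡-sym (^-* ½ p k))) (^-mono k (0≤* 0≤½ 0≤p) ½p≤p′)))))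
          where
          assoc : ∀ c h x y → c * h * (x * y) ≡ c * (h * x * y)
          assoc = solve-∀ ℚ-ring

      module Dense (¬sparse : ¬ hh ≤ℚ D * card H) where

        0≤D : 0ℚ ≤ℚ D
        0≤D = <⇒≤ 0<D
        D-card<hh : D * card H < hh
        D-card<hh = ≰⇒> ¬sparse
        0<hh : 0ℚ < hh
        0<hh = ≤-<-trans (0≤* 0≤D (card-nonneg H)) D-card<hh
        0<card-H : 0ℚ < card H
        0<card-H = square-positive (card-nonneg H) (<-≤-trans 0<hh (B≤card² H))
        0<card² : 0ℚ < card H * card H
        0<card² = 0<* 0<card-H 0<card-H
        p-H : ℚ
        p-H = hh * proj₁ (inverse 0<card²)
        edges-H : p-H * (card H * card H) ≡ hh
        edges-H = trans (regroup hh (proj₁ (inverse 0<card²)) (card H * card H))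
          (trans (cong (hh *_) (proj₂ (proj₂ (inverse 0<card²)))) (*-identityʳ hh))
          where
          regroup : ∀ l x y → l * x * y ≡ l * (y * x)
          regroup = solve-∀ ℚ-ring
        D≤ : D ≤ℚ p-H * card H
        D≤ = *-cancel 0<card-H (subst₂ _≤ℚ_ (*-comm D (card H)) (trans (≡-sym edges-H) (regroup p-H (card H))) (<⇒≤ D-card<hh))
          where
          regroup : ∀ p h → p * (h * h) ≡ h * (p * h)
          regroup = solve-∀ ℚ-ring
        0≤p-H : 0ℚ ≤ℚ p-H
        0≤p-H = 0≤* 0≤hh (<⇒≤ (proj₁ (proj₂ (inverse 0<card²))))
        p≤p-H : p ≤ℚ p-H
        p≤p-H = *-cancel 0<N (subst₂ _≤ℚ_ (*-comm p N) (*-comm p-H N) (≤-trans D≤ (*-monoˡ 0≤p-H (sum-mono H≤U))))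
        few-H : cliques (suc k) U ≤ℚ (1ℚ - ε) * (N ^ℚ suc k * p ^ℚ tri (suc k)) →
                cliques (suc k) H ≤ℚ (1ℚ - ε) * (card H ^ℚ suc k * p-H ^ℚ tri (suc k))
        few-H few = ≤-trans (cliques-mono (suc k) H≤U) (≤-trans few (*-monoˡ (≤⇒0≤ ε≤1)
          (subst₂ _≤ℚ_ (≡-sym (random-count N p)) (≡-sym (random-count (card H) p-H))
            (*-mono (^-nonneg (suc k) 0≤D) (^-mono (suc k) 0≤D D≤) (^-nonneg (i ℕ.+ tri j) 0≤p) (^-mono (i ℕ.+ tri j) 0≤p p≤p-H)))))
        -- A nonempty set has at least one element, so half of `N` is at most `N - ½`, and the bound
        -- on twice the size drops by one.
        bound-H : ∀ m → N ≤ℚ ½ * ℕ→ℚ (suc m) → card H ≤ℚ ½ * ℕ→ℚ m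
        bound-H m bound = ≤-trans card-H≤½N (≤-by (gap (ℕ→ℚ m) N)
          (0≤+ (0≤-resp (cong (λ y → ½ * y - N) (≡-sym (ℕ→ℚ-suc m))) (≤⇒0≤ bound)) (0≤* 0≤½ (≤⇒0≤ (sum-ind-positive U 0<N)))))
          where
          gap : ∀ y N → ½ * y - ½ * N ≡ (½ * (1ℚ + y) - N) + ½ * (N - 1ℚ)
          gap = solve-∀ ℚ-ring
        -- The constant is the same on both sides, so the passage to heavy vertices can be repeated
        -- without loss.
        value-H : c * (p ^ℚ k * (N * N)) ≤ℚ c * (p-H ^ℚ k * (card H * card H))
        value-H = *-monoˡ (<⇒≤ 0<c) (subst₂ _≤ℚ_ (≡-sym (surplus-size N p)) (≡-sym (surplus-size (card H) p-H))
          (*-mono (0≤* 0≤D 0≤D) (*-mono 0≤D D≤ 0≤D D≤) (^-nonneg i 0≤p) (^-mono i 0≤p p≤p-H)))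

  module _ {n} (G : Graph n) where

    open Form G
    open Cliques G
    open Certificate G

    -- Induction on an upper bound for 2 |U|; passing to the heavy vertices at least halves the set.
    reduce : ∀ m U p → card U ≤ℚ ½ * ℕ→ℚ m → 0ℚ < card U → p * (card U * card U) ≡ B (ι U) (ι U) →
      cliques (suc k) U ≤ℚ (1ℚ - ε) * (card U ^ℚ suc k * p ^ℚ tri (suc k)) →
      Achieves δ (ι U) (c * (p ^ℚ k * (card U * card U)))
    reduce zero U p bound 0<N = contradiction (<-≤-trans 0<N bound) (ℚₚ.<-irrefl refl)
    reduce (suc m) U p bound 0<N edges few = by-density (0ℚ ℚₚ.<? p)
      where
      Goal : Set
      Goal = Achieves δ (ι U) (c * (p ^ℚ k * (card U * card U)))
      0≤p : 0ℚ ≤ℚ p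
      0≤p = *-cancel (0<* 0<N 0<N) (≤-trans (≤-reflexive (*-zeroʳ (card U * card U)))
              (≤-trans (B-ι-nonneg U U) (≤-reflexive (trans (≡-sym edges) (*-comm p (card U * card U))))))
      vanish : ∀ c x y → c * (0ℚ * x * y) ≡ 0ℚ
      vanish = solve-∀ ℚ-ring
      heavy? : ∀ u → Dec (K₀ * (p * card U) < deg U u)
      heavy? u = K₀ * (p * card U) ℚₚ.<? deg U u
      heavy : Fin n → Bool
      heavy u = does (heavy? u)
      heavy-true : ∀ u → heavy u ≡ true → K₀ * (p * card U) ≤ℚ deg U u
      heavy-true u h = <⇒≤ (does-true (heavy? u) h)
      heavy-false : ∀ u → heavy u ≡ false → deg U u ≤ℚ K₀ * (p * card U)
      heavy-false u h = ℚₚ.≮⇒≥ (does-false (heavy? u) h)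

      module Positive (0<p : 0ℚ < p) where

        open Split.At G U p 0<N 0<p edges heavy heavy-true heavy-false

        by-heavy-density : Dec (hh ≤ℚ D * card H) → σ * T ≤ℚ vol → Goal
        by-heavy-density (yes sparse) large = cut-certificate large sparse
        by-heavy-density (no ¬sparse) large = achieves-weaken ≤-refl H≤U value-H
          (reduce m H p-H (bound-H m bound) 0<card-H edges-H (few-H few))
          where
          open Dense ¬sparse

        by-volume : vol ≤ℚ σ * T ⊎ σ * T ≤ℚ vol → Goal
        by-volume (inj₁ small) = core-certificate small few
        by-volume (inj₂ large) = by-heavy-density (hh ≤? D * card H) large

        goal : Goal
        goal = by-volume (≤-total vol (σ * T))

      by-density : Dec (0ℚ < p) → Goal
      by-density (yes 0<p) = Positive.goal 0<p
      by-density (no p≯0)  = achieves-weaken ≤-refl (λ _ → ≤-refl)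
        (≤-reflexive (trans (cong (λ y → c * (y * p ^ℚ j * (card U * card U))) (0≤⇒≡0 0≤p p≯0)) (vanish c (p ^ℚ j) (card U * card U))))
        (achieves-0 (ι-nonneg U))

-- From ordered cliques to copies of K_r.

tri≡C2 : ∀ r → r C 2 ≡ tri r
tri≡C2 zero    = refl
tri≡C2 (suc r) = trans (≡-sym (nCk+nC[k+1]≡[n+1]C[k+1] r 1)) (cong₂ ℕ._+_ (nC1≡n r) (tri≡C2 r))

allᵇ-elim : {A : Set} {p : A → Bool} (xs : List A) → allᵇ p xs ≡ true → ∀ {x} → x ∈ xs → p x ≡ true
allᵇ-elim {p = p} (y ∷ xs) h x∈ with p y in eq
allᵇ-elim (y ∷ xs) h (here refl) | true = eq
allᵇ-elim (y ∷ xs) h (there x∈)  | true = allᵇ-elim xs h x∈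

allᵇ-intro : {A : Set} {p : A → Bool} (xs : List A) → (∀ {x} → x ∈ xs → p x ≡ true) → allᵇ p xs ≡ true
allᵇ-intro []       h = refl
allᵇ-intro (y ∷ xs) h rewrite h (here refl) = allᵇ-intro xs (h ∘ there)

∧-elim : ∀ {b c} → b ∧ c ≡ true → (b ≡ true) × (c ≡ true)
∧-elim {true} h = refl , h

≡true? : ∀ b → (b ≡ true) ⊎ (b ≡ false)
≡true? true  = inj₁ refl
≡true? false = inj₂ refl

∈-pairs⁺ : ∀ {n} {i j : Fin n} → toℕ i ℕ.< toℕ j → (i , j) ∈ pairs n
∈-pairs⁺ {n} {i} {j} i<j = ∈-filter⁺ (λ ij → T? (toℕ (proj₁ ij) ℕ.<ᵇ toℕ (proj₂ ij)))
  (∈-concatMap⁺ (λ i → map (λ j → (i , j)) (allFin n)) (lose (∈-allFin i) (∈-map⁺ (λ j → (i , j)) (∈-allFin j)))) (ℕₚ.<⇒<ᵇ i<j)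

∈-pairs⁻ : ∀ {n} {i j : Fin n} → (i , j) ∈ pairs n → ¬ i ≡ j
∈-pairs⁻ {n} {i} h refl = ℕₚ.<-irrefl refl (ℕₚ.<ᵇ⇒< (toℕ i) (toℕ i) (proj₂ (∈-filter⁻ (λ ij → T? (toℕ (proj₁ ij) ℕ.<ᵇ toℕ (proj₂ ij)))
  {xs = concatMap (λ i → map (λ j → (i , j)) (allFin n)) (allFin n)} h)))

listSum-mono : {A : Set} {f g : A → ℚ} → (∀ x → f x ≤ℚ g x) → ∀ xs → listSum f xs ≤ℚ listSum g xs
listSum-mono h []       = ≤-refl
listSum-mono h (x ∷ xs) = +-mono-≤ (h x) (listSum-mono h xs)

listSum-*ˡ : {A : Set} (c : ℚ) (f : A → ℚ) (xs : List A) → listSum (λ x → c * f x) xs ≡ c * listSum f xs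
listSum-*ˡ c f []       = ≡-sym (*-zeroʳ c)
listSum-*ˡ c f (x ∷ xs) = trans (cong (c * f x +_) (listSum-*ˡ c f xs)) (≡-sym (ℚₚ.*-distribˡ-+ c (f x) (listSum f xs)))

listSum-sum : ∀ {m} {A : Set} (f : Fin m → A → ℚ) (xs : List A) → listSum (λ x → sum (λ i → f i x)) xs ≡ sum (λ i → listSum (f i) xs)
listSum-sum {m} f []       = ≡-sym (sum-replicate-zero m)
listSum-sum     f (x ∷ xs) = trans (cong (sum (λ i → f i x) +_) (listSum-sum f xs)) (≡-sym (sum-+ (λ i → f i x) (λ i → listSum (f i) xs)))

listSum-∈ : {A : Set} {f : A → ℚ} (xs : List A) → (∀ x → 0ℚ ≤ℚ f x) → ∀ {x} → x ∈ xs → f x ≤ℚ listSum f xs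
listSum-∈ {f = f} (y ∷ xs) h (here refl) = ≤-by (cancel (f y) (listSum f xs)) (listSum-nonneg xs)
  where
  cancel : ∀ a b → a + b - a ≡ b
  cancel = solve-∀ ℚ-ring
  listSum-nonneg : ∀ xs → 0ℚ ≤ℚ listSum f xs
  listSum-nonneg []       = ≤-refl
  listSum-nonneg (x ∷ xs) = 0≤+ (h x) (listSum-nonneg xs)
listSum-∈ {f = f} (y ∷ xs) h (there x∈) = ≤-trans (listSum-∈ xs h x∈) (≤-by (cancel (f y) (listSum f xs)) (h y))
  where
  cancel : ∀ a b → a + b - b ≡ a
  cancel = solve-∀ ℚ-ring

subsetSum : ∀ {n} → (Subset n → ℚ) → ℚ
subsetSum {n} F = listSum F (allSubsets n)

subsetSum-suc : ∀ {n} (F : Subset (suc n) → ℚ) → subsetSum F ≡ subsetSum (λ S → F (true ∷ S)) + subsetSum (λ S → F (false ∷ S))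
subsetSum-suc {n} F = trans (listSum-++ F (map (true ∷_) (allSubsets n)) (map (false ∷_) (allSubsets n)))
  (cong₂ _+_ (listSum-map F (true ∷_) (allSubsets n)) (listSum-map F (false ∷_) (allSubsets n)))

-- Inserting `v` is a bijection from the sets that avoid `v` to the sets that contain it.
subsetSum-insert : ∀ {n} (v : Fin n) (F : Subset n → ℚ) →
  subsetSum (λ S → ind (lookup S v) * F S) ≡ subsetSum (λ S → ind (not (lookup S v)) * F (S [ v ]≔ true))
subsetSum-insert {suc n} zero F = begin
  subsetSum (λ S → ind (lookup S zero) * F S)
    ≡⟨ subsetSum-suc (λ S → ind (lookup S zero) * F S) ⟩
  subsetSum (λ S → 1ℚ * F (true ∷ S)) + subsetSum (λ S → 0ℚ * F (false ∷ S))
    ≡⟨ cong₂ _+_ (listSum-*ˡ 1ℚ F⁺ (allSubsets n)) (listSum-*ˡ 0ℚ (λ S → F (false ∷ S)) (allSubsets n)) ⟩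
  1ℚ * subsetSum F⁺ + 0ℚ * subsetSum (λ S → F (false ∷ S))
    ≡⟨ move (subsetSum F⁺) (subsetSum (λ S → F (false ∷ S))) ⟩
  0ℚ * subsetSum F⁺ + 1ℚ * subsetSum F⁺
    ≡⟨ cong₂ _+_ (listSum-*ˡ 0ℚ F⁺ (allSubsets n)) (listSum-*ˡ 1ℚ F⁺ (allSubsets n)) ⟨
  subsetSum (λ S → 0ℚ * F⁺ S) + subsetSum (λ S → 1ℚ * F⁺ S)
    ≡⟨ subsetSum-suc (λ S → ind (not (lookup S zero)) * F (S [ zero ]≔ true)) ⟨
  subsetSum (λ S → ind (not (lookup S zero)) * F (S [ zero ]≔ true)) ∎
  where
  open ≡-Reasoning
  F⁺ : Subset n → ℚ
  F⁺ S = F (true ∷ S)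
  move : ∀ a b → 1ℚ * a + 0ℚ * b ≡ 0ℚ * a + 1ℚ * a
  move = solve-∀ ℚ-ring
subsetSum-insert {suc n} (suc v) F = trans (subsetSum-suc (λ S → ind (lookup S (suc v)) * F S))
  (trans (cong₂ _+_ (subsetSum-insert v (λ S → F (true ∷ S))) (subsetSum-insert v (λ S → F (false ∷ S))))
  (≡-sym (subsetSum-suc (λ S → ind (not (lookup S (suc v))) * F (S [ suc v ]≔ true)))))

size-insert : ∀ {n} (S : Subset n) v → lookup S v ≡ false → size (S [ v ]≔ true) ≡ suc (size S)
size-insert (false ∷ S) zero    h = refl
size-insert (true ∷ S)  (suc v) h = cong suc (size-insert S v h)
size-insert (false ∷ S) (suc v) h = size-insert S v h

sum-lookup : ∀ {n} (S : Subset n) → sum (λ v → ind (lookup S v)) ≡ ℕ→ℚ (size S)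
sum-lookup []          = refl
sum-lookup (true ∷ S)  = trans (cong (1ℚ +_) (sum-lookup S)) (≡-sym (ℕ→ℚ-suc (size S)))
sum-lookup (false ∷ S) = trans (+-identityˡ _) (sum-lookup S)

lookup-∅ : ∀ {n} (i : Fin n) → lookup (replicate n false) i ≡ false
lookup-∅ zero    = refl
lookup-∅ (suc i) = lookup-∅ i

size-∅ : ∀ n → size (replicate n false) ≡ 0
size-∅ zero    = refl
size-∅ (suc n) = size-∅ n

module CliqueCount {n} (G : Graph n) where

  open Form G
  open Cliques G
  open Surplus G using (∈-allSubsets)

  isClique-elim : ∀ S → isClique G S ≡ true → ∀ {i j} → ¬ i ≡ j → lookup S i ≡ true → lookup S j ≡ true → adj G i j ≡ true
  isClique-elim S h {i} {j} i≢j Si Sj with ℕₚ.<-cmp (toℕ i) (toℕ j)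
  ... | tri≈ _ eq _ = contradiction (Data.Fin.Properties.toℕ-injective eq) i≢j
  ... | tri< lt _ _ = subst (λ b → (if b then adj G i j else true) ≡ true) (cong₂ _∧_ Si Sj) (allᵇ-elim (pairs n) h (∈-pairs⁺ lt))
  ... | tri> _ _ gt = trans (Graph.sym G i j)
          (subst (λ b → (if b then adj G j i else true) ≡ true) (cong₂ _∧_ Sj Si) (allᵇ-elim (pairs n) h (∈-pairs⁺ gt)))

  isClique-intro : ∀ S → (∀ i j → ¬ i ≡ j → lookup S i ≡ true → lookup S j ≡ true → adj G i j ≡ true) → isClique G S ≡ true
  isClique-intro S h = allᵇ-intro (pairs n) pair
    where
    pair : ∀ {ij} → ij ∈ pairs n → (if lookup S (proj₁ ij) ∧ lookup S (proj₂ ij) then adj G (proj₁ ij) (proj₂ ij) else true) ≡ true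
    pair {i , j} ij∈ with lookup S i in Si | lookup S j in Sj
    ... | false | _     = refl
    ... | true  | false = refl
    ... | true  | true  = h i j (∈-pairs⁻ ij∈) Si Sj

  inside : VertexSet → Subset n → Bool
  inside U S = allᵇ (λ u → not (lookup S u) ∨ U u) (allFin n)

  inside-elim : ∀ U S → inside U S ≡ true → ∀ {u} → lookup S u ≡ true → U u ≡ true
  inside-elim U S h {u} Su = subst (λ b → not b ∨ U u ≡ true) Su (allᵇ-elim (allFin n) h (∈-allFin u))

  inside-intro : ∀ U S → (∀ u → lookup S u ≡ true → U u ≡ true) → inside U S ≡ true
  inside-intro U S h = allᵇ-intro (allFin n) (λ {u} _ → vertex u)
    where
    vertex : ∀ u → not (lookup S u) ∨ U u ≡ true
    vertex u with lookup S u in Su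
    ... | false = refl
    ... | true  = h u Su

  cliqueIn : ℕ → VertexSet → Subset n → Bool
  cliqueIn r U S = ((size S ℕ.≡ᵇ r) ∧ isClique G S) ∧ inside U S

  -- `S` lies in the neighbourhood of `v`, and there are no loops, so `v` is a new element adjacent
  -- to all of `S`.
  cliqueIn-extend : ∀ r U v S → U v ≡ true → cliqueIn r (U ∩N v) S ≡ true →
                    (lookup S v ≡ false) × (cliqueIn (suc r) U (S [ v ]≔ true) ≡ true)
  cliqueIn-extend r U v S Uv h = v∉S , cong₂ _∧_ (cong₂ _∧_ size≡ clique) inU
    where
    S′ = S [ v ]≔ true
    sizeS : (size S ℕ.≡ᵇ r) ≡ true
    sizeS = proj₁ (∧-elim (proj₁ (∧-elim h)))
    cliqueS : isClique G S ≡ true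
    cliqueS = proj₂ (∧-elim {size S ℕ.≡ᵇ r} (proj₁ (∧-elim h)))
    neighbour : ∀ {u} → lookup S u ≡ true → (U u ≡ true) × (adj G v u ≡ true)
    neighbour Su = ∧-elim (inside-elim (U ∩N v) S (proj₂ (∧-elim {(size S ℕ.≡ᵇ r) ∧ isClique G S} h)) Su)
    v∉S : lookup S v ≡ false
    v∉S with ≡true? (lookup S v)
    ... | inj₂ e = e
    ... | inj₁ e = contradiction (trans (≡-sym (irrefl G v)) (proj₂ (neighbour e))) (λ ())
    size≡ : (size S′ ℕ.≡ᵇ suc r) ≡ true
    size≡ = trans (cong (ℕ._≡ᵇ suc r) (size-insert S v v∉S)) sizeS
    old : ∀ {u} → ¬ u ≡ v → lookup S′ u ≡ true → lookup S u ≡ true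
    old {u} u≢v S′u = trans (≡-sym (lookup∘updateAt′ u v u≢v S)) S′u
    clique : isClique G S′ ≡ true
    clique = isClique-intro S′ adjacent
      where
      adjacent : ∀ i j → ¬ i ≡ j → lookup S′ i ≡ true → lookup S′ j ≡ true → adj G i j ≡ true
      adjacent i j i≢j S′i S′j with i Data.Fin.≟ v | j Data.Fin.≟ v
      ... | yes refl | yes refl = contradiction refl i≢j
      ... | yes refl | no j≢v   = proj₂ (neighbour (old j≢v S′j))
      ... | no i≢v   | yes refl = trans (Graph.sym G i v) (proj₂ (neighbour (old i≢v S′i)))
      ... | no i≢v   | no j≢v   = isClique-elim S cliqueS i≢j (old i≢v S′i) (old j≢v S′j)
    inU : inside U S′ ≡ true
    inU = inside-intro U S′ member
      where
      member : ∀ u → lookup S′ u ≡ true → U u ≡ true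
      member u S′u with u Data.Fin.≟ v
      ... | yes refl = Uv
      ... | no u≢v   = proj₁ (neighbour (old u≢v S′u))

  cliqueSets : ℕ → VertexSet → ℚ
  cliqueSets r U = subsetSum (λ S → ind (cliqueIn r U S))

  -- Counts pairs of a clique with `suc r` vertices and one of its vertices: removing that vertex
  -- leaves a clique in its neighbourhood.
  double-count : ∀ r U → sum (λ v → ι U v * cliqueSets r (U ∩N v)) ≤ℚ ℕ→ℚ (suc r) * cliqueSets (suc r) U
  double-count r U = ≤-trans (sum-mono step) (≤-reflexive regroup)
    where
    F : Subset n → ℚ
    F S = ind (cliqueIn (suc r) U S)
    term : ∀ v S → ι U v * ind (cliqueIn r (U ∩N v) S) ≤ℚ ind (not (lookup S v)) * F (S [ v ]≔ true)
    term v S with ≡true? (U v) | ≡true? (cliqueIn r (U ∩N v) S)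
    ... | inj₂ e | _      = ≤-trans (≤-reflexive (trans (cong (λ b → ind b * ind (cliqueIn r (U ∩N v) S)) e) (*-zeroˡ (ind (cliqueIn r (U ∩N v) S)))))
                              (0≤* (ind-nonneg (not (lookup S v))) (ind-nonneg (cliqueIn (suc r) U (S [ v ]≔ true))))
    ... | inj₁ _ | inj₂ e = ≤-trans (≤-reflexive (trans (cong (λ b → ι U v * ind b) e) (*-zeroʳ (ι U v))))
                              (0≤* (ind-nonneg (not (lookup S v))) (ind-nonneg (cliqueIn (suc r) U (S [ v ]≔ true))))
    ... | inj₁ e | inj₁ h with cliqueIn-extend r U v S e h
    ...   | v∉S , h′ = ≤-reflexive (trans (cong₂ (λ b c → ind b * ind c) e h) (≡-sym (cong₂ (λ b c → ind (not b) * ind c) v∉S h′)))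
    step : ∀ v → ι U v * cliqueSets r (U ∩N v) ≤ℚ subsetSum (λ S → ind (lookup S v) * F S)
    step v = ≤-trans (≤-reflexive (≡-sym (listSum-*ˡ (ι U v) (λ S → ind (cliqueIn r (U ∩N v) S)) (allSubsets n))))
      (≤-trans (listSum-mono (term v) (allSubsets n)) (≤-reflexive (≡-sym (subsetSum-insert v F))))
    by-size : ∀ S → sum (λ v → ind (lookup S v) * F S) ≡ ℕ→ℚ (suc r) * F S
    by-size S = trans (sum-cong-≗ (λ v → *-comm (ind (lookup S v)) (F S))) (trans (sum-*ˡ (F S) (λ v → ind (lookup S v)))
      (trans (cong (F S *_) (sum-lookup S)) (trans (*-comm (F S) (ℕ→ℚ (size S))) constant)))
      where
      constant : ℕ→ℚ (size S) * F S ≡ ℕ→ℚ (suc r) * F S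
      constant with ≡true? (cliqueIn (suc r) U S)
      ... | inj₂ e = trans (cong (λ b → ℕ→ℚ (size S) * ind b) e) (trans (*-zeroʳ (ℕ→ℚ (size S)))
                       (≡-sym (trans (cong (λ b → ℕ→ℚ (suc r) * ind b) e) (*-zeroʳ (ℕ→ℚ (suc r))))))
      ... | inj₁ e = cong (λ m → ℕ→ℚ m * F S) (ℕₚ.≡ᵇ⇒≡ (size S) (suc r) (Equivalence.from T-≡ (proj₁ (∧-elim (proj₁ (∧-elim e))))))
    regroup : sum (λ v → subsetSum (λ S → ind (lookup S v) * F S)) ≡ ℕ→ℚ (suc r) * cliqueSets (suc r) U
    regroup = trans (≡-sym (listSum-sum (λ v S → ind (lookup S v) * F S) (allSubsets n)))
      (trans (listSum-cong by-size (allSubsets n)) (listSum-*ˡ (ℕ→ℚ (suc r)) F (allSubsets n)))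

  cliques≤cliqueSets : ∀ r U → cliques r U ≤ℚ ℕ→ℚ (r !) * cliqueSets r U
  cliques≤cliqueSets zero U = ≤-trans (≤-reflexive (≡-sym (trans (*-identityˡ (ind (cliqueIn 0 U ∅))) (cong ind empty))))
    (*-monoˡ 0≤1 (listSum-∈ (allSubsets n) (λ S → ind-nonneg (cliqueIn 0 U S)) (∈-allSubsets ∅)))
    where
    ∅ : Subset n
    ∅ = replicate n false
    impossible : ∀ {A : Set} {u} → lookup ∅ u ≡ true → A
    impossible {u = u} h = contradiction (trans (≡-sym (lookup-∅ u)) h) (λ ())
    empty : cliqueIn 0 U ∅ ≡ true
    empty = cong₂ _∧_ (cong₂ _∧_ (cong (ℕ._≡ᵇ 0) (size-∅ n)) (isClique-intro ∅ (λ i j _ h _ → impossible h))) (inside-intro U ∅ (λ u h → impossible h))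
  cliques≤cliqueSets (suc r) U = begin
    sum (λ v → ι U v * cliques r (U ∩N v))
      ≤⟨ sum-mono (λ v → *-monoˡ (ι-nonneg U v) (cliques≤cliqueSets r (U ∩N v))) ⟩
    sum (λ v → ι U v * (ℕ→ℚ (r !) * cliqueSets r (U ∩N v)))
      ≡⟨ trans (sum-cong-≗ (λ v → swap (ι U v) (ℕ→ℚ (r !)) (cliqueSets r (U ∩N v)))) (sum-*ˡ (ℕ→ℚ (r !)) (λ v → ι U v * cliqueSets r (U ∩N v))) ⟩
    ℕ→ℚ (r !) * sum (λ v → ι U v * cliqueSets r (U ∩N v))
      ≤⟨ *-monoˡ (ℕ→ℚ-nonneg (r !)) (double-count r U) ⟩
    ℕ→ℚ (r !) * (ℕ→ℚ (suc r) * cliqueSets (suc r) U)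
      ≡⟨ trans (assoc (ℕ→ℚ (r !)) (ℕ→ℚ (suc r)) (cliqueSets (suc r) U)) (cong (_* cliqueSets (suc r) U) (≡-sym (ℕ→ℚ-* (suc r) (r !)))) ⟩
    ℕ→ℚ (suc r !) * cliqueSets (suc r) U ∎
    where
    open ≤-Reasoning
    swap : ∀ i f c → i * (f * c) ≡ f * (i * c)
    swap = solve-∀ ℚ-ring
    assoc : ∀ f s c → f * (s * c) ≡ s * f * c
    assoc = solve-∀ ℚ-ring

  cliqueSets≤copiesK : ∀ r U → cliqueSets r U ≤ℚ ℕ→ℚ (copiesK r G)
  cliqueSets≤copiesK r U = ≤-trans (listSum-mono forget (allSubsets n))
    (≤-reflexive (≡-sym (length-filter (λ S → (size S ℕ.≡ᵇ r) ∧ isClique G S) (allSubsets n))))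
    where
    forget : ∀ S → ind (cliqueIn r U S) ≤ℚ ind ((size S ℕ.≡ᵇ r) ∧ isClique G S)
    forget S = ≤-trans (≤-reflexive (ind-∧ ((size S ℕ.≡ᵇ r) ∧ isClique G S) (inside U S)))
      (≤-trans (*-monoˡ (ind-nonneg ((size S ℕ.≡ᵇ r) ∧ isClique G S)) (ind-≤1 (inside U S))) (≤-reflexive (*-identityʳ _)))

  cliques≤copiesK : ∀ r U → cliques r U ≤ℚ ℕ→ℚ (r !) * ℕ→ℚ (copiesK r G)
  cliques≤copiesK r U = ≤-trans (cliques≤cliqueSets r U) (*-monoˡ (ℕ→ℚ-nonneg (r !)) (cliqueSets≤copiesK r U))

-- The base case and the choice of constants.

inverse-≤1 : ∀ {p} (h : 1ℚ ≤ℚ p) → proj₁ (inverse (<-≤-trans 0<1 h)) ≤ℚ 1ℚ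
inverse-≤1 {p} h = ≤-trans (≤-trans (≤-reflexive (≡-sym (*-identityˡ p⁻¹))) (*-monoʳ (<⇒≤ (proj₁ (proj₂ inv-p))) h)) (≤-reflexive (proj₂ (proj₂ inv-p)))
  where
  inv-p = inverse (<-≤-trans 0<1 h)
  p⁻¹ = proj₁ inv-p

-- A quarter of ε / m, so that a power m costs at most a quarter of ε.
fraction : ∀ m ε → 1 ≤ m → 0ℚ < ε → ε ≤ℚ 1ℚ → Σ[ η ∈ ℚ ] (0ℚ < η) × (4ℚ * η ≤ℚ 1ℚ) × (ℕ→ℚ m * η ≡ ½ * ½ * ε)
fraction m ε 1≤m 0<ε ε≤1 = ½ * ½ * ε * i
  , 0<* (0<* (0<* 0<½ 0<½) 0<ε) (proj₁ (proj₂ inv-m))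
  , ≤-trans (≤-reflexive (quarter ε i)) (*-mono (<⇒≤ 0<ε) ε≤1 (<⇒≤ (proj₁ (proj₂ inv-m))) (inverse-≤1 (ℕ→ℚ-mono 1≤m)))
  , trans (regroup (ℕ→ℚ m) (½ * ½ * ε) i) (trans (cong (½ * ½ * ε *_) (proj₂ (proj₂ inv-m))) (*-identityʳ (½ * ½ * ε)))
  where
  inv-m = inverse (<-≤-trans 0<1 (ℕ→ℚ-mono 1≤m))
  i = proj₁ inv-m
  quarter : ∀ ε i → 4ℚ * (½ * ½ * ε * i) ≡ ε * i
  quarter = solve-∀ ℚ-ring
  regroup : ∀ m e i → m * (e * i) ≡ e * (m * i)
  regroup = solve-∀ ℚ-ring

bernoulli-1- : ∀ m {x} → x ≤ℚ 1ℚ → 1ℚ - ℕ→ℚ m * x ≤ℚ (1ℚ - x) ^ℚ m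
bernoulli-1- m {x} h = ≤-trans (≤-reflexive (shift (ℕ→ℚ m) x)) (bernoulli m (≤⇒0≤ h))
  where
  shift : ∀ m x → 1ℚ - m * x ≡ 1ℚ + m * (1ℚ - x - 1ℚ)
  shift = solve-∀ ℚ-ring

-- For edges the hypothesis says that `p * (N * N)` is at most `1 - ε` times itself. So the required
-- value is at most 0 and the empty family has it; the constants are arbitrary.
surplus-1 : SurplusFor 1
surplus-1 ε 0<ε ε≤1 = 1ℚ , 1ℚ , 0<1 , 0<1 , target
  where
  target : Target 1 ε 1ℚ 1ℚ
  target {n} G U p 0<N edges few = achieves-weaken ≤-refl (λ _ → ≤-refl) value≤0 (achieves-0 (ι-nonneg U))
    where
    open Form G
    open Cliques G
    open Certificate G
    N = card U
    swap : ∀ e p N → 0ℚ - e * (p * (N * N)) ≡ (1ℚ - e) * (N * (N * 1ℚ) * (p * 1ℚ)) - p * (N * N)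
    swap = solve-∀ ℚ-ring
    one : ∀ p N → 1ℚ * (p * 1ℚ * (N * N)) ≡ p * (N * N)
    one = solve-∀ ℚ-ring
    few′ : p * (N * N) ≤ℚ (1ℚ - ε) * (N * (N * 1ℚ) * (p * 1ℚ))
    few′ = subst (_≤ℚ (1ℚ - ε) * (N * (N * 1ℚ) * (p * 1ℚ))) (trans (cliques-2 U) (≡-sym edges)) few
    value≤0 : 1ℚ * (p * 1ℚ * (N * N)) ≤ℚ 0ℚ
    value≤0 = ≤-trans (≤-reflexive (one p N)) (*-cancel 0<ε (≤-trans (≤-by (swap ε p N) (≤⇒0≤ few′)) (≤-reflexive (≡-sym (*-zeroʳ ε)))))

target-mono-δ : ∀ {k ε c δ δ′} → δ′ ≤ℚ δ → Target k ε c δ → Target k ε c δ′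
target-mono-δ δ′≤δ target G U p 0<N edges few = Certificate.achieves-weaken G δ′≤δ (λ _ → ≤-refl) ≤-refl (target G U p 0<N edges few)

archimedean : ∀ {n} (f : Fin n → Bool) → Σ[ m ∈ ℕ ] sum (ind ∘ f) ≤ℚ ½ * ℕ→ℚ m
archimedean {n} f = 2 ℕ.* n , ≤-trans (bound f) (≤-reflexive (trans (half (ℕ→ℚ n)) (cong (½ *_) (≡-sym (ℕ→ℚ-* 2 n)))))
  where
  half : ∀ x → x ≡ ½ * (2ℚ * x)
  half = solve-∀ ℚ-ring
  bound : ∀ {m} (f : Fin m → Bool) → sum (ind ∘ f) ≤ℚ ℕ→ℚ m
  bound {zero}  f = ≤-refl
  bound {suc m} f = ≤-trans (+-mono-≤ (ind-≤1 (f zero)) (bound (f ∘ suc))) (≤-reflexive (≡-sym (ℕ→ℚ-suc m)))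

module Constants (i : ℕ) (previous : SurplusFor (suc i)) {ε : ℚ} (0<ε : 0ℚ < ε) (ε≤1 : ε ≤ℚ 1ℚ)
  {σ η : ℚ} (0<σ : 0ℚ < σ) (4σ≤1 : 4ℚ * σ ≤ℚ 1ℚ) (mσ : ℕ→ℚ (tri (suc (suc (suc i)))) * σ ≡ ½ * ½ * ε)
  (0<η : 0ℚ < η) (4η≤1 : 4ℚ * η ≤ℚ 1ℚ) (mη : ℕ→ℚ (suc (tri (suc (suc i)))) * η ≡ ½ * ½ * ε) where

  j k : ℕ
  j = suc i
  k = suc j

  η≤1 : η ≤ℚ 1ℚ
  η≤1 = ≤-by (gap η) (0≤+ (0≤* (ℚₚ.nonNegative⁻¹ (½ * ½)) (≤⇒0≤ 4η≤1)) (ℚₚ.nonNegative⁻¹ (½ * ½ * 3ℚ)))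
    where
    gap : ∀ x → 1ℚ - x ≡ ½ * ½ * (1ℚ - 4ℚ * x) + ½ * ½ * 3ℚ
    gap = solve-∀ ℚ-ring
  0<1-η : 0ℚ < 1ℚ - η
  0<1-η = <-≤-trans 0<½ (≤-by (gap η) (0≤+ (0≤* (ℚₚ.nonNegative⁻¹ (½ * ½)) (≤⇒0≤ 4η≤1)) (ℚₚ.nonNegative⁻¹ (½ * ½))))
    where
    gap : ∀ x → 1ℚ - x - ½ ≡ ½ * ½ * (1ℚ - 4ℚ * x) + ½ * ½
    gap = solve-∀ ℚ-ring
  2σ≤1 : 2ℚ * σ ≤ℚ 1ℚ
  2σ≤1 = ≤-by (gap σ) (0≤+ (0≤* 0≤½ (≤⇒0≤ 4σ≤1)) 0≤½)
    where
    gap : ∀ x → 1ℚ - 2ℚ * x ≡ ½ * (1ℚ - 4ℚ * x) + ½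
    gap = solve-∀ ℚ-ring
  σ-small : 1ℚ - ½ * ε ≤ℚ (1ℚ - 2ℚ * σ) ^ℚ tri (suc k)
  σ-small = ≤-trans (≤-reflexive (≡-sym (cong (λ y → 1ℚ - y) (trans (swap (ℕ→ℚ (tri (suc k))) σ) (trans (cong (2ℚ *_) mσ) (halve ε))))))
    (bernoulli-1- (tri (suc k)) 2σ≤1)
    where
    swap : ∀ m x → m * (2ℚ * x) ≡ 2ℚ * (m * x)
    swap = solve-∀ ℚ-ring
    halve : ∀ x → 2ℚ * (½ * ½ * x) ≡ ½ * x
    halve = solve-∀ ℚ-ring
  η-small : 1ℚ - ½ * (½ * ε) ≤ℚ (1ℚ - η) ^ℚ suc (tri k)
  η-small = ≤-trans (≤-reflexive (≡-sym (cong (λ y → 1ℚ - y) (trans mη (*-assoc ½ ½ ε))))) (bernoulli-1- (suc (tri k)) η≤1)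
  0<η⅛ : 0ℚ < η * ⅛
  0<η⅛ = 0<* 0<η (ℚₚ.positive⁻¹ ⅛)
  0<σσ¼ : 0ℚ < σ * σ * (½ * ½)
  0<σσ¼ = 0<* (0<* 0<σ 0<σ) (0<* 0<½ 0<½)
  four : ∀ x → 4ℚ * (x * (½ * ½)) ≡ x
  four = solve-∀ ℚ-ring

  choose : (Σ[ c₀ ∈ ℚ ] Σ[ δ₀ ∈ ℚ ] (0ℚ < c₀) × (0ℚ < δ₀) × Target j η c₀ δ₀) → (Σ[ σ⁻¹ ∈ ℚ ] (0ℚ < σ⁻¹) × (σ * σ⁻¹ ≡ 1ℚ)) →
           Σ[ c ∈ ℚ ] Σ[ δ ∈ ℚ ] (0ℚ < c) × (0ℚ < δ) × Target k ε c δ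
  choose (c₀ , δ₀ , 0<c₀ , 0<δ₀ , induction) (σ⁻¹ , 0<σ⁻¹ , σσ⁻¹) = chooseΓ (inverse 0<η⅛) (inverse 0<c₀′)
    where
    K₀ K δ κ₂ κ₁ : ℚ
    K₀ = ℕ→ℚ 6 * σ⁻¹
    K = 2ℚ * K₀
    -- Small enough for the induction hypothesis, for sparse neighbourhoods and for the cut at the
    -- heavy vertices, in this order.
    δ = δ₀ ⊓ ((η * ⅛) ⊓ (σ * σ * (½ * ½)))
    κ₂ = (K * K ^ℚ j) ^ℚ i
    κ₁ = κ₂ * (K ^ℚ i * K ^ℚ i)
    σK₀ : σ * K₀ ≡ ℕ→ℚ 6
    σK₀ = trans (swap σ (ℕ→ℚ 6) σ⁻¹) (trans (cong (ℕ→ℚ 6 *_) σσ⁻¹) (*-identityʳ (ℕ→ℚ 6)))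
      where
      swap : ∀ x y z → x * (y * z) ≡ y * (x * z)
      swap = solve-∀ ℚ-ring
    2≤K₀ : 2ℚ ≤ℚ K₀
    2≤K₀ = *-cancel 0<σ (≤-trans (≤-by (gap σ) (0≤+ (0≤* 0≤½ (≤⇒0≤ 4σ≤1)) (ℚₚ.nonNegative⁻¹ (ℕ→ℚ 11 * ½)))) (≤-reflexive (≡-sym σK₀)))
      where
      gap : ∀ x → ℕ→ℚ 6 - x * 2ℚ ≡ ½ * (1ℚ - 4ℚ * x) + ℕ→ℚ 11 * ½
      gap = solve-∀ ℚ-ring
    0<c₀′ : 0ℚ < c₀ * (1ℚ - η) ^ℚ j
    0<c₀′ = 0<* 0<c₀ (^-pos j 0<1-η)
    0<K : 0ℚ < K
    0<K = 0<* (ℚₚ.positive⁻¹ 2ℚ) (0<* (ℚₚ.positive⁻¹ (ℕ→ℚ 6)) 0<σ⁻¹)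
    0<κ₂ : 0ℚ < κ₂
    0<κ₂ = ^-pos i (0<* 0<K (^-pos j 0<K))
    0<κ₁ : 0ℚ < κ₁
    0<κ₁ = 0<* 0<κ₂ (0<* (^-pos i 0<K) (^-pos i 0<K))
    0<δ : 0ℚ < δ
    0<δ = 0<⊓ 0<δ₀ (0<⊓ 0<η⅛ 0<σσ¼)
    δ≤η : 8ℚ * δ ≤ℚ η
    δ≤η = ≤-trans (*-monoˡ (ℚₚ.nonNegative⁻¹ 8ℚ) (≤-trans (ℚₚ.p⊓q≤q δ₀ ((η * ⅛) ⊓ (σ * σ * (½ * ½)))) (ℚₚ.p⊓q≤p (η * ⅛) (σ * σ * (½ * ½)))))
      (≤-reflexive (eight η))
      where
      eight : ∀ x → 8ℚ * (x * (½ * ½ * ½)) ≡ x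
      eight = solve-∀ ℚ-ring
    δ≤σ : 4ℚ * δ ≤ℚ σ * σ
    δ≤σ = ≤-trans (*-monoˡ (ℚₚ.nonNegative⁻¹ 4ℚ) (≤-trans (ℚₚ.p⊓q≤q δ₀ ((η * ⅛) ⊓ (σ * σ * (½ * ½)))) (ℚₚ.p⊓q≤q (η * ⅛) (σ * σ * (½ * ½)))))
      (≤-reflexive (four (σ * σ)))
    induction′ : Target j η c₀ δ
    induction′ = target-mono-δ {j} {η} {c₀} (ℚₚ.p⊓q≤p δ₀ ((η * ⅛) ⊓ (σ * σ * (½ * ½)))) induction

    chooseΓ : (Σ[ y ∈ ℚ ] (0ℚ < y) × (η * ⅛ * y ≡ 1ℚ)) → (Σ[ z ∈ ℚ ] (0ℚ < z) × (c₀ * (1ℚ - η) ^ℚ j * z ≡ 1ℚ)) →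
              Σ[ c ∈ ℚ ] Σ[ δ ∈ ℚ ] (0ℚ < c) × (0ℚ < δ) × Target k ε c δ
    chooseΓ (y , 0<y , ηy) (z , 0<z , cz) = choose-c (inverse 0<2KΓ)
      where
      Γ : ℚ
      -- A sum of two positive terms, one for each lower bound on `Γ`.
      Γ = κ₁ * y + κ₂ * z
      split₁ : ∀ κ₁ κ₂ x y z → (κ₁ * y + κ₂ * z) * x ≡ κ₁ * (x * y) + κ₂ * z * x
      split₁ = solve-∀ ℚ-ring
      split₂ : ∀ κ₁ κ₂ x y z → (κ₁ * y + κ₂ * z) * x ≡ κ₂ * (x * z) + κ₁ * y * x
      split₂ = solve-∀ ℚ-ring
      absorb : ∀ {κ e w r} → e ≡ κ * w + r → w ≡ 1ℚ → 0ℚ ≤ℚ r → κ ≤ℚ e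
      absorb {κ} {r = r} refl refl 0≤r = ≤-by (cancel κ r) 0≤r
        where
        cancel : ∀ κ r → κ * 1ℚ + r - κ ≡ r
        cancel = solve-∀ ℚ-ring
      Γ-sparse : κ₁ ≤ℚ Γ * (η * ⅛)
      Γ-sparse = absorb (split₁ κ₁ κ₂ (η * ⅛) y z) ηy (<⇒≤ (0<* (0<* 0<κ₂ 0<z) 0<η⅛))
      Γ-cliques : κ₂ ≤ℚ Γ * (c₀ * (1ℚ - η) ^ℚ j)
      Γ-cliques = absorb (split₂ κ₁ κ₂ (c₀ * (1ℚ - η) ^ℚ j) y z) cz (<⇒≤ (0<* (0<* 0<κ₁ 0<y) 0<c₀′))
      0<Γ : 0ℚ < Γ
      0<Γ = ℚₚ.+-mono-< (0<* 0<κ₁ 0<y) (0<* 0<κ₂ 0<z)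
      0<2KΓ : 0ℚ < 2ℚ * K * Γ
      0<2KΓ = 0<* (0<* (ℚₚ.positive⁻¹ 2ℚ) 0<K) 0<Γ

      choose-c : (Σ[ y ∈ ℚ ] (0ℚ < y) × (2ℚ * K * Γ * y ≡ 1ℚ)) → Σ[ c ∈ ℚ ] Σ[ δ ∈ ℚ ] (0ℚ < c) × (0ℚ < δ) × Target k ε c δ
      choose-c (w , 0<w , 2KΓw) = c , δ , 0<c , 0<δ , target
        where
        c₁ c : ℚ
        c₁ = ½ * (½ * ε) * w
        -- The first term allows for the halved density after deletion, the second for the cut at
        -- the heavy vertices.
        c = (c₁ * ½ ^ℚ k) ⊓ (σ * σ * (½ * ½))
        0<c₁ : 0ℚ < c₁
        0<c₁ = 0<* (0<* 0<½ (0<* 0<½ 0<ε)) 0<w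
        0<c : 0ℚ < c
        0<c = 0<⊓ (0<* 0<c₁ (^-pos k 0<½)) 0<σσ¼
        c₁≤ : c₁ * (2ℚ * K * Γ) ≤ℚ ½ * (½ * ε)
        c₁≤ = ≤-reflexive (trans (regroup (½ * (½ * ε)) w (2ℚ * K * Γ)) (trans (cong (½ * (½ * ε) *_) 2KΓw) (*-identityʳ (½ * (½ * ε)))))
          where
          regroup : ∀ x w y → x * w * y ≡ x * (y * w)
          regroup = solve-∀ ℚ-ring
        c≤σ : 4ℚ * c ≤ℚ σ * σ
        c≤σ = ≤-trans (*-monoˡ (ℚₚ.nonNegative⁻¹ 4ℚ) (ℚₚ.p⊓q≤q (c₁ * ½ ^ℚ k) (σ * σ * (½ * ½)))) (≤-reflexive (four (σ * σ)))
        target : Target k ε c δ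
        target G U p 0<N edges few = Reduction.reduce i {ε} {σ} {K₀} {η} {δ} {c₀} {Γ} {c₁} {c}
          0<ε ε≤1 0<σ 4σ≤1 σ-small σK₀ 2≤K₀ 0<η η≤1 η-small 0<δ δ≤η δ≤σ 0<c₀ induction′ 0<Γ Γ-sparse Γ-cliques
          0<c₁ c₁≤ 0<c (ℚₚ.p⊓q≤p (c₁ * ½ ^ℚ k) (σ * σ * (½ * ½))) c≤σ
          G (proj₁ (archimedean U)) U p (proj₂ (archimedean U)) 0<N edges few

  surplus-k : Σ[ c ∈ ℚ ] Σ[ δ ∈ ℚ ] (0ℚ < c) × (0ℚ < δ) × Target k ε c δ
  surplus-k = choose (previous η 0<η η≤1) (inverse 0<σ)

surplus-suc : ∀ i → SurplusFor (suc i) → SurplusFor (suc (suc i))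
surplus-suc i previous ε 0<ε ε≤1 = combine (fraction (tri (suc k)) ε (ℕ.s≤s ℕ.z≤n) 0<ε ε≤1) (fraction (suc (tri k)) ε (ℕ.s≤s ℕ.z≤n) 0<ε ε≤1)
  where
  k = suc (suc i)
  combine : (Σ[ σ ∈ ℚ ] (0ℚ < σ) × (4ℚ * σ ≤ℚ 1ℚ) × (ℕ→ℚ (tri (suc k)) * σ ≡ ½ * ½ * ε)) →
            (Σ[ η ∈ ℚ ] (0ℚ < η) × (4ℚ * η ≤ℚ 1ℚ) × (ℕ→ℚ (suc (tri k)) * η ≡ ½ * ½ * ε)) →
            Σ[ c ∈ ℚ ] Σ[ δ ∈ ℚ ] (0ℚ < c) × (0ℚ < δ) × Target k ε c δ
  combine (σ , 0<σ , 4σ≤1 , mσ) (η , 0<η , 4η≤1 , mη) = Constants.surplus-k i previous 0<ε ε≤1 0<σ 4σ≤1 mσ 0<η 4η≤1 mη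

surplus : ∀ i → SurplusFor (suc i)
surplus zero    = surplus-1
surplus (suc i) = surplus-suc i (surplus i)

-- Application to the whole vertex set.

inv-cancel : ∀ k .{{_ : NonZero k}} → inv k * ℕ→ℚ k ≡ 1ℚ
inv-cancel k = /-*-cancel (ℤ.+ 1) k

module WholeGraph {n} .{{_ : NonZero n}} (G : Graph n) where

  open Form G
  open Cliques G
  open Certificate G

  V : VertexSet
  V _ = true

  N d p : ℚ
  N = ℕ→ℚ n
  d = avgDeg G
  p = d * inv n

  card-V : card V ≡ N
  card-V = total n
    where
    total : ∀ m → sum {m} (λ _ → 1ℚ) ≡ ℕ→ℚ m
    total zero    = refl
    total (suc m) = trans (cong (1ℚ +_) (total m)) (≡-sym (ℕ→ℚ-suc m))

  0<N : 0ℚ < N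
  0<N = <-≤-trans 0<1 (ℕ→ℚ-mono {1} {n} (ℕ.>-nonZero⁻¹ n))

  0<card : 0ℚ < card V
  0<card = subst (0ℚ <_) (≡-sym card-V) 0<N

  pN≡d : p * N ≡ d
  pN≡d = trans (*-assoc d (inv n) N) (trans (cong (d *_) (inv-cancel n)) (*-identityʳ d))

  edges : p * (card V * card V) ≡ B (ι V) (ι V)
  edges = trans (cong (λ y → p * (y * y)) card-V) (trans (≡-sym (*-assoc p N N))
    (trans (cong (_* N) pN≡d) (trans (/-*-cancel (ℤ.+ (2 ℕ.* e G)) n) (≡-sym (Surplus.edges-B G)))))

  0≤p : 0ℚ ≤ℚ p
  0≤p = *-cancel (0<* 0<card 0<card) (≤-trans (≤-reflexive (*-zeroʳ (card V * card V)))
    (≤-trans (B-ι-nonneg V V) (≤-reflexive (trans (≡-sym edges) (*-comm p (card V * card V))))))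

  few-cliques : ∀ r {ε ε′} → ε′ ≤ℚ ε →
    ℕ→ℚ (copiesK r G) ≤ℚ (1ℚ - ε) * (ℕ→ℚ (n ℕ.^ r) * inv (r !) {{r !≢0}}) * (p ^ℚ (r C 2)) →
    cliques r V ≤ℚ (1ℚ - ε′) * (card V ^ℚ r * p ^ℚ tri r)
  few-cliques r {ε} {ε′} ε′≤ε few = ≤-trans (CliqueCount.cliques≤copiesK G r V) (≤-trans (*-monoˡ (ℕ→ℚ-nonneg (r !)) few)
    (≤-trans (≤-reflexive cancel-r!)
      (*-monoʳ (0≤* (^-nonneg r (<⇒≤ 0<card)) (^-nonneg (tri r) 0≤p)) (+-monoʳ-≤ 1ℚ (ℚₚ.neg-antimono-≤ ε′≤ε)))))
    where
    regroup : ∀ f e N i P → f * (e * (N * i) * P) ≡ e * (N * P) * (i * f)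
    regroup = solve-∀ ℚ-ring
    cancel-r! : ℕ→ℚ (r !) * ((1ℚ - ε) * (ℕ→ℚ (n ℕ.^ r) * inv (r !) {{r !≢0}}) * (p ^ℚ (r C 2))) ≡ (1ℚ - ε) * (card V ^ℚ r * p ^ℚ tri r)
    cancel-r! = begin
      ℕ→ℚ (r !) * ((1ℚ - ε) * (ℕ→ℚ (n ℕ.^ r) * inv (r !) {{r !≢0}}) * (p ^ℚ (r C 2)))
        ≡⟨ regroup (ℕ→ℚ (r !)) (1ℚ - ε) (ℕ→ℚ (n ℕ.^ r)) (inv (r !) {{r !≢0}}) (p ^ℚ (r C 2)) ⟩
      (1ℚ - ε) * (ℕ→ℚ (n ℕ.^ r) * p ^ℚ (r C 2)) * (inv (r !) {{r !≢0}} * ℕ→ℚ (r !))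
        ≡⟨ cong ((1ℚ - ε) * (ℕ→ℚ (n ℕ.^ r) * p ^ℚ (r C 2)) *_) (inv-cancel (r !) {{r !≢0}}) ⟩
      (1ℚ - ε) * (ℕ→ℚ (n ℕ.^ r) * p ^ℚ (r C 2)) * 1ℚ
        ≡⟨ *-identityʳ ((1ℚ - ε) * (ℕ→ℚ (n ℕ.^ r) * p ^ℚ (r C 2))) ⟩
      (1ℚ - ε) * (ℕ→ℚ (n ℕ.^ r) * p ^ℚ (r C 2))
        ≡⟨ cong₂ (λ y m → (1ℚ - ε) * (y * p ^ℚ m)) (trans (ℕ→ℚ-^ n r) (cong (_^ℚ r) (≡-sym card-V))) (tri≡C2 r) ⟩
      (1ℚ - ε) * (card V ^ℚ r * p ^ℚ tri r) ∎
      where open ≡-Reasoning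

  d^-scale : ∀ q → d ^ℚ suc (suc q) * inv (n ℕ.^ q) {{m^n≢0 n q}} ≡ p ^ℚ suc (suc q) * (card V * card V)
  d^-scale q = begin
    d ^ℚ k * s                        ≡⟨ cong (λ y → y ^ℚ k * s) pN≡d ⟨
    (p * N) ^ℚ k * s                  ≡⟨ cong (_* s) (^-* p N k) ⟩
    p ^ℚ k * N ^ℚ k * s               ≡⟨ regroup (p ^ℚ k) N (N ^ℚ q) s ⟩
    p ^ℚ k * (N * N) * (s * N ^ℚ q)   ≡⟨ cong (λ y → p ^ℚ k * (N * N) * (s * y)) (ℕ→ℚ-^ n q) ⟨
    p ^ℚ k * (N * N) * (s * ℕ→ℚ (n ℕ.^ q)) ≡⟨ cong (p ^ℚ k * (N * N) *_) (inv-cancel (n ℕ.^ q) {{m^n≢0 n q}}) ⟩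
    p ^ℚ k * (N * N) * 1ℚ             ≡⟨ *-identityʳ (p ^ℚ k * (N * N)) ⟩
    p ^ℚ k * (N * N)                  ≡⟨ cong (λ y → p ^ℚ k * (y * y)) card-V ⟨
    p ^ℚ k * (card V * card V)        ∎
    where
    open ≡-Reasoning
    k = suc (suc q)
    s = inv (n ℕ.^ q) {{m^n≢0 n q}}
    regroup : ∀ P N Nq x → P * (N * (N * Nq)) * x ≡ P * (N * N) * (x * Nq)
    regroup = solve-∀ ℚ-ring

  -- The quarter undoes the 4 in `sp-bound`, and `δ * ½` is the scaling in `achieves-bound`.
  achieves-sp : ∀ {δ v} → 0ℚ ≤ℚ δ → δ ≤ℚ 1ℚ → Achieves δ (ι V) v → ½ * ½ * (δ * ½) * v ≤ℚ sp G
  achieves-sp {δ} {v} 0≤δ δ≤1 A = ≤-trans (≤-reflexive (*-assoc (½ * ½) (δ * ½) v)) (≤-trans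
    (*-monoˡ (ℚₚ.nonNegative⁻¹ (½ * ½)) (achieves-bound {4ℚ * sp G} {δ} 0≤δ δ≤1 (λ u → ≤-refl) (Surplus.sp-bound G) A))
    (≤-reflexive (quarter (sp G))))
    where
    quarter : ∀ s → ½ * ½ * (4ℚ * s) ≡ s
    quarter = solve-∀ ℚ-ring

  target-sp : ∀ q {ε c δ} → 0ℚ ≤ℚ δ → δ ≤ℚ 1ℚ → Target (suc (suc q)) ε c δ →
    ∀ r → r ≡ suc (suc (suc q)) → cliques r V ≤ℚ (1ℚ - ε) * (card V ^ℚ r * p ^ℚ tri r) →
    ½ * ½ * (δ * ½) * c * d ^ℚ suc (suc q) * inv (n ℕ.^ q) {{m^n≢0 n q}} ≤ℚ sp G
  target-sp q {c = c} {δ} 0≤δ δ≤1 target r refl few = ≤-trans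
    (≤-reflexive (trans (regroup (½ * ½ * (δ * ½)) c (d ^ℚ suc (suc q)) (inv (n ℕ.^ q) {{m^n≢0 n q}}))
      (cong (λ y → ½ * ½ * (δ * ½) * (c * y)) (d^-scale q))))
    (achieves-sp 0≤δ δ≤1 (target G V p 0<card edges few))
    where
    regroup : ∀ a c y x → a * c * y * x ≡ a * (c * (y * x))
    regroup = solve-∀ ℚ-ring

theorem1p8 : (r : ℕ) → 3 ≤ r → (ε : ℚ) → 0ℚ < ε →
    Σ ℚ (λ c → (0ℚ < c) ×
    ((n : ℕ) .{{_ : NonZero n}} (G : Graph n) →
    ℕ→ℚ (copiesK r G) ≤ℚ
    (1ℚ - ε) * (ℕ→ℚ (n ℕ.^ r) * inv (r !) {{r !≢0}}) * ((avgDeg G * inv n) ^ℚ (r C 2)) →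
    c * (avgDeg G ^ℚ (r ∸ 1)) * inv (n ℕ.^ (r ∸ 3)) {{m^n≢0 n (r ∸ 3)}} ≤ℚ sp G))
theorem1p8 r@(suc (suc (suc q))) (ℕ.s≤s (ℕ.s≤s (ℕ.s≤s ℕ.z≤n))) ε 0<ε =
  -- The induction assumes `ε` at most 1; lowering `ε` only raises the clique count allowed by the
  -- hypothesis.
  finish (surplus (suc q) (ε ⊓ 1ℚ) (0<⊓ 0<ε 0<1) (ℚₚ.p⊓q≤q ε 1ℚ))
  where
  finish : (Σ[ c ∈ ℚ ] Σ[ δ ∈ ℚ ] (0ℚ < c) × (0ℚ < δ) × Target (suc (suc q)) (ε ⊓ 1ℚ) c δ) → _
  finish (c , δ₀ , 0<c , 0<δ₀ , target) = ½ * ½ * (δ * ½) * c , 0<* (0<* (0<* 0<½ 0<½) (0<* 0<δ 0<½)) 0<c , bound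
    where
    δ : ℚ
    δ = δ₀ ⊓ 1ℚ
    0<δ : 0ℚ < δ
    0<δ = 0<⊓ 0<δ₀ 0<1
    bound : (n : ℕ) .{{_ : NonZero n}} (G : Graph n) →
      ℕ→ℚ (copiesK r G) ≤ℚ (1ℚ - ε) * (ℕ→ℚ (n ℕ.^ r) * inv (r !) {{r !≢0}}) * ((avgDeg G * inv n) ^ℚ (r C 2)) →
      ½ * ½ * (δ * ½) * c * (avgDeg G ^ℚ (r ∸ 1)) * inv (n ℕ.^ (r ∸ 3)) {{m^n≢0 n (r ∸ 3)}} ≤ℚ sp G
    bound n G few = WholeGraph.target-sp G q {ε ⊓ 1ℚ} {c} {δ} (<⇒≤ 0<δ) (ℚₚ.p⊓q≤q δ₀ 1ℚ)
      (target-mono-δ {suc (suc q)} {ε ⊓ 1ℚ} {c} {δ₀} {δ} (ℚₚ.p⊓q≤p δ₀ 1ℚ) target)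
      r refl (WholeGraph.few-cliques G r {ε} {ε ⊓ 1ℚ} (ℚₚ.p⊓q≤p ε 1ℚ) few)
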